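{- For every $\epsilon>0$, the algorithm $\mathcal{A}_\epsilon$ described in the context is a $(1+4\sqrt{2}+\epsilon)$-approximation algorithm for the GGMST. That is, for each fixed $\epsilon>0$, on every GGMST instance, $\mathcal{A}_\epsilon$ runs in polynomial time and outputs a feasible solution $T_A$ satisfying $$w(T_A)\le (1+4\sqrt{2}+\epsilon)\,w(T_{opt}),$$ where $T_{opt}$ is an optimal solution of the instance.
   Context: GGMST (geometric generalized minimum spanning tree problem in grid clusters). The plane $\mathbb{R}^2$ is divided by the integer grid into $1\times 1$ cells $[a,a+1]\times[b,b+1]$, $a,b\in\mathbb{Z}$. An instance is a finite non-empty set $V\subset\mathbb{R}^2$ of $n$ points; each point is assigned to exactly one cell containing it (a point on a cell border is assigned to just one of the neighbouring cells, by any rule). A cell is non-empty if at least one point is assigned to it; "point in a cell" means assigned to it. The number of non-empty cells is denoted $N+1$. The edge $e_{u,v}$ between points $u,v$ has weight $w(e_{u,v})$ equal to their Euclidean distance, and the weight of a graph is the sum of the weights of its edges. A feasible solution is a tree, whose vertices are points of $V$, containing exactly one point from each non-empty cell (so it has $N$ edges). An optimal solution $T_{opt}$ is a feasible solution of minimum weight. Algorithm $\mathcal{A}_\epsilon$: if $N\le 15$ or $N\le 10\sqrt{2}/\epsilon$, then for every spanning tree $T$ of the complete graph on the non-empty cells, compute (by dynamic programming over $T$ rooted at an arbitrary cell) a minimum-weight feasible solution having the same structure as $T$ (i.e. the chosen points of two cells are adjacent iff the cells are adjacent in $T$), and output the one of minimum weight over all $T$. The dynamic program sets $W(p)=0$ for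 the points $p$ of leaf cells, and for a point $p$ of a cell with child cells having point sets $X_{1},\dots,X_{k}$ it sets $W(p)=\sum_{j=1}^k\min_{q\in X_{j}}\{W(q)+w(e_{p,q})\}$; the optimum for $T$ is the minimum of $W(p)$ over points $p$ of the root cell. Otherwise, run the following procedure. (1) Compute a minimum spanning tree $T$ of the complete graph on the non-empty cells, where the distance between two cells is the smallest weight of an edge $e_{p_1,p_2}$ with $p_1$ in the first cell and $p_2$ in the second. (2) Let $G$ be the graph on points consisting of the shortest edges (with their endpoints) corresponding to the edges of $T$. (3) For each cell $C$ that contains more than one point of $G$: let $C_G$ be the set of points of $G$ in $C$, let $p$ be a point of $V$ in $C$ minimizing $\sum_{c\in C_G}w(e_{c,p})$, and replace $C_G$ by $p$, i.e. every edge of $G$ entering $C$ is reconnected to $p$. (4) Return $G$. -}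

module Defs where

open import Algebra.Structures using (IsCommutativeRing)
open import Data.Bool.Base using (Bool; true; false; if_then_else_; _∨_)
open import Data.Integer.Base using (ℤ; +_; -[1+_])
import Data.Integer.Properties as ℤ
open import Data.List.Base using (List; []; _∷_; _++_; length)
open import Data.List.Membership.Propositional using (_∈_)
open import Data.List.NonEmpty.Base as List⁺ using (List⁺; _∷_; _∷⁺_; toList)
open import Data.List.Relation.Unary.All using (All)
open import Data.List.Relation.Unary.AllPairs using (AllPairs)
open import Data.List.Relation.Unary.Linked using (Linked)
open import Data.List.Relation.Unary.Unique.Propositional using (Unique)
open import Data.Nat.Base as ℕ using (ℕ; zero; suc)
open import Data.Product using (Σ; ∃; ∃!; _×_; _,_; proj₁; proj₂)
open import Data.Product.Properties using (≡-dec)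
open import Data.Sum.Base using (_⊎_)
open import Data.Vec.Base using (Vec; []; _∷_)
open import Function.Base using (_∘_)
open import Relation.Binary.Construct.Closure.ReflexiveTransitive using (Star)
open import Relation.Binary.Definitions using (DecidableEquality)
open import Relation.Binary.PropositionalEquality using (_≡_; _≢_)
open import Relation.Binary.Structures using (IsDecTotalOrder)
open import Relation.Nullary using (¬_; does)

-- An ordered field in which non-negative elements have square roots, with
-- decidable equality and order.  The values of `0# ⁻¹`, and of `√` at negative
-- arguments, are unspecified.
record EuclideanField : Set₁ where
  infix  9 _⁻¹
  infix  8 -_
  infixl 7 _*_
  infixl 6 _+_ _-_
  infix  4 _≤_ _<_
  field
    ℝ       : Set
    _+_ _*_ : ℝ → ℝ → ℝ
    -_ _⁻¹  : ℝ → ℝ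
    √       : ℝ → ℝ
    0# 1#   : ℝ
    _≤_     : ℝ → ℝ → Set

    isCommutativeRing : IsCommutativeRing _≡_ _+_ _*_ -_ 0# 1#
    0≢1               : 0# ≢ 1#
    *-inverseʳ        : ∀ x → x ≢ 0# → x * x ⁻¹ ≡ 1#

    isDecTotalOrder : IsDecTotalOrder _≡_ _≤_
    +-monoˡ-≤       : ∀ z {x y} → x ≤ y → x + z ≤ y + z
    *-nonNegative   : ∀ {x y} → 0# ≤ x → 0# ≤ y → 0# ≤ x * y

    √-nonNegative : ∀ {x} → 0# ≤ x → 0# ≤ √ x
    √-square      : ∀ {x} → 0# ≤ x → √ x * √ x ≡ x

  open IsDecTotalOrder isDecTotalOrder public using (_≟_; _≤?_)

  _-_ : ℝ → ℝ → ℝ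
  x - y = x + - y

  _<_ : ℝ → ℝ → Set
  x < y = x ≤ y × x ≢ y

  fromℕ : ℕ → ℝ
  fromℕ zero    = 0#
  fromℕ (suc n) = 1# + fromℕ n

  fromℤ : ℤ → ℝ
  fromℤ (+ n)    = fromℕ n
  fromℤ -[1+ n ] = - fromℕ (suc n)

  UpperBound : (ℝ → Set) → ℝ → Set
  UpperBound P b = ∀ x → P x → x ≤ b

-- The real numbers of classical mathematics, which these axioms determine up
-- to isomorphism.  Classically `archimedean`, the square root and decidability
-- are redundant in the presence of `complete`.
record Reals : Set₁ where
  field
    euclideanField : EuclideanField

  open EuclideanField euclideanField public

  field
    archimedean : ∀ x → ∃ λ n → x ≤ fromℕ n
    complete    : (P : ℝ → Set) → ∃ P → ∃ (UpperBound P) →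
                  ∃ λ s → UpperBound P s × (∀ b → UpperBound P b → s ≤ b)

-- Running times.  `pure` costs one step and binding adds up costs.  Apart from
-- these, `after` is used only for operations and comparisons of reals (unit
-- cost, as in the real RAM), for comparing two naturals, and for comparing the
-- cells of two points.  All other code in `Timed` does a bounded amount of work
-- between two of these steps.
infix 2 _after_

record Timed (A : Set) : Set where
  constructor _after_
  field
    value : A
    steps : ℕ

open Timed public

private
  variable
    A B : Set

pure : A → Timed A
pure x = x after 1

infixl 1 _>>=_

_>>=_ : Timed A → (A → Timed B) → Timed B
m >>= f = value (f (value m)) after (steps m ℕ.+ steps (f (value m)))

appendᵗ : List A → List A → Timed (List A)
appendᵗ []       ys = pure ys
appendᵗ (x ∷ xs) ys = do
  zs ← appendᵗ xs ys
  pure (x ∷ zs)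

mapᵗ : (A → Timed B) → List A → Timed (List B)
mapᵗ f []       = pure []
mapᵗ f (x ∷ xs) = do
  y  ← f x
  ys ← mapᵗ f xs
  pure (y ∷ ys)

map⁺ᵗ : (A → Timed B) → List⁺ A → Timed (List⁺ B)
map⁺ᵗ f (x ∷ xs) = do
  y  ← f x
  ys ← mapᵗ f xs
  pure (y ∷ ys)

concatMapᵗ : (A → Timed (List⁺ B)) → List A → Timed (List B)
concatMapᵗ f []       = pure []
concatMapᵗ f (x ∷ xs) = do
  ys ← f x
  zs ← concatMapᵗ f xs
  appendᵗ (toList ys) zs

concatMap⁺ᵗ : (A → Timed (List⁺ B)) → List⁺ A → Timed (List⁺ B)
concatMap⁺ᵗ f (x ∷ xs) = do
  y ∷ ys ← f x
  zs     ← concatMapᵗ f xs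
  ws     ← appendᵗ ys zs
  pure (y ∷ ws)

filterᵗ : (A → Timed Bool) → List A → Timed (List A)
filterᵗ p []       = pure []
filterᵗ p (x ∷ xs) = do
  b  ← p x
  ys ← filterᵗ p xs
  pure (if b then x ∷ ys else ys)

lengthᵗ : List A → Timed ℕ
lengthᵗ []       = pure 0
lengthᵗ (x ∷ xs) = do
  n ← lengthᵗ xs
  pure (suc n)

toVecᵗ : (xs : List A) → Timed (Vec A (length xs))
toVecᵗ []       = pure []
toVecᵗ (x ∷ xs) = do
  ys ← toVecᵗ xs
  pure (x ∷ ys)

-- All ways of taking one element out of a vector.
selectᵗ : ∀ {n} → Vec A (suc n) → Timed (List⁺ (A × Vec A n))
selectᵗ (x ∷ [])         = pure ((x , []) ∷ [])
selectᵗ (x ∷ xs@(_ ∷ _)) = do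
  ys ← selectᵗ xs
  zs ← mapᵗ (λ (y , rest) → pure (y , x ∷ rest)) (toList ys)
  pure ((x , xs) ∷ zs)

_≤ℕᵗ_ : ℕ → ℕ → Timed Bool
m ≤ℕᵗ n = (m ℕ.≤ᵇ n) after 1

module GGMST (R : Reals) where

  open Reals R public

  Point : Set
  Point = ℝ × ℝ

  _≟ₚ_ : DecidableEquality Point
  _≟ₚ_ = ≡-dec _≟_ _≟_

  dist : Point → Point → ℝ
  dist (x₁ , y₁) (x₂ , y₂) =
    √ ((x₁ - x₂) * (x₁ - x₂) + (y₁ - y₂) * (y₁ - y₂))

  -- (a , b) stands for the cell [a, a+1] × [b, b+1].
  Cell : Set
  Cell = ℤ × ℤ

  _≟ᶜ_ : DecidableEquality Cell
  _≟ᶜ_ = ≡-dec ℤ._≟_ ℤ._≟_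

  _∈ᶜ_ : Point → Cell → Set
  (x , y) ∈ᶜ (a , b) = (fromℤ a ≤ x × x ≤ fromℤ a + 1#)
                     × (fromℤ b ≤ y × y ≤ fromℤ b + 1#)

  -- The assignment of points to cells is part of the instance, and is
  -- constrained only on the given points.
  record Instance : Set where
    field
      points        : List⁺ Point
      distinct      : Unique (toList points)
      cell          : Point → Cell
      cell-contains : All (λ p → p ∈ᶜ cell p) (toList points)

    size : ℕ
    size = List⁺.length points

    NonEmpty : Cell → Set
    NonEmpty c = ∃ λ p → p ∈ toList points × cell p ≡ c

  -- Edges are undirected: (u , v) and (v , u) are the same edge.
  Edge : Set
  Edge = Point × Point

  SameEdge : Edge → Edge → Set
  SameEdge (u , v) (u′ , v′) = (u ≡ u′ × v ≡ v′) ⊎ (u ≡ v′ × v ≡ u′)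

  record Graph : Set where
    constructor graph
    field
      vertices : List Point
      edges    : List Edge

  open Graph public

  edgesWeight : List Edge → ℝ
  edgesWeight []             = 0#
  edgesWeight ((u , v) ∷ es) = dist u v + edgesWeight es

  weight : Graph → ℝ
  weight G = edgesWeight (edges G)

  Adjacent : Graph → Point → Point → Set
  Adjacent G u v = (u , v) ∈ edges G ⊎ (v , u) ∈ edges G

  record IsSimpleGraph (G : Graph) : Set where
    field
      vertices-distinct : Unique (vertices G)
      edges-endpoints   : All (λ (u , v) → u ∈ vertices G × v ∈ vertices G)
                              (edges G)
      no-loops          : All (λ (u , v) → u ≢ v) (edges G)
      edges-distinct    : AllPairs (λ e e′ → ¬ SameEdge e e′) (edges G)

  record IsCycle (G : Graph) (v : Point) (vs : List Point) : Set where
    field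
      closed-walk : Linked (Adjacent G) (v ∷ vs ++ v ∷ [])
      no-repeats  : Unique (v ∷ vs)
      long        : 3 ℕ.≤ length (v ∷ vs)

  record IsTree (G : Graph) : Set where
    field
      simple    : IsSimpleGraph G
      nonempty  : ∃ λ v → v ∈ vertices G
      connected : ∀ {u v} → u ∈ vertices G → v ∈ vertices G →
                  Star (Adjacent G) u v
      acyclic   : ∀ v vs → ¬ IsCycle G v vs

  module _ (I : Instance) where
    open Instance I

    record IsFeasible (G : Graph) : Set where
      field
        isTree        : IsTree G
        from-points   : All (_∈ toList points) (vertices G)
        one-per-cell  : ∀ c → NonEmpty c →
                        ∃! _≡_ λ v → v ∈ vertices G × cell v ≡ c

    record IsOptimal (G : Graph) : Set where
      field
        feasible : IsFeasible G
        minimum  : ∀ G′ → IsFeasible G′ → weight G ≤ weight G′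

  _+ᵗ_ _-ᵗ_ _*ᵗ_ _/ᵗ_ : ℝ → ℝ → Timed ℝ
  x +ᵗ y = (x + y)    after 1
  x -ᵗ y = (x - y)    after 1
  x *ᵗ y = (x * y)    after 1
  x /ᵗ y = (x * y ⁻¹) after 1

  √ᵗ : ℝ → Timed ℝ
  √ᵗ x = √ x after 1

  _≤ᵗ_ _≡ᵗ_ : ℝ → ℝ → Timed Bool
  x ≤ᵗ y = does (x ≤? y) after 1
  x ≡ᵗ y = does (x ≟ y) after 1

  fromℕᵗ : ℕ → Timed ℝ
  fromℕᵗ zero    = pure 0#
  fromℕᵗ (suc n) = do
    x ← fromℕᵗ n
    1# +ᵗ x

  samePointᵗ : Point → Point → Timed Bool
  samePointᵗ (x₁ , y₁) (x₂ , y₂) = do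
    b ← x₁ ≡ᵗ x₂
    c ← y₁ ≡ᵗ y₂
    pure (if b then c else false)

  distᵗ : Point → Point → Timed ℝ
  distᵗ (x₁ , y₁) (x₂ , y₂) = do
    dx ← x₁ -ᵗ x₂
    dy ← y₁ -ᵗ y₂
    a  ← dx *ᵗ dx
    b  ← dy *ᵗ dy
    s  ← a +ᵗ b
    √ᵗ s

  sumᵗ : (A → Timed ℝ) → List A → Timed ℝ
  sumᵗ f []       = pure 0#
  sumᵗ f (x ∷ xs) = do
    a ← f x
    s ← sumᵗ f xs
    a +ᵗ s

  -- Ties are broken in favour of the element that comes first.
  argminFromᵗ : (A → Timed ℝ) → A → List A → Timed A
  argminFromᵗ f x []       = pure x
  argminFromᵗ f x (y ∷ ys) = do
    z ← argminFromᵗ f y ys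
    a ← f x
    b ← f z
    c ← a ≤ᵗ b
    pure (if c then x else z)

  argminᵗ : (A → Timed ℝ) → List⁺ A → Timed A
  argminᵗ f (x ∷ xs) = argminFromᵗ f x xs

  edgeWeightᵗ : Edge → Timed ℝ
  edgeWeightᵗ (u , v) = distᵗ u v

  pairsᵗ : List⁺ A → List⁺ B → Timed (List⁺ (A × B))
  pairsᵗ xs ys = concatMap⁺ᵗ (λ x → map⁺ᵗ (λ y → pure (x , y)) ys) xs

  -- The points assigned to one non-empty cell.
  Cluster : Set
  Cluster = List⁺ Point

  closestPairᵗ : Cluster → Cluster → Timed Edge
  closestPairᵗ C D = do
    es ← pairsᵗ C D
    argminᵗ edgeWeightᵗ es

  cellDistanceᵗ : Cluster → Cluster → Timed ℝ
  cellDistanceᵗ C D = do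
    e ← closestPairᵗ C D
    edgeWeightᵗ e

  -- Prim's algorithm: a minimum spanning tree of the complete graph on
  -- the clusters, grown from those already reached.
  primᵗ : ∀ {n} → List⁺ Cluster → Vec Cluster n →
          Timed (List (Cluster × Cluster))
  primᵗ {zero}  reached []   = pure []
  primᵗ {suc n} reached todo = do
    choices              ← selectᵗ todo
    links                ← pairsᵗ reached choices
    C , (D , rest)       ← argminᵗ (λ (C , (D , _)) → cellDistanceᵗ C D) links
    es                   ← primᵗ {n} (D ∷⁺ reached) rest
    pure ((C , D) ∷ es)

  -- A tree on clusters, with a chosen root.
  data CellTree : Set where
    node : Cluster → List CellTree → CellTree

  -- All ways of attaching a new leaf to a tree.
  mutual
    attachᵗ : Cluster → CellTree → Timed (List⁺ CellTree)
    attachᵗ D (node C ts) = do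
      tss ← attachBelowᵗ D ts
      us  ← mapᵗ (λ ts′ → pure (node C ts′)) tss
      pure (node C (node D [] ∷ ts) ∷ us)

    attachBelowᵗ : Cluster → List CellTree → Timed (List (List CellTree))
    attachBelowᵗ D []       = pure []
    attachBelowᵗ D (t ∷ ts) = do
      us  ← attachᵗ D t
      uss ← attachBelowᵗ D ts
      xs  ← mapᵗ (λ t′ → pure (t′ ∷ ts)) (toList us)
      ys  ← mapᵗ (λ ts′ → pure (t ∷ ts′)) uss
      appendᵗ xs ys

  -- All trees obtained from the given one by attaching the given clusters, in
  -- any order and at any place.  From a single root this yields every spanning
  -- tree of the complete graph on the clusters, possibly several times.
  spanningTreesᵗ : ∀ {n} → CellTree → Vec Cluster n → Timed (List⁺ CellTree)
  spanningTreesᵗ {zero}  t []   = pure (t ∷ [])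
  spanningTreesᵗ {suc n} t todo = do
    choices ← selectᵗ todo
    concatMap⁺ᵗ
      (λ (D , rest) → do
        us ← attachᵗ D t
        concatMap⁺ᵗ (λ u → spanningTreesᵗ {n} u rest) us)
      choices

  -- An entry of the dynamic programming table of a cell: a point p of the
  -- cell, the value W(p), and a solution on the subtree that attains it.
  record Entry : Set where
    constructor entry
    field
      point    : Point
      W        : ℝ
      solution : Graph

  open Entry

  Table : Set
  Table = List⁺ Entry

  -- The entry of p, given the tables of the child cells.
  entryᵗ : Point → List Table → Timed Entry
  entryᵗ p []             = pure (entry p 0# (graph (p ∷ []) []))
  entryᵗ p (table ∷ tables) = do
    e  ← entryᵗ p tables
    q  ← argminᵗ via table
    a  ← via q
    w  ← a +ᵗ W e
    vs ← appendᵗ (vertices (solution q)) (vertices (solution e))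
    es ← appendᵗ (edges (solution q)) (edges (solution e))
    pure (entry p w (graph vs ((p , point q) ∷ es)))
    where
    via : Entry → Timed ℝ
    via q = do
      d ← distᵗ p (point q)
      W q +ᵗ d

  mutual
    tableᵗ : CellTree → Timed Table
    tableᵗ (node C ts) = do
      tables ← tablesᵗ ts
      map⁺ᵗ (λ p → entryᵗ p tables) C

    tablesᵗ : List CellTree → Timed (List Table)
    tablesᵗ []       = pure []
    tablesᵗ (t ∷ ts) = do
      table  ← tableᵗ t
      tables ← tablesᵗ ts
      pure (table ∷ tables)

  bestForᵗ : CellTree → Timed Entry
  bestForᵗ t = do
    table ← tableᵗ t
    argminᵗ (pure ∘ W) table

  exhaustiveᵗ : Cluster → List Cluster → Timed Graph
  exhaustiveᵗ C Cs = do
    todo    ← toVecᵗ Cs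
    ts      ← spanningTreesᵗ (node C []) todo
    entries ← map⁺ᵗ bestForᵗ ts
    best    ← argminᵗ (pure ∘ W) entries
    pure (solution best)

  incidentᵗ : List Edge → Point → Timed Bool
  incidentᵗ []             p = pure false
  incidentᵗ ((u , v) ∷ es) p = do
    a ← samePointᵗ p u
    b ← samePointᵗ p v
    c ← incidentᵗ es p
    pure (a ∨ b ∨ c)

  module _ (I : Instance) where
    open Instance I

    sameCellᵗ : Point → Point → Timed Bool
    sameCellᵗ p q = does (cell p ≟ᶜ cell q) after 1

    insertᵗ : Point → List Cluster → Timed (List⁺ Cluster)
    insertᵗ p []       = pure ((p ∷ []) ∷ [])
    insertᵗ p (C ∷ Cs) = do
      b  ← sameCellᵗ p (List⁺.head C)
      Ds ← insertᵗ p Cs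
      pure (if b then (p ∷⁺ C) ∷ Cs else C ∷⁺ Ds)

    clustersFromᵗ : Point → List Point → Timed (List⁺ Cluster)
    clustersFromᵗ p []       = insertᵗ p []
    clustersFromᵗ p (q ∷ qs) = do
      Cs ← clustersFromᵗ q qs
      insertᵗ p (toList Cs)

    clustersᵗ : Timed (List⁺ Cluster)
    clustersᵗ = clustersFromᵗ (List⁺.head points) (List⁺.tail points)

    reconnectᵗ : Point → List Edge → Timed (List Edge)
    reconnectᵗ p = mapᵗ λ (u , v) → do
        u′ ← move u
        v′ ← move v
        pure (u′ , v′)
      where
      move : Point → Timed Point
      move u = do
        b ← sameCellᵗ u p
        pure (if b then p else u)

    -- Here and below a graph without isolated vertices is given by its edges.
    -- The second argument of `mergeᵗ` is the list of points of the graph in C.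
    mergeᵗ : Cluster → List Point → List Edge → Timed (List Edge)
    mergeᵗ C C-G@(_ ∷ _ ∷ _) es = do
      p ← argminᵗ (λ p → sumᵗ (λ c → distᵗ c p) C-G) C
      reconnectᵗ p es
    mergeᵗ C _               es = pure es

    mergeAllᵗ : List Cluster → List Edge → Timed (List Edge)
    mergeAllᵗ []       es = pure es
    mergeAllᵗ (C ∷ Cs) es = do
      C-G ← filterᵗ (incidentᵗ es) (toList C)
      es′ ← mergeᵗ C C-G es
      mergeAllᵗ Cs es′

    mstBasedᵗ : Cluster → List Cluster → Timed Graph
    mstBasedᵗ C Cs = do
      todo ← toVecᵗ Cs
      T    ← primᵗ (C ∷ []) todo
      es   ← mapᵗ (λ (D , E) → closestPairᵗ D E) T
      es′  ← mergeAllᵗ (C ∷ Cs) es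
      vs   ← filterᵗ (incidentᵗ es′) (toList points)
      pure (graph vs es′)

    -- N ≤ 15 or N ≤ 10√2/ε
    isSmallᵗ : ℝ → ℕ → Timed Bool
    isSmallᵗ ε N = do
      a  ← N ≤ℕᵗ 15
      x  ← fromℕᵗ N
      t  ← √ᵗ (fromℕ 2)
      t′ ← fromℕ 10 *ᵗ t
      y  ← t′ /ᵗ ε
      b  ← x ≤ᵗ y
      pure (a ∨ b)

    𝒜 : ℝ → Timed Graph
    𝒜 ε = do
      C ∷ Cs ← clustersᵗ
      N      ← lengthᵗ Cs
      small  ← isSmallᵗ ε N
      if small then exhaustiveᵗ C Cs else mstBasedᵗ C Cs

{-# OPTIONS --safe #-}
-- In the exhaustive branch the output is optimal. In the other branch the tree
-- found by Prim's algorithm weighs at most w(T_opt), because each edge that it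
-- chooses can be traded for an edge of T_opt. Uniting the ends in a cell that
-- contains d ends of edges costs at most (d - 1)√2, hence (N - 1)√2 in total.
-- On the other hand N + 1 ≤ 4 + 4 w(T_opt): all points of T_opt can be moved to
-- corners of their cells without increasing the total horizontal or vertical
-- extent of the edges, and a lattice tree of rectilinear length L meets at most
-- 4 + 2L cells. Together with N ≥ 16 and N ≥ 10√2/ε this bounds (N - 1)√2 by
-- (4√2 + ε) w(T_opt).
module Submission where

open import Algebra.Bundles using (CommutativeRing)
import Algebra.Properties.Ring
import Algebra.Solver.Ring
open import Algebra.Solver.Ring.AlmostCommutativeRing using (fromCommutativeRing; _-Raw-AlmostCommutative⟶_)
open import Data.Bool.Base using (Bool; true; false; if_then_else_; T)
open import Data.Bool.Properties using (∨-zeroʳ)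
open import Data.Empty using (⊥; ⊥-elim)
open import Data.Integer.Base as ℤ using (ℤ; +_; -[1+_]; _⊖_)
import Data.Integer.Properties as ℤ
open import Data.List.Base using (List; []; _∷_; _++_; length; map; concatMap; filter)
import Data.List.Membership.DecPropositional as DecMembership
open import Data.List.Membership.Propositional using (_∈_; _∉_; find)
open import Data.List.Membership.Propositional.Properties using (∈-++⁺ˡ; ∈-++⁺ʳ; ∈-++⁻; ∈-map⁺; ∈-map⁻; ∈-∃++; ∈-concatMap⁺; ∈-concatMap⁻; ∈-filter⁺; ∈-filter⁻)
open import Data.List.NonEmpty.Base as List⁺ using (List⁺; _∷_; _∷⁺_; toList)
open import Data.List.Properties using (++-assoc; map-++; ∷-injective; ∷-injectiveˡ; ∷-injectiveʳ; length-++; ++-identityʳ; length-map)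
open import Data.List.Relation.Binary.Permutation.Propositional as ↭ using (_↭_; refl; prep; swap; trans; ↭-sym; ↭-reflexive)
open import Data.List.Relation.Binary.Permutation.Propositional.Properties using (∈-resp-↭; shift; ↭-length; All-resp-↭; ++⁺ˡ; ++⁺ʳ; ++⁺; map⁺)
open import Data.List.Relation.Binary.Pointwise as Pointwise using (Pointwise; []; _∷_)
open import Data.List.Relation.Binary.Subset.Propositional using (_⊆_)
open import Data.List.Relation.Unary.All as All using (All; []; _∷_)
import Data.List.Relation.Unary.All.Properties as Allₚ
open import Data.List.Relation.Unary.AllPairs as AllPairs using (AllPairs; []; _∷_)
open import Data.List.Relation.Unary.Any as Any using (here; there)
open import Data.List.Relation.Unary.Linked using (Linked; []; [-]; _∷_)
open import Data.List.Relation.Unary.Unique.Propositional using (Unique)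
open import Data.Maybe.Base using (Maybe; just; nothing)
open import Data.Nat.Base as ℕ using (ℕ; zero; suc; s≤s; z≤n)
import Data.Nat.Properties as ℕ
import Data.Nat.Solver
open import Data.Product using (∃; ∃-syntax; _×_; _,_; proj₁; proj₂)
open import Data.Sum.Base as Sum using (_⊎_; inj₁; inj₂)
open import Data.Vec.Base as Vec using (Vec; []; _∷_)
open import Defs
open import Function.Base using (_∘_; id)
open import Level using (0ℓ)
open import Relation.Binary.Bundles using (Poset)
open import Relation.Binary.Construct.Closure.ReflexiveTransitive as Star using (Star; _◅_; _◅◅_)
open import Relation.Binary.Definitions using (DecidableEquality; tri<; tri≈; tri>)
open import Relation.Binary.PropositionalEquality as ≡ using (_≡_; _≢_; refl; sym; cong; cong₂; subst; subst₂; module ≡-Reasoning)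
import Relation.Binary.Reasoning.PartialOrder
open import Relation.Binary.Structures using (IsDecTotalOrder)
open import Relation.Nullary using (¬_; does; yes; no; contradiction)

-- Every tree is handled as a growth sequence: a list of directed edges, each leading from a vertex
-- already present to a new one. Prim's tree has this form on cells, the trees of the dynamic
-- program and the merged output have it on points, and every feasible tree can be brought into it.
-- The exchange argument meets an obstacle: Prim's closest pairs need not end in the points chosen
-- by T_opt, and after some trades the rest of T_opt is no longer a tree. Its invariant is therefore
-- only that the vertices of T_opt in the remaining clusters still reach those in the clusters
-- already attached. The branching condition absorbs an additive error. From N + 1 ≤ 4 + 4 w(T_opt)
-- one gets (N - 1)√2 ≤ 4√2 w(T_opt) + 2√2, so 2√2 must be at most ε w(T_opt). For N ≥ 16 the same
-- inequality gives w(T_opt) ≥ (N - 3)/4 ≥ 13 N/64, and N ≥ 10√2/ε then yields ε w(T_opt) ≥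
-- (130/64)√2. On the exhaustive branch N is bounded in terms of ε alone, which makes the
-- superexponential number of trees a constant.

module EdgeLists {V : Set} where

  -- Growth sequences, walks and bridges

  Adj : List (V × V) → V → V → Set
  Adj es u v = (u , v) ∈ es ⊎ (v , u) ∈ es

  -- The absence of an `IsCycle`, with its fields as arguments and without a vertex list, so that
  -- edges can be taken away one at a time.
  Acyclic : List (V × V) → Set
  Acyclic es = ∀ v vs → Linked (Adj es) (v ∷ vs ++ v ∷ []) → Unique (v ∷ vs) →
               3 ℕ.≤ length (v ∷ vs) → ⊥

  -- The edges, in this order, grow a forest from the vertices in S, each edge
  -- being directed towards its new endpoint.
  data Grow (S : List V) : List (V × V) → Set where
    []   : Grow S []
    step : ∀ {u v es} → u ∈ S → v ∉ S → Grow (v ∷ S) es → Grow S ((u , v) ∷ es)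

  heads : List (V × V) → List V
  heads = map proj₂

  grow-fresh : ∀ {S es w} → Grow S es → w ∈ heads es → w ∉ S
  grow-fresh (step _ v∉ g) (here refl) w∈S = v∉ w∈S
  grow-fresh (step _ v∉ g) (there w∈)  w∈S = grow-fresh g w∈ (there w∈S)

  -- Used to graft a subtree onto a forest that has already grown elsewhere. Enlarging the starting
  -- set can spoil only the freshness of the heads, which is therefore assumed anew.
  grow-mono : ∀ {S S′ es} → S ⊆ S′ → (∀ {v} → v ∈ heads es → v ∉ S′) → Grow S es → Grow S′ es
  grow-mono sub new [] = []
  grow-mono {S} {S′} sub new (step {v = v} u∈ v∉ g) =
    step (sub u∈) (new (here refl)) (grow-mono sub′ new′ g)
    where
    sub′ : v ∷ S ⊆ v ∷ S′
    sub′ (here eq) = here eq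
    sub′ (there p) = there (sub p)
    new′ : ∀ {w} → w ∈ heads _ → w ∉ v ∷ S′
    new′ w∈ (here refl) = grow-fresh g w∈ (here refl)
    new′ w∈ (there p)   = new (there w∈) p

  grow-++ : ∀ {S xs ys} → Grow S xs → Grow S ys →
            (∀ {v} → v ∈ heads xs → v ∉ heads ys) → Grow S (xs ++ ys)
  grow-++ [] h disjoint = h
  grow-++ {S} {ys = ys} (step {v = v} u∈ v∉ g) h disjoint =
    step u∈ v∉ (grow-++ g (grow-mono there new h) (disjoint ∘ there))
    where
    new : ∀ {w} → w ∈ heads ys → w ∉ v ∷ S
    new w∈ (here refl) = disjoint (here refl) w∈
    new w∈ (there p)   = grow-fresh h w∈ p

  heads-unique : ∀ {S es} → Grow S es → Unique (heads es)
  heads-unique [] = []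
  heads-unique (step u∈ v∉ g) =
    All.tabulate (λ { w∈ refl → grow-fresh g w∈ (here refl) }) ∷ heads-unique g

  grow-heads : ∀ {S es u v} → Grow S es → (u , v) ∈ es → v ∈ heads es
  grow-heads g e∈ = ∈-map⁺ proj₂ e∈

  grow-tails : ∀ {S es u v} → Grow S es → (u , v) ∈ es → u ∈ S ⊎ u ∈ heads es
  grow-tails (step u∈ v∉ g) (here refl) = inj₁ u∈
  grow-tails (step u∈ v∉ g) (there e∈) with grow-tails g e∈
  ... | inj₁ (here refl) = inj₂ (here refl)
  ... | inj₁ (there p)   = inj₁ p
  ... | inj₂ p           = inj₂ (there p)

  -- `es′` stays the whole list while `es` shrinks in the induction, so that paths found early
  -- remain paths.
  grow-connected : ∀ {S es es′ r} → Grow S es → es ⊆ es′ → (∀ {s} → s ∈ S → Star (Adj es′) r s) →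
                   ∀ {w} → w ∈ heads es → Star (Adj es′) r w
  grow-connected {S} {es′ = es′} {r} (step {v = v} u∈ v∉ g) sub conn = λ where
      (here refl) → conn-v
      (there w∈)  → grow-connected g (sub ∘ there) conn′ w∈
    where
    conn-v : Star (Adj es′) r v
    conn-v = conn u∈ ◅◅ (inj₁ (sub (here refl)) ◅ Star.ε)
    conn′ : ∀ {s} → s ∈ v ∷ S → Star (Adj es′) r s
    conn′ (here refl) = conn-v
    conn′ (there p)   = conn p

  -- Components are never computed: two vertices are shown to be disconnected by a colouring that is
  -- constant along edges and differs on them.
  Monochromatic : (V → Bool) → List (V × V) → Set
  Monochromatic κ = All (λ (u , v) → κ u ≡ κ v)

  adj-monochromatic : ∀ {κ es u v} → Monochromatic κ es → Adj es u v → κ u ≡ κ v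
  adj-monochromatic mono (inj₁ e∈) = All.lookup mono e∈
  adj-monochromatic mono (inj₂ e∈) = sym (All.lookup mono e∈)

  walk-monochromatic : ∀ {κ es x l} → Monochromatic κ es → Linked (Adj es) (x ∷ l) →
                       All (λ z → κ x ≡ κ z) (x ∷ l)
  walk-monochromatic mono [-]      = refl ∷ []
  walk-monochromatic mono (r ∷ rs) =
    refl ∷ All.map (≡.trans (adj-monochromatic mono r)) (walk-monochromatic mono rs)

  Joins : V → V → V → V → Set
  Joins a b p q = (p ≡ a × q ≡ b) ⊎ (p ≡ b × q ≡ a)

  -- The walk up to the crossing avoids the edge, the walk after it may still use it; applying
  -- `first-bridge` to the latter finds the way back.
  data FirstBridge (es : List (V × V)) (a b : V) : List V → Set where
    split : ∀ {l} xs p q ys → l ≡ xs ++ p ∷ q ∷ ys → Linked (Adj es) (xs ++ p ∷ []) →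
            Joins a b p q → Linked (Adj ((a , b) ∷ es)) (q ∷ ys) → FirstBridge es a b l

  bridge-step : ∀ {es a b u v} → Adj ((a , b) ∷ es) u v → Adj es u v ⊎ Joins a b u v
  bridge-step (inj₁ (here refl)) = inj₂ (inj₁ (refl , refl))
  bridge-step (inj₂ (here refl)) = inj₂ (inj₂ (refl , refl))
  bridge-step (inj₁ (there e∈))  = inj₁ (inj₁ e∈)
  bridge-step (inj₂ (there e∈))  = inj₁ (inj₂ e∈)

  first-bridge : ∀ {es a b l} → Linked (Adj ((a , b) ∷ es)) l →
                 Linked (Adj es) l ⊎ FirstBridge es a b l
  first-bridge []  = inj₁ []
  first-bridge [-] = inj₁ [-]
  first-bridge (r ∷ rs) with bridge-step r
  ... | inj₂ j  = inj₂ (split [] _ _ _ refl [-] j rs)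
  ... | inj₁ r′ with first-bridge rs
  ...   | inj₁ rs′                                 = inj₁ (r′ ∷ rs′)
  ...   | inj₂ (split [] p q ys refl h j t)        = inj₂ (split (_ ∷ []) p q ys refl (r′ ∷ h) j t)
  ...   | inj₂ (split (x ∷ xs) p q ys refl h j t)  =
    inj₂ (split (_ ∷ x ∷ xs) p q ys refl (r′ ∷ h) j t)

  private
    last∈ : ∀ {v : V} vs xs {y ys} → vs ++ v ∷ [] ≡ xs ++ y ∷ ys → v ∈ y ∷ ys
    last∈ vs       []       eq   = subst (_ ∈_) eq (∈-++⁺ʳ vs (here refl))
    last∈ []       (x ∷ []) ()
    last∈ []       (x ∷ _ ∷ _) ()
    last∈ (w ∷ vs) (x ∷ xs) eq   = last∈ vs xs (∷-injectiveʳ eq)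

    first∈ : ∀ {v : V} {vs} xs {p ys} → v ∷ vs ≡ xs ++ p ∷ ys → v ∈ xs ++ p ∷ []
    first∈ []       refl = here refl
    first∈ (x ∷ xs) refl = here refl

    unique-no-repeat : ∀ {q : V} {l} xs {ys zs} → Unique l → l ≡ xs ++ q ∷ ys ++ q ∷ zs → ⊥
    unique-no-repeat []       {ys} (q∉ ∷ _) refl = All.lookup q∉ (∈-++⁺ʳ ys (here refl)) refl
    unique-no-repeat (x ∷ xs) (_ ∷ u)      refl = unique-no-repeat xs u refl

    prefix-end : ∀ {v : V} vs ys {zs} → All (v ≢_) vs → vs ++ v ∷ [] ≡ ys ++ v ∷ zs → zs ≡ []
    prefix-end []       []          []        refl = refl
    prefix-end []       (_ ∷ [])    []        ()
    prefix-end []       (_ ∷ _ ∷ _) []        ()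
    prefix-end (x ∷ vs) []          (v≢ ∷ _)  eq   = ⊥-elim (v≢ (sym (∷-injectiveˡ eq)))
    prefix-end (x ∷ vs) (_ ∷ ys)    (_ ∷ all) eq   = prefix-end vs ys all (∷-injectiveʳ eq)

    unique-snoc : ∀ {v : V} {vs} → Unique vs → All (v ≢_) vs → Unique (vs ++ v ∷ [])
    unique-snoc [] [] = [] ∷ []
    unique-snoc {v} (x∉ ∷ u) (v≢x ∷ v∉) = go x∉ (v≢x ∘ sym) ∷ unique-snoc u v∉
      where
      go : ∀ {x xs} → All (x ≢_) xs → x ≢ v → All (x ≢_) (xs ++ v ∷ [])
      go []       x≢v = x≢v ∷ []
      go (p ∷ ps) x≢v = p ∷ go ps x≢v

  -- Both `v ∷ vs` and `vs ++ v ∷ []` are free of repetitions, so a repeated vertex must occupy the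
  -- very first and the very last position.
  closed-walk-repeat : ∀ {v q : V} {vs} xs {ys zs} → Unique (v ∷ vs) →
                       v ∷ vs ++ v ∷ [] ≡ xs ++ q ∷ ys ++ q ∷ zs → xs ≡ [] × zs ≡ []
  closed-walk-repeat {vs = vs} [] {ys} (v∉ ∷ u) eq with ∷-injective eq
  ... | refl , eq′ = refl , prefix-end vs ys v∉ eq′
  closed-walk-repeat (x ∷ xs) (v∉ ∷ u) eq =
    ⊥-elim (unique-no-repeat xs (unique-snoc u v∉) (∷-injectiveʳ eq))

  private
    short-walk : ∀ {v p q r : V} (vs : List V) → _≡_ {A = List V} (v ∷ vs ++ v ∷ []) (p ∷ q ∷ r ∷ []) → 3 ℕ.≤ length (v ∷ vs) → ⊥
    short-walk []              () long
    short-walk (_ ∷ [])        eq (s≤s (s≤s ()))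
    short-walk (_ ∷ _ ∷ [])    () long
    short-walk (_ ∷ _ ∷ _ ∷ _) () long

  -- A cycle through a bridge would have to cross it twice, but its endpoints
  -- can be visited only once.
  acyclic-bridge : ∀ {es a b} (κ : V → Bool) → Monochromatic κ es → κ a ≢ κ b →
                   Acyclic es → Acyclic ((a , b) ∷ es)
  acyclic-bridge {es} {a} {b} κ mono κa≢κb acyclic v vs walk unique long with first-bridge walk
  ... | inj₁ walk′ = acyclic v vs walk′ unique long
  ... | inj₂ (split xs p q ys eq h j t) = second (first-bridge t)
    where
    same : ∀ {x l y z} → Linked (Adj es) (x ∷ l) → y ∈ x ∷ l → z ∈ x ∷ l → κ y ≡ κ z
    same rs y∈ z∈ = let c = walk-monochromatic mono rs in
      ≡.trans (sym (All.lookup c y∈)) (All.lookup c z∈)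
    same′ : ∀ {x y z} l → Linked (Adj es) (l ++ x ∷ []) → y ∈ l ++ x ∷ [] → z ∈ l ++ x ∷ [] → κ y ≡ κ z
    same′ []      rs = same rs
    same′ (_ ∷ _) rs = same rs
    crosses : ∀ {p q} → Joins a b p q → κ p ≢ κ q
    crosses (inj₁ (refl , refl)) = κa≢κb
    crosses (inj₂ (refl , refl)) = κa≢κb ∘ sym
    -- Between the crossings the colour does not change, so the second one starts from the colour
    -- class entered by the first and runs in the opposite direction.
    back : ∀ {p q r s} → Joins a b p q → Joins a b r s → κ q ≡ κ r → r ≡ q × s ≡ p
    back (inj₁ (refl , refl)) (inj₁ (refl , refl)) κq≡κr = ⊥-elim (κa≢κb (sym κq≡κr))
    back (inj₁ (refl , refl)) (inj₂ (refl , refl)) κq≡κr = refl , refl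
    back (inj₂ (refl , refl)) (inj₁ (refl , refl)) κq≡κr = refl , refl
    back (inj₂ (refl , refl)) (inj₂ (refl , refl)) κq≡κr = ⊥-elim (κa≢κb κq≡κr)
    κv≡κp : κ v ≡ κ p
    κv≡κp = same′ xs h (first∈ xs eq) (∈-++⁺ʳ xs (here refl))
    second : Linked (Adj es) (q ∷ ys) ⊎ FirstBridge es a b (q ∷ ys) → ⊥
    second (inj₁ t′) = crosses j (≡.trans (sym κv≡κp) (same t′
      (last∈ (v ∷ vs) (xs ++ p ∷ []) (≡.trans eq (sym (++-assoc xs (p ∷ []) (q ∷ ys))))) (here refl)))
    -- Nothing happens between the crossings: the closed walk is `p`, `q`, `p`, too short for a
    -- cycle.
    second (inj₂ (split [] r s ys′ refl h′ j′ t′)) with back j j′ refl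
    ... | refl , refl with closed-walk-repeat xs {_ ∷ []} unique eq
    ...   | refl , refl = short-walk vs eq long
    -- Here `q` recurs before the way back, with `p` ahead of it and `s` behind it, although only
    -- the two ends of the walk may coincide.
    second (inj₂ (split (_ ∷ xs′) r s ys′ refl h′ j′ t′))
      with back j j′ (same h′ (here refl) (∈-++⁺ʳ (_ ∷ xs′) (here refl)))
    ... | refl , refl with closed-walk-repeat (xs ++ p ∷ []) {xs′} unique
                             (≡.trans eq (sym (++-assoc xs (p ∷ []) (q ∷ ys))))
    ...   | _ , ()

-- Acyclicity of growth sequences

module ForestGrowth {V : Set} (_≟_ : DecidableEquality V) where

  open EdgeLists {V}

  -- A head is new when it appears, so it can take the colour of its parent without disturbing what
  -- was coloured before.
  grow-colouring : ∀ {S es} → Grow S es → (κ : V → Bool) →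
                   ∃ λ κ′ → (∀ {s} → s ∈ S → κ′ s ≡ κ s) × Monochromatic κ′ es
  grow-colouring [] κ = κ , (λ _ → refl) , []
  grow-colouring {S} (step {u} {v} u∈ v∉ g) κ with grow-colouring g recoloured
    where
    recoloured : V → Bool
    recoloured x = if does (x ≟ v) then κ u else κ x
  ... | κ′ , agrees , mono = κ′ , agrees′ , ≡.trans (agrees′ u∈) (sym κ′v) ∷ mono
    where
    agrees′ : ∀ {s} → s ∈ S → κ′ s ≡ κ s
    agrees′ {s} s∈ with s ≟ v | agrees (there s∈)
    ... | yes refl | _  = contradiction s∈ v∉
    ... | no _     | eq = eq
    κ′v : κ′ v ≡ κ u
    κ′v with v ≟ v | agrees (here refl)
    ... | yes _  | eq = eq
    ... | no v≢v | _  = contradiction refl v≢v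

  -- The first edge is a bridge: the other edges grow from `v ∷ S`, so the colouring that marks `v`
  -- alone extends to them and separates `v` from `u`.
  grow-acyclic : ∀ {S es} → Grow S es → Acyclic es
  grow-acyclic [] v []      (inj₁ () ∷ _) unique long
  grow-acyclic [] v []      (inj₂ () ∷ _) unique long
  grow-acyclic [] v (_ ∷ _) (inj₁ () ∷ _) unique long
  grow-acyclic [] v (_ ∷ _) (inj₂ () ∷ _) unique long
  grow-acyclic {S} (step {u} {v} u∈ v∉ g) with grow-colouring g (λ x → does (x ≟ v))
  ... | κ′ , agrees , mono = acyclic-bridge κ′ mono different (grow-acyclic g)
    where
    different : κ′ u ≢ κ′ v
    different eq with u ≟ v | v ≟ v | agrees (there u∈) | agrees (here refl)
    ... | yes refl | _      | _  | _  = v∉ u∈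
    ... | no _     | no v≢v | _  | _  = v≢v refl
    ... | no _     | yes _  | κu | κv with ≡.trans (sym κu) (≡.trans eq κv)
    ...   | ()

-- Arithmetic of ordered fields and the Euclidean norm

module OrderedField (E : EuclideanField) where

  open EuclideanField E

  commutativeRing : CommutativeRing 0ℓ 0ℓ
  commutativeRing = record { isCommutativeRing = isCommutativeRing }

  open CommutativeRing commutativeRing public
    using (+-comm; +-assoc; +-identityˡ; +-identityʳ; *-comm; *-assoc; *-identityˡ; *-identityʳ;
           distribˡ; distribʳ; zeroˡ; zeroʳ; -‿inverseʳ; -‿inverseˡ; ring)
  open Algebra.Properties.Ring ring using (-0#≈0#; -‿involutive; -‿+-comm; -‿distribˡ-*)
  open IsDecTotalOrder isDecTotalOrder public
    using () renaming (refl to ≤-refl; reflexive to ≤-reflexive; trans to ≤-trans; total to ≤-total; antisym to ≤-antisym)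

  poset : Poset 0ℓ 0ℓ 0ℓ
  poset = record { isPartialOrder = IsDecTotalOrder.isPartialOrder isDecTotalOrder }

  module ≤-Reasoning = Relation.Binary.Reasoning.PartialOrder poset
    using (begin_; step-≤; step-≡-⟩; step-≡-⟨; step-≡-∣; _∎)

  fromℕ-+ : ∀ m n → fromℕ (m ℕ.+ n) ≡ fromℕ m + fromℕ n
  fromℕ-+ zero    n = sym (+-identityˡ _)
  fromℕ-+ (suc m) n = ≡.trans (cong (λ z → 1# + z) (fromℕ-+ m n)) (sym (+-assoc _ _ _))

  fromℕ-* : ∀ m n → fromℕ (m ℕ.* n) ≡ fromℕ m * fromℕ n
  fromℕ-* zero    n = sym (zeroˡ _)
  fromℕ-* (suc m) n = begin
    fromℕ (n ℕ.+ m ℕ.* n)             ≡⟨ fromℕ-+ n _ ⟩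
    fromℕ n + fromℕ (m ℕ.* n)         ≡⟨ cong₂ _+_ (sym (*-identityˡ _)) (fromℕ-* m n) ⟩
    1# * fromℕ n + fromℕ m * fromℕ n  ≡⟨ distribʳ _ _ _ ⟨
    (1# + fromℕ m) * fromℕ n          ∎
    where open ≡-Reasoning

  fromℤ-neg : ∀ i → fromℤ (ℤ.- i) ≡ - fromℤ i
  fromℤ-neg (+ zero)  = sym -0#≈0#
  fromℤ-neg (+ suc n) = refl
  fromℤ-neg -[1+ n ]  = sym (-‿involutive _)

  fromℤ-⊖ : ∀ m n → fromℤ (m ⊖ n) ≡ fromℕ m - fromℕ n
  fromℤ-⊖ m       zero    = ≡.trans (sym (+-identityʳ _)) (cong (λ z → fromℕ m + z) (sym -0#≈0#))
  fromℤ-⊖ zero    (suc n) = sym (+-identityˡ _)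
  fromℤ-⊖ (suc m) (suc n) = begin
    fromℤ (suc m ⊖ suc n)              ≡⟨ cong fromℤ (ℤ.[1+m]⊖[1+n]≡m⊖n m n) ⟩
    fromℤ (m ⊖ n)                      ≡⟨ fromℤ-⊖ m n ⟩
    fromℕ m - fromℕ n                  ≡⟨ cong (λ z → fromℕ m + z) (sym cancel) ⟩
    fromℕ m + (1# + - fromℕ (suc n))   ≡⟨ +-assoc _ _ _ ⟨
    (fromℕ m + 1#) + - fromℕ (suc n)   ≡⟨ cong (_+ - fromℕ (suc n)) (+-comm _ _) ⟩
    fromℕ (suc m) - fromℕ (suc n)      ∎
    where
    open ≡-Reasoning
    cancel : 1# + - fromℕ (suc n) ≡ - fromℕ n
    cancel = begin
      1# + - (1# + fromℕ n)      ≡⟨ cong (λ z → 1# + z) (sym (-‿+-comm _ _)) ⟩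
      1# + (- 1# + - fromℕ n)    ≡⟨ +-assoc _ _ _ ⟨
      (1# + - 1#) + - fromℕ n    ≡⟨ cong (_+ - fromℕ n) (-‿inverseʳ _) ⟩
      0# + - fromℕ n             ≡⟨ +-identityˡ _ ⟩
      - fromℕ n                  ∎

  fromℤ-+ : ∀ i j → fromℤ (i ℤ.+ j) ≡ fromℤ i + fromℤ j
  fromℤ-+ (+ m)    (+ n)    = fromℕ-+ m n
  fromℤ-+ (+ m)    -[1+ n ] = fromℤ-⊖ m (suc n)
  fromℤ-+ -[1+ m ] (+ n)    = ≡.trans (fromℤ-⊖ n (suc m)) (+-comm _ _)
  fromℤ-+ -[1+ m ] -[1+ n ] = begin
    - fromℕ (suc (suc (m ℕ.+ n)))       ≡⟨ cong (λ k → - fromℕ (suc k)) (ℕ.+-suc m n) ⟨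
    - fromℕ (suc m ℕ.+ suc n)           ≡⟨ cong -_ (fromℕ-+ (suc m) (suc n)) ⟩
    - (fromℕ (suc m) + fromℕ (suc n))   ≡⟨ -‿+-comm _ _ ⟨
    - fromℕ (suc m) + - fromℕ (suc n)   ∎
    where open ≡-Reasoning

  fromℤ-pos-* : ∀ m j → fromℤ (+ m ℤ.* j) ≡ fromℕ m * fromℤ j
  fromℤ-pos-* zero    j = ≡.trans (cong fromℤ (ℤ.*-zeroˡ j)) (sym (zeroˡ _))
  fromℤ-pos-* (suc m) j = begin
    fromℤ (+ suc m ℤ.* j)          ≡⟨ cong fromℤ (ℤ.suc-* (+ m) j) ⟩
    fromℤ (j ℤ.+ + m ℤ.* j)        ≡⟨ fromℤ-+ j _ ⟩
    fromℤ j + fromℤ (+ m ℤ.* j)    ≡⟨ cong₂ _+_ (sym (*-identityˡ _)) (fromℤ-pos-* m j) ⟩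
    1# * fromℤ j + fromℕ m * fromℤ j ≡⟨ distribʳ _ _ _ ⟨
    fromℕ (suc m) * fromℤ j        ∎
    where open ≡-Reasoning

  fromℤ-* : ∀ i j → fromℤ (i ℤ.* j) ≡ fromℤ i * fromℤ j
  fromℤ-* (+ m)    j = fromℤ-pos-* m j
  fromℤ-* -[1+ m ] j = begin
    fromℤ (-[1+ m ] ℤ.* j)       ≡⟨ cong fromℤ (ℤ.neg-distribˡ-* (+ suc m) j) ⟨
    fromℤ (ℤ.- (+ suc m ℤ.* j))  ≡⟨ fromℤ-neg (+ suc m ℤ.* j) ⟩
    - fromℤ (+ suc m ℤ.* j)      ≡⟨ cong -_ (fromℤ-pos-* (suc m) j) ⟩
    - (fromℕ (suc m) * fromℤ j)  ≡⟨ -‿distribˡ-* _ _ ⟩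
    - fromℕ (suc m) * fromℤ j    ∎
    where open ≡-Reasoning

  private
    fromℤ-morphism : CommutativeRing.rawRing ℤ.+-*-commutativeRing
                     -Raw-AlmostCommutative⟶ fromCommutativeRing commutativeRing
    fromℤ-morphism = record
      { ⟦_⟧ = fromℤ ; +-homo = fromℤ-+ ; *-homo = fromℤ-* ; -‿homo = fromℤ-neg
      ; 0-homo = refl ; 1-homo = +-identityʳ _ }

    coefficient-≟ : ∀ i j → Maybe (fromℤ i ≡ fromℤ j)
    coefficient-≟ i j with i ℤ.≟ j
    ... | yes i≡j = just (cong fromℤ i≡j)
    ... | no _    = nothing

  -- The coefficients are integers, whose equality computes, so that identities with numerals
  -- normalise although the field is abstract.
  module Solver = Algebra.Solver.Ring _ _ fromℤ-morphism coefficient-≟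
  open Solver

  0≤y-x⇒x≤y : ∀ {x y} → 0# ≤ y - x → x ≤ y
  0≤y-x⇒x≤y {x} {y} 0≤ = subst₂ _≤_ (+-identityˡ x)
    (solve 2 (λ x y → y :- x :+ x := y) refl x y) (+-monoˡ-≤ x 0≤)

  x≤y⇒0≤y-x : ∀ {x y} → x ≤ y → 0# ≤ y - x
  x≤y⇒0≤y-x {x} {y} x≤y = subst (_≤ y - x) (-‿inverseʳ x) (+-monoˡ-≤ (- x) x≤y)

  -- The goal x ≤ y is reduced to a ring identity exhibiting y - x as a
  -- combination that is known to be non-negative.
  by-difference : ∀ {x y z} → 0# ≤ z → z ≡ y - x → x ≤ y
  by-difference 0≤z eq = 0≤y-x⇒x≤y (subst (0# ≤_) eq 0≤z)

  +-nonNegative : ∀ {x y} → 0# ≤ x → 0# ≤ y → 0# ≤ x + y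
  +-nonNegative {x} {y} 0≤x 0≤y =
    ≤-trans 0≤y (subst (_≤ x + y) (+-identityˡ y) (+-monoˡ-≤ y 0≤x))

  +-mono-≤ : ∀ {x y u v} → x ≤ y → u ≤ v → x + u ≤ y + v
  +-mono-≤ {x} {y} {u} {v} x≤y u≤v = by-difference
    (+-nonNegative (x≤y⇒0≤y-x x≤y) (x≤y⇒0≤y-x u≤v))
    (solve 4 (λ x y u v → y :- x :+ (v :- u) := y :+ v :- (x :+ u)) refl x y u v)

  +-monoʳ-≤ : ∀ z {x y} → x ≤ y → z + x ≤ z + y
  +-monoʳ-≤ z = +-mono-≤ ≤-refl

  +-cancelʳ-≤ : ∀ z {x y} → x + z ≤ y + z → x ≤ y
  +-cancelʳ-≤ z {x} {y} le = by-difference (x≤y⇒0≤y-x le)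
    (solve 3 (λ x y z → y :+ z :- (x :+ z) := y :- x) refl x y z)

  *-monoˡ-≤ : ∀ z {x y} → 0# ≤ z → x ≤ y → z * x ≤ z * y
  *-monoˡ-≤ z {x} {y} 0≤z x≤y = by-difference (*-nonNegative 0≤z (x≤y⇒0≤y-x x≤y))
    (solve 3 (λ x y z → z :* (y :- x) := z :* y :- z :* x) refl x y z)

  neg-mono-≤ : ∀ {x y} → x ≤ y → - y ≤ - x
  neg-mono-≤ {x} {y} x≤y = by-difference (x≤y⇒0≤y-x x≤y)
    (solve 2 (λ x y → y :- x := :- x :- (:- y)) refl x y)

  0≤x⇒-x≤0 : ∀ {x} → 0# ≤ x → - x ≤ 0#
  0≤x⇒-x≤0 {x} 0≤x = subst (- x ≤_) -0#≈0# (neg-mono-≤ 0≤x)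

  x≤0⇒0≤-x : ∀ {x} → x ≤ 0# → 0# ≤ - x
  x≤0⇒0≤-x {x} x≤0 = subst (_≤ - x) -0#≈0# (neg-mono-≤ x≤0)

  square-nonNegative : ∀ x → 0# ≤ x * x
  square-nonNegative x with ≤-total 0# x
  ... | inj₁ 0≤x = *-nonNegative 0≤x 0≤x
  ... | inj₂ x≤0 = subst (0# ≤_) (solve 1 (λ x → :- x :* :- x := x :* x) refl x)
                     (*-nonNegative (x≤0⇒0≤-x x≤0) (x≤0⇒0≤-x x≤0))

  0≤1 : 0# ≤ 1#
  0≤1 = subst (0# ≤_) (*-identityˡ 1#) (square-nonNegative 1#)

  fromℕ-nonNegative : ∀ n → 0# ≤ fromℕ n
  fromℕ-nonNegative zero    = ≤-refl
  fromℕ-nonNegative (suc n) = +-nonNegative 0≤1 (fromℕ-nonNegative n)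

  fromℕ-mono-≤ : ∀ {m n} → m ℕ.≤ n → fromℕ m ≤ fromℕ n
  fromℕ-mono-≤ {n = n} z≤n = fromℕ-nonNegative n
  fromℕ-mono-≤ (s≤s m≤n)   = +-monoʳ-≤ 1# (fromℕ-mono-≤ m≤n)

  x+1≰x : ∀ {x} → ¬ (1# + x ≤ x)
  x+1≰x {x} le = 0≢1 (≤-antisym 0≤1 (+-cancelʳ-≤ x (subst (1# + x ≤_) (sym (+-identityˡ x)) le)))

  fromℕ-cancel-≤ : ∀ {m n} → fromℕ m ≤ fromℕ n → m ℕ.≤ n
  fromℕ-cancel-≤ {m} {n} le with m ℕ.≤? n
  ... | yes m≤n = m≤n
  ... | no m≰n  = contradiction (≤-trans (fromℕ-mono-≤ (ℕ.≰⇒> m≰n)) le) x+1≰x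

  zero-product : ∀ {x y} → x * y ≡ 0# → x ≢ 0# → y ≡ 0#
  zero-product {x} {y} xy≡0 x≢0 = begin
    y               ≡⟨ *-identityˡ y ⟨
    1# * y          ≡⟨ cong (_* y) (*-inverseʳ x x≢0) ⟨
    x * x ⁻¹ * y    ≡⟨ solve 3 (λ x i y → x :* i :* y := i :* (x :* y)) refl x (x ⁻¹) y ⟩
    x ⁻¹ * (x * y)  ≡⟨ cong (x ⁻¹ *_) xy≡0 ⟩
    x ⁻¹ * 0#       ≡⟨ zeroʳ _ ⟩
    0#              ∎
    where open ≡-Reasoning

  +-zeroˡ : ∀ {x y} → 0# ≤ x → 0# ≤ y → x + y ≡ 0# → x ≡ 0#
  +-zeroˡ {x} {y} 0≤x 0≤y eq = ≤-antisym
    (subst₂ _≤_ (+-identityʳ x) eq (+-monoʳ-≤ x 0≤y)) 0≤x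

  *-cancelˡ-≤ : ∀ z {x y} → 0# < z → z * x ≤ z * y → x ≤ y
  *-cancelˡ-≤ z {x} {y} (0≤z , 0≢z) le with ≤-total x y
  ... | inj₁ x≤y = x≤y
  ... | inj₂ y≤x = ≤-reflexive (begin
    x             ≡⟨ solve 2 (λ x y → x := x :- y :+ y) refl x y ⟩
    x - y + y     ≡⟨ cong (_+ y) (zero-product z[x-y]≡0 (λ z≡0 → 0≢z (sym z≡0))) ⟩
    0# + y        ≡⟨ +-identityˡ y ⟩
    y             ∎)
    where
    open ≡-Reasoning
    z[x-y]≡0 : z * (x - y) ≡ 0#
    z[x-y]≡0 = ≤-antisym
      (by-difference (x≤y⇒0≤y-x le)
        (solve 3 (λ x y z → z :* y :- z :* x := con (+ 0) :- z :* (x :- y)) refl x y z))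
      (*-nonNegative 0≤z (x≤y⇒0≤y-x y≤x))

  -- If y ≤ x, the factor x + y of y² - x² = (x + y)(y - x) can be cancelled unless it vanishes, and
  -- then x is zero.
  square-cancel-≤ : ∀ {x y} → 0# ≤ y → x * x ≤ y * y → x ≤ y
  square-cancel-≤ {x} {y} 0≤y le with ≤-total x y
  ... | inj₁ x≤y = x≤y
  ... | inj₂ y≤x with (x + y) ≟ 0#
  ...   | yes x+y≡0 = ≤-trans (≤-reflexive (+-zeroˡ (≤-trans 0≤y y≤x) 0≤y x+y≡0)) 0≤y
  ...   | no x+y≢0  = *-cancelˡ-≤ (x + y)
      (+-nonNegative (≤-trans 0≤y y≤x) 0≤y , (λ eq → x+y≢0 (sym eq)))
      (by-difference (x≤y⇒0≤y-x le)
        (solve 2 (λ x y → y :* y :- x :* x := (x :+ y) :* y :- (x :+ y) :* x) refl x y))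

  infix 5 ∣_∣
  ∣_∣ : ℝ → ℝ
  ∣ x ∣ with 0# ≤? x
  ... | yes _ = x
  ... | no _  = - x

  ≰⇒≥ : ∀ {x y} → ¬ (x ≤ y) → y ≤ x
  ≰⇒≥ {x} {y} x≰y with ≤-total x y
  ... | inj₁ x≤y = contradiction x≤y x≰y
  ... | inj₂ y≤x = y≤x

  ∣x∣-nonNegative : ∀ x → 0# ≤ ∣ x ∣
  ∣x∣-nonNegative x with 0# ≤? x
  ... | yes 0≤x = 0≤x
  ... | no 0≰x  = x≤0⇒0≤-x (≰⇒≥ 0≰x)

  ∣x∣-least : ∀ {x b} → x ≤ b → - x ≤ b → ∣ x ∣ ≤ b
  ∣x∣-least {x} x≤b -x≤b with 0# ≤? x
  ... | yes _ = x≤b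
  ... | no _  = -x≤b

  0≤x⇒∣x∣≡x : ∀ {x} → 0# ≤ x → ∣ x ∣ ≡ x
  0≤x⇒∣x∣≡x {x} 0≤x with 0# ≤? x
  ... | yes _  = refl
  ... | no 0≰x = contradiction 0≤x 0≰x

  x≤0⇒∣x∣≡-x : ∀ {x} → x ≤ 0# → ∣ x ∣ ≡ - x
  x≤0⇒∣x∣≡-x {x} x≤0 with 0# ≤? x
  ... | no _    = refl
  ... | yes 0≤x with ≤-antisym x≤0 0≤x
  ...   | refl = sym -0#≈0#

  ∣x∣*∣x∣≡x*x : ∀ x → ∣ x ∣ * ∣ x ∣ ≡ x * x
  ∣x∣*∣x∣≡x*x x with 0# ≤? x
  ... | yes _ = refl
  ... | no _  = solve 1 (λ x → :- x :* :- x := x :* x) refl x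

  norm : ℝ → ℝ → ℝ
  norm x y = √ (x * x + y * y)

  sum-of-squares : ∀ x y → 0# ≤ x * x + y * y
  sum-of-squares x y = +-nonNegative (square-nonNegative x) (square-nonNegative y)

  norm-nonNegative : ∀ x y → 0# ≤ norm x y
  norm-nonNegative x y = √-nonNegative (sum-of-squares x y)

  norm-square : ∀ x y → norm x y * norm x y ≡ x * x + y * y
  norm-square x y = √-square (sum-of-squares x y)

  norm-≤ : ∀ {x y b} → 0# ≤ b → x * x + y * y ≤ b * b → norm x y ≤ b
  norm-≤ {x} {y} 0≤b le = square-cancel-≤ 0≤b (subst (_≤ _) (sym (norm-square x y)) le)

  ∣x∣≤norm : ∀ x y → ∣ x ∣ ≤ norm x y
  ∣x∣≤norm x y = square-cancel-≤ (norm-nonNegative x y)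
    (subst₂ _≤_ (sym (∣x∣*∣x∣≡x*x x)) (sym (norm-square x y))
      (by-difference (square-nonNegative y)
        (solve 2 (λ a b → b := a :+ b :- a) refl (x * x) (y * y))))

  ∣y∣≤norm : ∀ x y → ∣ y ∣ ≤ norm x y
  ∣y∣≤norm x y = subst (λ s → ∣ y ∣ ≤ √ s) (+-comm _ _) (∣x∣≤norm y x)

  -- Lagrange's identity: the squares of the two sides differ by (a d - b c)².
  cauchy-schwarz : ∀ a b c d → a * c + b * d ≤ norm a b * norm c d
  cauchy-schwarz a b c d = square-cancel-≤
    (*-nonNegative (norm-nonNegative a b) (norm-nonNegative c d))
    (by-difference (square-nonNegative (a * d - b * c)) (begin
      (a * d - b * c) * (a * d - b * c)
        ≡⟨ solve 4 (λ a b c d → (a :* d :- b :* c) :* (a :* d :- b :* c)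
             := (a :* a :+ b :* b) :* (c :* c :+ d :* d)
                :- (a :* c :+ b :* d) :* (a :* c :+ b :* d)) refl a b c d ⟩
      (a * a + b * b) * (c * c + d * d) - s
        ≡⟨ cong (λ z → z - s) (cong₂ _*_ (sym (norm-square a b)) (sym (norm-square c d))) ⟩
      norm a b * norm a b * (norm c d * norm c d) - s
        ≡⟨ solve 3 (λ m n s → m :* m :* (n :* n) :- s := m :* n :* (m :* n) :- s) refl
             (norm a b) (norm c d) s ⟩
      norm a b * norm c d * (norm a b * norm c d) - s ∎))
    where
    open ≡-Reasoning
    s = (a * c + b * d) * (a * c + b * d)

  -- After squaring, the difference of the two sides is twice the gap in `cauchy-schwarz`.
  norm-triangle : ∀ a b c d → norm (a + c) (b + d) ≤ norm a b + norm c d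
  norm-triangle a b c d = norm-≤ (+-nonNegative (norm-nonNegative a b) (norm-nonNegative c d))
    (by-difference (+-nonNegative 0≤cs 0≤cs) (begin
      (m * n - (a * c + b * d)) + (m * n - (a * c + b * d))
        ≡⟨ solve 6 (λ a b c d m n → (m :* n :- (a :* c :+ b :* d)) :+ (m :* n :- (a :* c :+ b :* d))
             := ((a :* a :+ b :* b) :+ (c :* c :+ d :* d) :+ (m :* n :+ m :* n))
                :- ((a :+ c) :* (a :+ c) :+ (b :+ d) :* (b :+ d))) refl a b c d m n ⟩
      (a * a + b * b) + (c * c + d * d) + (m * n + m * n) - s
        ≡⟨ cong (λ z → z + (m * n + m * n) - s)
             (cong₂ _+_ (sym (norm-square a b)) (sym (norm-square c d))) ⟩
      m * m + n * n + (m * n + m * n) - s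
        ≡⟨ solve 3 (λ m n s → m :* m :+ n :* n :+ (m :* n :+ m :* n) :- s
             := (m :+ n) :* (m :+ n) :- s) refl m n s ⟩
      (m + n) * (m + n) - s ∎))
    where
    open ≡-Reasoning
    m = norm a b
    n = norm c d
    s = (a + c) * (a + c) + (b + d) * (b + d)
    0≤cs = x≤y⇒0≤y-x (cauchy-schwarz a b c d)

  ∣x∣≤1⇒x*x≤1 : ∀ {x} → ∣ x ∣ ≤ 1# → x * x ≤ 1#
  ∣x∣≤1⇒x*x≤1 {x} le = ≤-trans (≤-reflexive (sym (∣x∣*∣x∣≡x*x x)))
    (≤-trans (*-monoˡ-≤ ∣ x ∣ (∣x∣-nonNegative x) le) (≤-trans (≤-reflexive (*-identityʳ _)) le))

-- Trading an edge that leaves a set of vertices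

module Exchange {V : Set} (_≟_ : DecidableEquality V) where

  open EdgeLists {V}
  open DecMembership _≟_ using (_∈?_)

  -- Paths that may stop anywhere in S, as though S were contracted to a point; nothing is asserted
  -- about F connecting the members of S with each other.
  data Reach (S : List V) (F : List (V × V)) : V → Set where
    here : ∀ {z} → z ∈ S → Reach S F z
    step : ∀ {z y} → Adj F z y → Reach S F y → Reach S F z

  star-reach : ∀ {S F z y} → Star (Adj F) z y → Reach S F y → Reach S F z
  star-reach Star.ε        r = r
  star-reach (a ◅ as) r = step a (star-reach as r)

  ∈-↭-∷ : ∀ {A : Set} {x : A} {xs} → x ∈ xs → ∃ λ ys → xs ↭ x ∷ ys
  ∈-↭-∷ {x = x} x∈ with ∈-∃++ x∈
  ... | ys , zs , refl = ys ++ zs , shift x ys zs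

  -- The edge `e` leads from outside into S. What matters is that `path` runs in `rest`: with `e`
  -- deleted, D is still connected to its outer end.
  record Crossing (S : List V) (F : List (V × V)) (D : V) : Set where
    field
      {e}    : V × V
      {rest} : List (V × V)
      removed : F ↭ e ∷ rest
      outer inner : V
      joins  : e ≡ (outer , inner) ⊎ e ≡ (inner , outer)
      inner∈ : inner ∈ S
      outer∉ : outer ∉ S
      path   : Star (Adj rest) D outer

    End : V → Set
    End u = u ≡ outer ⊎ u ≡ inner

    ends : ∀ {u v} → (u , v) ≡ e → End u × End v
    ends refl with joins
    ... | inj₁ eq = inj₁ (cong proj₁ eq) , inj₂ (cong proj₂ eq)
    ... | inj₂ eq = inj₂ (cong proj₁ eq) , inj₁ (cong proj₂ eq)

    remaining : ∀ {u v} → Adj F u v → Adj rest u v ⊎ End u × End v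
    remaining (inj₁ e∈) with ∈-resp-↭ removed e∈
    ... | there e∈′ = inj₁ (inj₁ e∈′)
    ... | here eq   = inj₂ (ends eq)
    remaining (inj₂ e∈) with ∈-resp-↭ removed e∈
    ... | there e∈′ = inj₁ (inj₂ e∈′)
    ... | here eq   = inj₂ (proj₂ (ends eq) , proj₁ (ends eq))

    -- A path that used `e` is cut off at the first end of `e` it meets: the inner one lies in S,
    -- and the outer one has been added.
    relink-outer : ∀ {z} → Reach S F z → Reach (outer ∷ S) rest z
    relink-outer (here z∈)  = here (there z∈)
    relink-outer (step a r) with remaining a
    ... | inj₁ a′                = step a′ (relink-outer r)
    ... | inj₂ (inj₁ refl , _)   = here (here refl)
    ... | inj₂ (inj₂ refl , _)   = here (there inner∈)

    -- Within `rest` the outer end is joined to D, so adding D to S makes up for the loss of `e`.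
    -- This is the trade in the analysis of Prim's algorithm.
    relink : ∀ {z} → Reach S F z → Reach (D ∷ S) rest z
    relink r = via-path (relink-outer r)
      where
      via-path : ∀ {z} → Reach (outer ∷ S) rest z → Reach (D ∷ S) rest z
      via-path (here (here refl)) = star-reach (Star.reverse Sum.swap path) (here (here refl))
      via-path (here (there z∈))  = here (there z∈)
      via-path (step a r)         = step a (via-path r)

  -- Induction along the given path until it first enters S.
  crossing : ∀ {S F D} → D ∉ S → Reach S F D → Crossing S F D
  crossing D∉ (here D∈) = contradiction D∈ D∉
  crossing {S} {F} {D} D∉ (step {y = y} a r) with y ∈? S
  ... | yes y∈ = cross a
    where
    cross : Adj F D y → Crossing S F D
    cross (inj₁ e∈) = record
      { removed = proj₂ (∈-↭-∷ e∈) ; outer = D ; inner = y ; joins = inj₁ refl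
      ; inner∈ = y∈ ; outer∉ = D∉ ; path = Star.ε }
    cross (inj₂ e∈) = record
      { removed = proj₂ (∈-↭-∷ e∈) ; outer = D ; inner = y ; joins = inj₂ refl
      ; inner∈ = y∈ ; outer∉ = D∉ ; path = Star.ε }
  ... | no y∉ = record
      { removed = removed ; outer = outer ; inner = inner ; joins = joins
      ; inner∈ = inner∈ ; outer∉ = outer∉ ; path = first }
    where
    open Crossing (crossing y∉ r)
    first : Star (Adj rest) D outer
    first with remaining a
    ... | inj₁ a′               = a′ ◅ path
    -- The step out of D may be the deleted edge itself; D is then already the outer end.
    ... | inj₂ (inj₁ refl , _)  = Star.ε
    ... | inj₂ (inj₂ refl , _)  = contradiction inner∈ D∉

-- Bringing a connected graph into growth order

module SpanningGrowth {V : Set} (_≟_ : DecidableEquality V) where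

  open EdgeLists {V}
  open Exchange _≟_
  open DecMembership _≟_ using (_∈?_)

  -- es can be oriented and completed to a permutation of F.
  data _⊑_ : List (V × V) → List (V × V) → Set where
    []   : ∀ {F} → [] ⊑ F
    step : ∀ {u v es e F F′} → F ↭ e ∷ F′ → e ≡ (v , u) ⊎ e ≡ (u , v) → es ⊑ F′ → ((u , v) ∷ es) ⊑ F

  -- While a vertex of `vs` is missing, its path to S yields a crossing edge, which passes from F to
  -- the growth while its outer end joins S. Each round uses up an edge of F, hence the fuel `n`.
  spanning-growth : ∀ n {S F} vs → length F ℕ.≤ n → (∀ {v} → v ∈ vs → Reach S F v) →
                    ∃ λ es → Grow S es × (∀ {v} → v ∈ vs → v ∈ S ⊎ v ∈ heads es) × es ⊑ F
  spanning-growth n {S} {F} vs le reach with All.all? (_∈? S) vs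
  ... | yes all = [] , [] , inj₁ ∘ All.lookup all , []
  ... | no ¬all with find¬ vs ¬all
    where
    find¬ : ∀ vs → ¬ All (_∈ S) vs → ∃ λ D → D ∈ vs × D ∉ S
    find¬ []       ¬all = contradiction [] ¬all
    find¬ (v ∷ vs) ¬all with v ∈? S
    ... | no v∉ = v , here refl , v∉
    ... | yes v∈ with find¬ vs (¬all ∘ (v∈ ∷_))
    ...   | D , D∈ , D∉ = D , there D∈ , D∉
  ...   | D , D∈ , D∉ = go n le
    where
    open Crossing (crossing D∉ (reach D∈))
    go : ∀ n → length F ℕ.≤ n →
         ∃ λ es → Grow S es × (∀ {v} → v ∈ vs → v ∈ S ⊎ v ∈ heads es) × es ⊑ F
    go n le with n | subst (ℕ._≤ n) (↭-length removed) le
    ... | suc n | s≤s le′ with spanning-growth n vs le′ (λ v∈ → relink-outer (reach v∈))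
    ...   | es , grow , covers , sub =
      (inner , outer) ∷ es , step inner∈ outer∉ grow , covers′ ∘ covers , step removed joins sub
      where
      covers′ : ∀ {v} → v ∈ outer ∷ S ⊎ v ∈ heads es → v ∈ S ⊎ v ∈ outer ∷ heads es
      covers′ (inj₁ (here eq)) = inj₂ (here eq)
      covers′ (inj₁ (there p)) = inj₁ p
      covers′ (inj₂ p)         = inj₂ (there p)

  ⊑-ends : ∀ {P : V → Set} {es F} → es ⊑ F → All (λ (u , v) → P u × P v) F →
           All (λ (u , v) → P u × P v) es
  ⊑-ends [] all = []
  ⊑-ends (step F↭ joins sub) all with All.tabulate (λ x∈ → All.lookup all (∈-resp-↭ (↭-sym F↭) x∈)) | joins
  ... | (p , q) ∷ all′ | inj₁ refl = (q , p) ∷ ⊑-ends sub all′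
  ... | (p , q) ∷ all′ | inj₂ refl = (p , q) ∷ ⊑-ends sub all′

unique-⊆-length : ∀ {A : Set} {xs ys : List A} → Unique xs → xs ⊆ ys → length xs ℕ.≤ length ys
unique-⊆-length [] sub = z≤n
unique-⊆-length {A} {x ∷ xs} {ys} (x∉ ∷ u) sub with ∈-∃++ (sub (here refl))
... | as , bs , refl = ℕ.≤-trans (s≤s (unique-⊆-length u sub′)) (ℕ.≤-reflexive (sym (↭-length (shift x as bs))))
  where
  sub′ : xs ⊆ as ++ bs
  sub′ z∈ with ∈-resp-↭ (shift x as bs) (sub (there z∈))
  ... | here refl = contradiction refl (All.lookup x∉ z∈)
  ... | there z∈′ = z∈′

-- Rounding one coordinate to the sides of the cells

module Rounding (E : EuclideanField) {V : Set} (_≟ᵛ_ : DecidableEquality V) where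

  open EuclideanField E
  open OrderedField E
  open Solver
  open DecMembership _≟ᵛ_ using (_∈?_)

  variation : (V → ℝ) → List (V × V) → ℝ
  variation f []             = 0#
  variation f ((u , v) ∷ es) = ∣ f u - f v ∣ + variation f es

  variationℤ : (V → ℤ) → List (V × V) → ℕ
  variationℤ X []             = 0
  variationℤ X ((u , v) ∷ es) = ℤ.∣ X u ℤ.- X v ∣ ℕ.+ variationℤ X es

  ∣fromℤ∣ : ∀ i → ∣ fromℤ i ∣ ≡ fromℕ ℤ.∣ i ∣
  ∣fromℤ∣ (+ n)    = 0≤x⇒∣x∣≡x (fromℕ-nonNegative n)
  ∣fromℤ∣ -[1+ n ] = ≡.trans (x≤0⇒∣x∣≡-x (0≤x⇒-x≤0 (fromℕ-nonNegative (suc n))))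
    (solve 1 (λ x → :- (:- x) := x) refl _)

  ∣h*x∣ : ∀ {h} x → 0# ≤ h → ∣ h * x ∣ ≡ h * ∣ x ∣
  ∣h*x∣ {h} x 0≤h with ≤-total 0# x
  ... | inj₁ 0≤x = ≡.trans (0≤x⇒∣x∣≡x (*-nonNegative 0≤h 0≤x)) (cong (h *_) (sym (0≤x⇒∣x∣≡x 0≤x)))
  ... | inj₂ x≤0 = ≡.trans (x≤0⇒∣x∣≡-x hx≤0)
      (≡.trans (solve 2 (λ h x → :- (h :* x) := h :* (:- x)) refl h x) (cong (h *_) (sym (x≤0⇒∣x∣≡-x x≤0))))
    where
    hx≤0 : h * x ≤ 0#
    hx≤0 = subst (h * x ≤_) (zeroʳ h) (*-monoˡ-≤ h 0≤h x≤0)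

  ∣x-y∣-comm : ∀ x y → ∣ x - y ∣ ≡ ∣ y - x ∣
  ∣x-y∣-comm x y = ≤-antisym (le x y) (le y x)
    where
    le : ∀ x y → ∣ x - y ∣ ≤ ∣ y - x ∣
    le x y with ≤-total x y
    ... | inj₁ x≤y = ≤-reflexive (≡.trans
            (x≤0⇒∣x∣≡-x (by-difference (x≤y⇒0≤y-x x≤y) (solve 2 (λ x y → y :- x := con (+ 0) :- (x :- y)) refl x y)))
            (≡.trans (solve 2 (λ x y → :- (x :- y) := y :- x) refl x y) (sym (0≤x⇒∣x∣≡x (x≤y⇒0≤y-x x≤y)))))
    ... | inj₂ y≤x = ≤-reflexive (≡.trans (0≤x⇒∣x∣≡x (x≤y⇒0≤y-x y≤x))
            (≡.trans (solve 2 (λ x y → x :- y := :- (y :- x)) refl x y)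
            (sym (x≤0⇒∣x∣≡-x (by-difference (x≤y⇒0≤y-x y≤x) (solve 2 (λ x y → x :- y := con (+ 0) :- (y :- x)) refl x y))))))

  bump : Bool → ℤ
  bump b = if b then + 1 else + 0

  variation-scale : ∀ {h} (X : V → ℤ) f es → 0# ≤ h → (∀ p → f p ≡ h * fromℤ (X p)) →
                    variation f es ≡ h * fromℕ (variationℤ X es)
  variation-scale X f []             0≤h eq = sym (zeroʳ _)
  variation-scale {h} X f ((u , v) ∷ es) 0≤h eq = begin
    ∣ f u - f v ∣ + variation f es
      ≡⟨ cong₂ _+_ (cong ∣_∣ edge) (variation-scale X f es 0≤h eq) ⟩
    ∣ h * fromℤ (X u ℤ.- X v) ∣ + h * fromℕ (variationℤ X es)
      ≡⟨ cong (_+ h * fromℕ (variationℤ X es)) (≡.trans (∣h*x∣ _ 0≤h) (cong (h *_) (∣fromℤ∣ (X u ℤ.- X v)))) ⟩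
    h * fromℕ ℤ.∣ X u ℤ.- X v ∣ + h * fromℕ (variationℤ X es)
      ≡⟨ distribˡ h _ _ ⟨
    h * (fromℕ ℤ.∣ X u ℤ.- X v ∣ + fromℕ (variationℤ X es))
      ≡⟨ cong (h *_) (fromℕ-+ ℤ.∣ X u ℤ.- X v ∣ _) ⟨
    h * fromℕ (variationℤ X ((u , v) ∷ es)) ∎
    where
    open ≡-Reasoning
    edge : f u - f v ≡ h * fromℤ (X u ℤ.- X v)
    edge = begin
      f u - f v                         ≡⟨ cong₂ _-_ (eq u) (eq v) ⟩
      h * fromℤ (X u) - h * fromℤ (X v) ≡⟨ solve 3 (λ h a b → h :* a :- h :* b := h :* (a :- b)) refl h _ _ ⟩
      h * (fromℤ (X u) - fromℤ (X v))   ≡⟨ cong (λ z → h * (fromℤ (X u) + z)) (fromℤ-neg (X v)) ⟨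
      h * (fromℤ (X u) + fromℤ (ℤ.- X v)) ≡⟨ cong (h *_) (fromℤ-+ (X u) (ℤ.- X v)) ⟨
      h * fromℤ (X u ℤ.- X v)           ∎

  infixl 7 _⊓_
  _⊓_ : ℝ → ℝ → ℝ
  x ⊓ t with x ≤? t
  ... | yes _ = x
  ... | no _  = t

  x≤t⇒x⊓t≡x : ∀ {x t} → x ≤ t → x ⊓ t ≡ x
  x≤t⇒x⊓t≡x {x} {t} x≤t with x ≤? t
  ... | yes _  = refl
  ... | no x≰t = contradiction x≤t x≰t

  t≤x⇒x⊓t≡t : ∀ {x t} → t ≤ x → x ⊓ t ≡ t
  t≤x⇒x⊓t≡t {x} {t} t≤x with x ≤? t
  ... | yes x≤t = ≤-antisym x≤t t≤x
  ... | no _    = refl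

  ⊓-mono : ∀ t {x y} → x ≤ y → x ⊓ t ≤ y ⊓ t
  ⊓-mono t {x} {y} x≤y with x ≤? t | y ≤? t
  ... | yes _   | yes _  = x≤y
  ... | yes x≤t | no _   = x≤t
  ... | no x≰t  | yes y≤t = contradiction (≤-trans x≤y y≤t) x≰t
  ... | no _    | no _   = ≤-refl

  -- `x - x ⊓ t` is the part of x above the level t, that is max(x - t, 0).
  excess-mono : ∀ t {x y} → x ≤ y → x - x ⊓ t ≤ y - y ⊓ t
  excess-mono t {x} {y} x≤y with x ≤? t | y ≤? t
  ... | yes _   | yes _  = ≤-reflexive (≡.trans (-‿inverseʳ x) (sym (-‿inverseʳ y)))
  ... | yes x≤t | no y≰t = ≤-trans (≤-reflexive (-‿inverseʳ x)) (x≤y⇒0≤y-x (≰⇒≥ y≰t))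
  ... | no x≰t  | yes y≤t = contradiction (≤-trans x≤y y≤t) x≰t
  ... | no _    | no _   = +-monoˡ-≤ (- t) x≤y

  -- At p, a layer of thickness h has its bottom at h (A p), and f p measures
  -- the height above that bottom.
  module _ (A : V → ℤ) where

    Layer : ℝ → (V → ℝ) → V → ℝ
    Layer h f p = h * fromℤ (A p) + f p

    Within : ℝ → (V → ℝ) → Set
    Within h f = ∀ p → 0# ≤ f p × f p ≤ h

    within-low : ∀ {h t f} → 0# ≤ t → Within h f → Within t (λ p → f p ⊓ t)
    within-low {t = t} {f} 0≤t within p with f p ≤? t
    ... | yes le = proj₁ (within p) , le
    ... | no _   = 0≤t , ≤-refl

    within-high : ∀ {h t f} → t ≤ h → Within h f → Within (h - t) (λ p → f p - f p ⊓ t)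
    within-high {t = t} {f} t≤h within p with f p ≤? t
    ... | yes le = ≤-reflexive (sym (-‿inverseʳ _)) , ≤-trans (≤-reflexive (-‿inverseʳ _)) (x≤y⇒0≤y-x t≤h)
    ... | no ¬le = x≤y⇒0≤y-x (≰⇒≥ ¬le) , +-monoˡ-≤ (- t) (proj₂ (within p))

    -- Distinct integers differ by at least one, so the bottom of the layer at `v` is no lower than
    -- its top at `u`.
    layer-mono-< : ∀ {h f u v} → 0# ≤ h → Within h f → A u ℤ.< A v → Layer h f u ≤ Layer h f v
    layer-mono-< {h} {f} {u} {v} 0≤h within Au<Av = ≤-trans
      (+-monoʳ-≤ (h * fromℤ (A u)) (proj₂ (within u)))
      (by-difference (+-nonNegative (*-nonNegative 0≤h (x≤y⇒0≤y-x step₁)) (proj₁ (within v)))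
        (solve 4 (λ h a b g → h :* (b :- (con (+ 1) :+ a)) :+ g := h :* b :+ g :- (h :* a :+ h)) refl
          h (fromℤ (A u)) (fromℤ (A v)) (f v)))
      where
      fromℤ-nonNegative : ∀ {i} → + 0 ℤ.≤ i → 0# ≤ fromℤ i
      fromℤ-nonNegative {+ n} _ = fromℕ-nonNegative n
      step₁ : fromℤ (+ 1) + fromℤ (A u) ≤ fromℤ (A v)
      step₁ = by-difference (fromℤ-nonNegative (ℤ.i≤j⇒0≤j-i (ℤ.i<j⇒suc[i]≤j Au<Av)))
        (≡.trans (fromℤ-+ (A v) (ℤ.- ℤ.suc (A u))) (cong (λ z → fromℤ (A v) + z)
          (≡.trans (fromℤ-neg (ℤ.suc (A u))) (cong -_ (fromℤ-+ (+ 1) (A u))))))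

    -- Cutting every cell at relative height t writes the coordinate as a sum of two. Both order any
    -- two vertices alike, first by cell and then by `f`, so the absolute differences add up without
    -- cancellation.
    variation-split : ∀ {h t f} es → 0# ≤ t → t ≤ h → Within h f →
      variation (Layer t (λ p → f p ⊓ t)) es + variation (Layer (h - t) (λ p → f p - f p ⊓ t)) es
        ≤ variation (Layer h f) es
    variation-split [] 0≤t t≤h within = ≤-reflexive (+-identityˡ _)
    variation-split {h} {t} {f} ((u , v) ∷ es) 0≤t t≤h within =
      ≤-trans (≤-reflexive (solve 4 (λ a b c d → a :+ b :+ (c :+ d) := a :+ c :+ (b :+ d)) refl _ _ _ _))
        (+-mono-≤ edge (variation-split es 0≤t t≤h within))
      where
      low high : V → ℝ
      low  = Layer t (λ p → f p ⊓ t)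
      high = Layer (h - t) (λ p → f p - f p ⊓ t)
      sum : ∀ u v → (low u - low v) + (high u - high v) ≡ Layer h f u - Layer h f v
      sum u v = solve 8 (λ h t a b x y m n →
        (t :* a :+ m :- (t :* b :+ n)) :+ ((h :- t) :* a :+ (x :- m) :- ((h :- t) :* b :+ (y :- n)))
        := (h :* a :+ x) :- (h :* b :+ y)) refl h t (fromℤ (A u)) (fromℤ (A v)) (f u) (f v) (f u ⊓ t) (f v ⊓ t)
      same-sign : ∀ u v → low v ≤ low u → high v ≤ high u →
                  ∣ low u - low v ∣ + ∣ high u - high v ∣ ≤ ∣ Layer h f u - Layer h f v ∣
      same-sign u v l≤ h≤ = ≤-reflexive (≡.trans
        (cong₂ _+_ (0≤x⇒∣x∣≡x (x≤y⇒0≤y-x l≤)) (0≤x⇒∣x∣≡x (x≤y⇒0≤y-x h≤)))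
        (≡.trans (sum u v) (sym (0≤x⇒∣x∣≡x (subst (0# ≤_) (sum u v)
          (+-nonNegative (x≤y⇒0≤y-x l≤) (x≤y⇒0≤y-x h≤)))))))
      same-sign′ : low u ≤ low v → high u ≤ high v →
                  ∣ low u - low v ∣ + ∣ high u - high v ∣ ≤ ∣ Layer h f u - Layer h f v ∣
      same-sign′ l≤ h≤ = subst₂ _≤_ (cong₂ _+_ (∣x-y∣-comm _ _) (∣x-y∣-comm _ _)) (∣x-y∣-comm _ _)
        (same-sign v u l≤ h≤)
      edge : ∣ low u - low v ∣ + ∣ high u - high v ∣ ≤ ∣ Layer h f u - Layer h f v ∣
      edge with ℤ.<-cmp (A u) (A v)
      ... | tri< lt _ _ = same-sign′ (layer-mono-< 0≤t (within-low 0≤t within) lt)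
                                     (layer-mono-< (x≤y⇒0≤y-x t≤h) (within-high t≤h within) lt)
      ... | tri> _ _ gt = same-sign u v (layer-mono-< 0≤t (within-low 0≤t within) gt)
                                        (layer-mono-< (x≤y⇒0≤y-x t≤h) (within-high t≤h within) gt)
      ... | tri≈ _ Au≡Av _ with ≤-total (f u) (f v)
      ...   | inj₁ fu≤fv = same-sign′
          (+-mono-≤ (≤-reflexive (cong (λ a → t * fromℤ a) Au≡Av)) (⊓-mono t fu≤fv))
          (+-mono-≤ (≤-reflexive (cong (λ a → (h - t) * fromℤ a) Au≡Av)) (excess-mono t fu≤fv))
      ...   | inj₂ fv≤fu = same-sign u v
          (+-mono-≤ (≤-reflexive (cong (λ a → t * fromℤ a) (sym Au≡Av))) (⊓-mono t fv≤fu))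
          (+-mono-≤ (≤-reflexive (cong (λ a → (h - t) * fromℤ a) (sym Au≡Av))) (excess-mono t fv≤fu))

    bumped : (V → Bool) → V → ℤ
    bumped b p = A p ℤ.+ bump (b p)

    -- The layer is cut at the height of each intermediate point in turn. The
    -- variations of the slices add up to the whole, so the best slice is at
    -- most average.
    round-layer : ∀ vs {h f} es → 0# ≤ h → Within h f → (∀ p → f p ≡ 0# ⊎ f p ≡ h ⊎ p ∈ vs) →
                  ∃ λ b → h * fromℕ (variationℤ (bumped b) es) ≤ variation (Layer h f) es
    round-layer [] {h} {f} es 0≤h within extreme =
      b , ≤-reflexive (sym (variation-scale (bumped b) (Layer h f) es 0≤h exact))
      where
      b : V → Bool
      -- With no intermediate height left, every point is at the bottom or the top, and the layer is
      -- h times an integer coordinate.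
      b p = does (f p ≟ h)
      f-value : ∀ p → f p ≡ h * fromℤ (bump (b p))
      f-value p with f p ≟ h | extreme p
      ... | yes eq | _                = ≡.trans eq (solve 1 (λ h → h := h :* con (+ 1)) refl h)
      ... | no _   | inj₁ eq          = ≡.trans eq (sym (zeroʳ h))
      ... | no neq | inj₂ (inj₁ eq)   = contradiction eq neq
      ... | no _   | inj₂ (inj₂ ())
      exact : ∀ p → Layer h f p ≡ h * fromℤ (bumped b p)
      exact p = ≡.trans (cong (λ z → h * fromℤ (A p) + z) (f-value p))
        (≡.trans (sym (distribˡ h _ _)) (cong (h *_) (sym (fromℤ-+ (A p) (bump (b p))))))
    round-layer (v ∷ vs) {h} {f} es 0≤h within extreme
      with round-layer vs {t} {λ p → f p ⊓ t} es 0≤t (within-low 0≤t within) extreme-low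
         | round-layer vs {h - t} {λ p → f p - f p ⊓ t} es (x≤y⇒0≤y-x t≤h) (within-high t≤h within) extreme-high
      where
      t = f v
      0≤t = proj₁ (within v)
      t≤h = proj₂ (within v)
      -- After the cut, `v` is at the top of the lower slice and at the bottom of the upper one, so
      -- it can leave the list of intermediate points.
      extreme-low : ∀ p → f p ⊓ t ≡ 0# ⊎ f p ⊓ t ≡ t ⊎ p ∈ vs
      extreme-low p with extreme p
      ... | inj₁ eq = inj₁ (≡.trans (x≤t⇒x⊓t≡x (subst (_≤ t) (sym eq) 0≤t)) eq)
      ... | inj₂ (inj₁ eq) = inj₂ (inj₁ (t≤x⇒x⊓t≡t (subst (t ≤_) (sym eq) t≤h)))
      ... | inj₂ (inj₂ (here refl)) = inj₂ (inj₁ (x≤t⇒x⊓t≡x ≤-refl))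
      ... | inj₂ (inj₂ (there p∈)) = inj₂ (inj₂ p∈)
      extreme-high : ∀ p → f p - f p ⊓ t ≡ 0# ⊎ f p - f p ⊓ t ≡ h - t ⊎ p ∈ vs
      extreme-high p with extreme p
      ... | inj₁ eq = inj₁ (≡.trans (cong (λ z → f p - z) (x≤t⇒x⊓t≡x (subst (_≤ t) (sym eq) 0≤t))) (-‿inverseʳ _))
      ... | inj₂ (inj₁ eq) = inj₂ (inj₁ (cong₂ _-_ eq (t≤x⇒x⊓t≡t (subst (t ≤_) (sym eq) t≤h))))
      ... | inj₂ (inj₂ (here refl)) = inj₁ (≡.trans (cong (λ z → f p - z) (x≤t⇒x⊓t≡x ≤-refl)) (-‿inverseʳ _))
      ... | inj₂ (inj₂ (there p∈)) = inj₂ (inj₂ p∈)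
    ... | b₁ , le₁ | b₂ , le₂ = choose (ℕ.≤-total L₁ L₂)
      where
      L₁ = variationℤ (bumped b₁) es
      L₂ = variationℤ (bumped b₂) es
      t = f v
      0≤t = proj₁ (within v)
      t≤h = proj₂ (within v)
      0≤h-t = x≤y⇒0≤y-x t≤h
      total : t * fromℕ L₁ + (h - t) * fromℕ L₂ ≤ variation (Layer h f) es
      total = ≤-trans (+-mono-≤ le₁ le₂) (variation-split es 0≤t t≤h within)
      cut : ∀ x → h * x ≡ t * x + (h - t) * x
      cut x = solve 3 (λ h t x → h :* x := t :* x :+ (h :- t) :* x) refl h t x
      choose : L₁ ℕ.≤ L₂ ⊎ L₂ ℕ.≤ L₁ →
               ∃ λ b → h * fromℕ (variationℤ (bumped b) es) ≤ variation (Layer h f) es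
      choose (inj₁ le) = b₁ , ≤-trans (≤-reflexive (cut _))
        (≤-trans (+-monoʳ-≤ _ (*-monoˡ-≤ (h - t) 0≤h-t (fromℕ-mono-≤ le))) total)
      choose (inj₂ le) = b₂ , ≤-trans (≤-reflexive (cut _))
        (≤-trans (+-mono-≤ (*-monoˡ-≤ t 0≤t (fromℕ-mono-≤ le)) ≤-refl) total)

    round-coordinate : ∀ vs es (x : V → ℝ) →
      (∀ {p} → p ∈ vs → fromℤ (A p) ≤ x p × x p ≤ fromℤ (A p) + 1#) →
      All (λ (u , v) → u ∈ vs × v ∈ vs) es →
      ∃ λ b → fromℕ (variationℤ (bumped b) es) ≤ variation x es
    round-coordinate vs es x contains ends = finish (round-layer vs es 0≤1 within extreme)
      where
      f : V → ℝ
      -- Only points of `vs` are known to lie in their cells. The others are put at the bottom by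
      -- default; they are not ends of edges.
      f p = if does (p ∈? vs) then x p - fromℤ (A p) else 0#
      within : Within 1# f
      within p with p ∈? vs
      ... | no _   = ≤-refl , 0≤1
      ... | yes p∈ = x≤y⇒0≤y-x (proj₁ (contains p∈)) , by-difference (x≤y⇒0≤y-x (proj₂ (contains p∈)))
          (solve 3 (λ a x o → a :+ o :- x := o :- (x :- a)) refl (fromℤ (A p)) (x p) 1#)
      extreme : ∀ p → f p ≡ 0# ⊎ f p ≡ 1# ⊎ p ∈ vs
      extreme p with p ∈? vs
      ... | no _   = inj₁ refl
      ... | yes p∈ = inj₂ (inj₂ p∈)
      height : ∀ {p} → p ∈ vs → Layer 1# f p ≡ x p
      height {p} p∈ with p ∈? vs
      ... | yes _  = ≡.trans (cong (_+ (x p - fromℤ (A p))) (*-identityˡ _)) (solve 2 (λ a x → a :+ (x :- a) := x) refl _ _)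
      ... | no p∉  = contradiction p∈ p∉
      same : ∀ {es} → All (λ (u , v) → u ∈ vs × v ∈ vs) es → variation (Layer 1# f) es ≡ variation x es
      same []                = refl
      same ((u∈ , v∈) ∷ ends) = cong₂ _+_ (cong ∣_∣ (cong₂ _-_ (height u∈) (height v∈))) (same ends)
      finish : (∃ λ b → 1# * fromℕ (variationℤ (bumped b) es) ≤ variation (Layer 1# f) es) → _
      finish (b , le) = b , subst₂ _≤_ (*-identityˡ _) (same ends) le

-- Unit squares around a lattice tree

module LatticeCover where

  -- (x , y) stands for the unit square whose lower left corner is (x , y).
  around : ℤ → ℤ → List (ℤ × ℤ)
  around x y = (x , y) ∷ (ℤ.pred x , y) ∷ (x , ℤ.pred y) ∷ (ℤ.pred x , ℤ.pred y) ∷ []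

  private
    i-j≡0 : ∀ {i j} → ℤ.∣ i ℤ.- j ∣ ≡ 0 → j ≡ i
    i-j≡0 {i} {j} eq = sym (ℤ.i-j≡0⇒i≡j i j (ℤ.∣i∣≡0⇒i≡0 eq))

    ∣i∣≡1 : ∀ {i} → ℤ.∣ i ∣ ≡ 1 → i ≡ + 1 ⊎ i ≡ -[1+ 0 ]
    ∣i∣≡1 {+ _}      refl = inj₁ refl
    ∣i∣≡1 { -[1+ _ ]} refl = inj₂ refl

    j≡i-[i-j] : ∀ i j → j ≡ i ℤ.- (i ℤ.- j)
    j≡i-[i-j] i j = solve 2 (λ i j → j := i :- (i :- j)) refl i j
      where
      open import Data.Integer.Solver using (module +-*-Solver)
      open +-*-Solver

    i-j≡1 : ∀ {i j} → ℤ.∣ i ℤ.- j ∣ ≡ 1 → j ≡ ℤ.pred i ⊎ j ≡ ℤ.suc i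
    i-j≡1 {i} {j} eq with ∣i∣≡1 {i ℤ.- j} eq
    ... | inj₁ d≡1  = inj₁ (≡.trans (j≡i-[i-j] i j) (≡.trans (cong (λ d → i ℤ.- d) d≡1) (ℤ.+-comm i -[1+ 0 ])))
    ... | inj₂ d≡-1 = inj₂ (≡.trans (j≡i-[i-j] i j) (≡.trans (cong (λ d → i ℤ.- d) d≡-1) (ℤ.+-comm i (+ 1))))

    all⊆ : ∀ {xs ys : List (ℤ × ℤ)} → All (_∈ ys) xs → xs ⊆ ys
    all⊆ = All.lookup

    pattern 1st = here refl
    pattern 2nd = there (here refl)
    pattern 3rd = there (there (here refl))
    pattern 4th = there (there (there (here refl)))
    pattern 5th = there (there (there (there (here refl))))
    pattern 6th = there (there (there (there (there (here refl)))))

  -- A unit step keeps two of the four squares and finds two new ones. From distance two on, the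
  -- allowance covers all four squares of the new corner, whether or not some were known.
  new-squares : ∀ x y x′ y′ → ∃ λ N →
    length N ℕ.≤ 2 ℕ.* (ℤ.∣ x ℤ.- x′ ∣ ℕ.+ ℤ.∣ y ℤ.- y′ ∣) × around x′ y′ ⊆ around x y ++ N
  new-squares x y x′ y′ with ℤ.∣ x ℤ.- x′ ∣ in dx | ℤ.∣ y ℤ.- y′ ∣ in dy
  ... | 0 | 0 with i-j≡0 {x} dx | i-j≡0 {y} dy
  ...   | refl | refl = [] , z≤n , ∈-++⁺ˡ
  new-squares x y x′ y′ | 1 | 0 with i-j≡1 {x} dx | i-j≡0 {y} dy
  ...   | inj₁ refl | refl = (ℤ.pred (ℤ.pred x) , y) ∷ (ℤ.pred (ℤ.pred x) , ℤ.pred y) ∷ [] ,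
          s≤s (s≤s z≤n) , all⊆ (2nd ∷ 5th ∷ 4th ∷ 6th ∷ [])
  ...   | inj₂ refl | refl = (ℤ.suc x , y) ∷ (ℤ.suc x , ℤ.pred y) ∷ [] , s≤s (s≤s z≤n) ,
          all⊆ (5th ∷ here (cong (_, y) (ℤ.pred-suc x)) ∷ 6th ∷
                there (there (here (cong (_, ℤ.pred y) (ℤ.pred-suc x)))) ∷ [])
  new-squares x y x′ y′ | 0 | 1 with i-j≡0 {x} dx | i-j≡1 {y} dy
  ...   | refl | inj₁ refl = (x , ℤ.pred (ℤ.pred y)) ∷ (ℤ.pred x , ℤ.pred (ℤ.pred y)) ∷ [] ,
          s≤s (s≤s z≤n) , all⊆ (3rd ∷ 4th ∷ 5th ∷ 6th ∷ [])
  ...   | refl | inj₂ refl = (x , ℤ.suc y) ∷ (ℤ.pred x , ℤ.suc y) ∷ [] , s≤s (s≤s z≤n) ,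
          all⊆ (5th ∷ 6th ∷ here (cong (x ,_) (ℤ.pred-suc y)) ∷
                there (here (cong (ℤ.pred x ,_) (ℤ.pred-suc y))) ∷ [])
  new-squares x y x′ y′ | 0           | suc (suc n) = around x′ y′ , 4≤ n , ∈-++⁺ʳ (around x y)
    where
    4≤ : ∀ n → 4 ℕ.≤ 2 ℕ.* (2 ℕ.+ n)
    4≤ n = ℕ.*-monoʳ-≤ 2 (s≤s (s≤s z≤n))
  new-squares x y x′ y′ | 1           | suc n       = around x′ y′ , ℕ.*-monoʳ-≤ 2 {2} {2 ℕ.+ n} (s≤s (s≤s z≤n)) , ∈-++⁺ʳ (around x y)
  new-squares x y x′ y′ | suc (suc m) | n           = around x′ y′ , ℕ.*-monoʳ-≤ 2 {2} {2 ℕ.+ m ℕ.+ n} (s≤s (s≤s z≤n)) , ∈-++⁺ʳ (around x y)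

  module _ {V : Set} (X Y : V → ℤ) where

    open EdgeLists {V}

    squares : V → List (ℤ × ℤ)
    squares v = around (X v) (Y v)

    length-ℤ : List (V × V) → ℕ
    length-ℤ []             = 0
    length-ℤ ((u , v) ∷ es) = ℤ.∣ X u ℤ.- X v ∣ ℕ.+ ℤ.∣ Y u ℤ.- Y v ∣ ℕ.+ length-ℤ es

    -- The tail of each edge is already covered when the edge is added, so only the new squares at
    -- its head are to be paid for.
    grow-cover : ∀ {S es} L → Grow S es → (∀ {s} → s ∈ S → squares s ⊆ L) →
                 ∃ λ L′ → length L′ ℕ.≤ length L ℕ.+ 2 ℕ.* length-ℤ es ×
                          (∀ {v} → v ∈ S ⊎ v ∈ heads es → squares v ⊆ L′)
    grow-cover L [] covers = L , ℕ.m≤m+n _ _ , λ { (inj₁ s∈) → covers s∈ }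
    grow-cover {S} L (step {u} {v} {es} u∈ v∉ g) covers with new-squares (X u) (Y u) (X v) (Y v)
    ... | N , N≤ , sub with grow-cover (L ++ N) g covers′
      where
      covers′ : ∀ {s} → s ∈ v ∷ S → squares s ⊆ L ++ N
      covers′ (there s∈) c∈ = ∈-++⁺ˡ (covers s∈ c∈)
      covers′ (here refl) c∈ with ∈-++⁻ (squares u) (sub c∈)
      ... | inj₁ c∈u = ∈-++⁺ˡ (covers u∈ c∈u)
      ... | inj₂ c∈N = ∈-++⁺ʳ L c∈N
    ...   | L′ , L′≤ , covers′ = L′ , bound , covers′ ∘ regroup
      where
      open ℕ.≤-Reasoning
      d = ℤ.∣ X u ℤ.- X v ∣ ℕ.+ ℤ.∣ Y u ℤ.- Y v ∣
      bound : length L′ ℕ.≤ length L ℕ.+ 2 ℕ.* (d ℕ.+ length-ℤ es)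
      bound = begin
        length L′                                        ≤⟨ L′≤ ⟩
        length (L ++ N) ℕ.+ 2 ℕ.* length-ℤ es            ≡⟨ cong (ℕ._+ 2 ℕ.* length-ℤ es) (length-++ L) ⟩
        length L ℕ.+ length N ℕ.+ 2 ℕ.* length-ℤ es      ≤⟨ ℕ.+-monoˡ-≤ _ (ℕ.+-monoʳ-≤ (length L) N≤) ⟩
        length L ℕ.+ 2 ℕ.* d ℕ.+ 2 ℕ.* length-ℤ es       ≡⟨ ℕ.+-assoc (length L) _ _ ⟩
        length L ℕ.+ (2 ℕ.* d ℕ.+ 2 ℕ.* length-ℤ es)     ≡⟨ cong (length L ℕ.+_) (ℕ.*-distribˡ-+ 2 d _) ⟨
        length L ℕ.+ 2 ℕ.* (d ℕ.+ length-ℤ es)           ∎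
      regroup : ∀ {w} → w ∈ S ⊎ w ∈ v ∷ heads es → w ∈ v ∷ S ⊎ w ∈ heads es
      regroup (inj₁ p)           = inj₁ (there p)
      regroup (inj₂ (here refl)) = inj₁ (here refl)
      regroup (inj₂ (there p))   = inj₂ p

-- Distances in the plane and the number of cells that a tree meets

module PlaneGeometry (R : Reals) where

  open GGMST R
  open OrderedField euclideanField public
  open Solver

  dist-nonNegative : ∀ p q → 0# ≤ dist p q
  dist-nonNegative (x₁ , y₁) (x₂ , y₂) = norm-nonNegative (x₁ - x₂) (y₁ - y₂)

  dist-sym : ∀ p q → dist p q ≡ dist q p
  dist-sym (x₁ , y₁) (x₂ , y₂) = cong √ (solve 4 (λ a b c d →
    (a :- b) :* (a :- b) :+ (c :- d) :* (c :- d) := (b :- a) :* (b :- a) :+ (d :- c) :* (d :- c))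
    refl x₁ x₂ y₁ y₂)

  dist-triangle : ∀ p q r → dist p r ≤ dist p q + dist q r
  dist-triangle (x₁ , y₁) (x₂ , y₂) (x₃ , y₃) =
    subst (_≤ norm (x₁ - x₂) (y₁ - y₂) + norm (x₂ - x₃) (y₂ - y₃))
      (cong₂ norm (eq x₁ x₂ x₃) (eq y₁ y₂ y₃))
      (norm-triangle (x₁ - x₂) (y₁ - y₂) (x₂ - x₃) (y₂ - y₃))
    where
    eq : ∀ a b c → (a - b) + (b - c) ≡ a - c
    eq = solve 3 (λ a b c → (a :- b) :+ (b :- c) := a :- c) refl

  dist-refl : ∀ p → dist p p ≡ 0#
  dist-refl (x , y) = ≤-antisym
    (norm-≤ ≤-refl (≤-reflexive (solve 2 (λ x y → (x :- x) :* (x :- x) :+ (y :- y) :* (y :- y) := con (+ 0) :* con (+ 0)) refl x y)))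
    (dist-nonNegative (x , y) (x , y))

  0≤√2 : 0# ≤ √ (fromℕ 2)
  0≤√2 = √-nonNegative (fromℕ-nonNegative 2)

  dist-same-cell : ∀ {p q c} → p ∈ᶜ c → q ∈ᶜ c → dist p q ≤ √ (fromℕ 2)
  dist-same-cell {x₁ , y₁} {x₂ , y₂} {a , b} ((a≤x₁ , x₁≤) , (b≤y₁ , y₁≤)) ((a≤x₂ , x₂≤) , (b≤y₂ , y₂≤)) =
    norm-≤ 0≤√2 (≤-trans (+-mono-≤ (square≤1 a≤x₁ x₁≤ a≤x₂ x₂≤) (square≤1 b≤y₁ y₁≤ b≤y₂ y₂≤))
      (≤-reflexive (≡.trans (cong (λ z → 1# + z) (sym (+-identityʳ 1#))) (sym (√-square (fromℕ-nonNegative 2))))))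
    where
    half : ∀ {a x y} → x ≤ a + 1# → a ≤ y → x - y ≤ 1#
    half {a} {x} {y} x≤ a≤y = by-difference (+-nonNegative (x≤y⇒0≤y-x x≤) (x≤y⇒0≤y-x a≤y))
      (solve 4 (λ a x y o → a :+ o :- x :+ (y :- a) := o :- (x :- y)) refl a x y 1#)
    square≤1 : ∀ {a x y} → a ≤ x → x ≤ a + 1# → a ≤ y → y ≤ a + 1# → (x - y) * (x - y) ≤ 1#
    square≤1 {a} {x} {y} a≤x x≤ a≤y y≤ = ∣x∣≤1⇒x*x≤1 (∣x∣-least (half x≤ a≤y)
      (subst (_≤ 1#) (solve 2 (λ x y → y :- x := :- (x :- y)) refl x y) (half y≤ a≤x)))

  edgesWeight-nonNegative : ∀ es → 0# ≤ edgesWeight es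
  edgesWeight-nonNegative []             = ≤-refl
  edgesWeight-nonNegative ((u , v) ∷ es) = +-nonNegative (dist-nonNegative u v) (edgesWeight-nonNegative es)

  edgesWeight-++ : ∀ xs ys → edgesWeight (xs ++ ys) ≡ edgesWeight xs + edgesWeight ys
  edgesWeight-++ []             ys = sym (+-identityˡ _)
  edgesWeight-++ ((u , v) ∷ xs) ys = ≡.trans (cong (λ z → dist u v + z) (edgesWeight-++ xs ys)) (sym (+-assoc _ _ _))

  edgesWeight-↭ : ∀ {xs ys} → xs ↭ ys → edgesWeight xs ≡ edgesWeight ys
  edgesWeight-↭ refl                          = refl
  edgesWeight-↭ (prep (u , v) p)              = cong (λ z → dist u v + z) (edgesWeight-↭ p)
  edgesWeight-↭ (swap (u , v) (u′ , v′) p)    = ≡.trans (cong (λ z → dist u v + (dist u′ v′ + z)) (edgesWeight-↭ p))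
    (solve 3 (λ a b c → a :+ (b :+ c) := b :+ (a :+ c)) refl _ _ _)
  edgesWeight-↭ (trans p q)                   = ≡.trans (edgesWeight-↭ p) (edgesWeight-↭ q)

  open EdgeLists {Point}
  open SpanningGrowth _≟ₚ_

  ⊑-weight : ∀ {es F} → es ⊑ F → edgesWeight es ≤ edgesWeight F
  ⊑-weight {F = F} []                  = edgesWeight-nonNegative F
  ⊑-weight {F = F} (step {u} {v} {es} {F′ = F′} F↭ joins sub) =
    ≤-trans (+-monoʳ-≤ (dist u v) (⊑-weight sub))
            (≤-reflexive (≡.trans (edge joins) (sym (edgesWeight-↭ F↭))))
    where
    edge : ∀ {e} → e ≡ (v , u) ⊎ e ≡ (u , v) → dist u v + edgesWeight F′ ≡ edgesWeight (e ∷ F′)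
    edge (inj₁ refl) = cong (_+ edgesWeight F′) (dist-sym u v)
    edge (inj₂ refl) = refl

  open Rounding euclideanField _≟ₚ_
  open LatticeCover

  variation-x≤weight : ∀ es → variation proj₁ es ≤ edgesWeight es
  variation-x≤weight []             = ≤-refl
  variation-x≤weight (((x₁ , y₁) , (x₂ , y₂)) ∷ es) = +-mono-≤ (∣x∣≤norm (x₁ - x₂) (y₁ - y₂)) (variation-x≤weight es)

  variation-y≤weight : ∀ es → variation proj₂ es ≤ edgesWeight es
  variation-y≤weight []             = ≤-refl
  variation-y≤weight (((x₁ , y₁) , (x₂ , y₂)) ∷ es) = +-mono-≤ (∣y∣≤norm (x₁ - x₂) (y₁ - y₂)) (variation-y≤weight es)

  length-ℤ-split : ∀ X Y es → length-ℤ X Y es ≡ variationℤ X es ℕ.+ variationℤ Y es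
  length-ℤ-split X Y []             = refl
  length-ℤ-split X Y ((u , v) ∷ es) = ≡.trans (cong (_ ℕ.+_) (length-ℤ-split X Y es))
    (interchange ℤ.∣ X u ℤ.- X v ∣ ℤ.∣ Y u ℤ.- Y v ∣ (variationℤ X es) (variationℤ Y es))
    where
    interchange : ∀ a b c d → (a ℕ.+ b) ℕ.+ (c ℕ.+ d) ≡ (a ℕ.+ c) ℕ.+ (b ℕ.+ d)
    interchange = solveℕ 4 (λ a b c d → (a ⊕ b) ⊕ (c ⊕ d) ⊜ (a ⊕ c) ⊕ (b ⊕ d)) refl
      where open Data.Nat.Solver.+-*-Solver using () renaming (solve to solveℕ; _:+_ to _⊕_; _:=_ to _⊜_)

  -- Every point can be moved to a corner of its cell without increasing the
  -- total horizontal or vertical length of the edges. A lattice point lies in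
  -- four cells, and an edge of rectilinear length d reaches at most 2 d new ones.
  cells-bound : ∀ (cell : Point → Cell) vs {r es} → Grow (r ∷ []) es →
    All (λ (u , v) → u ∈ vs × v ∈ vs) es → (∀ {p} → p ∈ vs → p ∈ᶜ cell p) →
    ∀ cs → Unique cs → (∀ {c} → c ∈ cs → ∃ λ v → (v ∈ r ∷ [] ⊎ v ∈ heads es) × cell v ≡ c) →
    fromℕ (length cs) ≤ fromℕ 4 + fromℕ 4 * edgesWeight es
  cells-bound cell vs {r} {es} grow ends contains cs unique occupied
    with round-coordinate (proj₁ ∘ cell) vs es proj₁ (proj₁ ∘ contains) ends
       | round-coordinate (proj₂ ∘ cell) vs es proj₂ (proj₂ ∘ contains) ends
  ... | bx , bx≤ | by , by≤ with grow-cover X Y (squares X Y r) grow (λ { (here refl) → id })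
    where
    X = bumped (proj₁ ∘ cell) bx
    Y = bumped (proj₂ ∘ cell) by
  ...   | L , L≤ , covers = ≤-trans (fromℕ-mono-≤ (ℕ.≤-trans (unique-⊆-length unique cs⊆L) L≤)) (begin
      fromℕ (4 ℕ.+ 2 ℕ.* length-ℤ X Y es)
        ≡⟨ fromℕ-+ 4 (2 ℕ.* length-ℤ X Y es) ⟩
      fromℕ 4 + fromℕ (2 ℕ.* length-ℤ X Y es)
        ≡⟨ cong (λ z → fromℕ 4 + z) (≡.trans (fromℕ-* 2 (length-ℤ X Y es)) (cong (fromℕ 2 *_)
             (≡.trans (cong fromℕ (length-ℤ-split X Y es)) (fromℕ-+ (variationℤ X es) _)))) ⟩
      fromℕ 4 + fromℕ 2 * (fromℕ (variationℤ X es) + fromℕ (variationℤ Y es))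
        ≤⟨ +-monoʳ-≤ (fromℕ 4) (*-monoˡ-≤ (fromℕ 2) (fromℕ-nonNegative 2) (+-mono-≤
             (≤-trans bx≤ (variation-x≤weight es)) (≤-trans by≤ (variation-y≤weight es)))) ⟩
      -- An edge is at least as long as either of its projections, so the weight bounds both
      -- extents: two coordinates, with two squares per unit of each, give the factor 4.
      fromℕ 4 + fromℕ 2 * (edgesWeight es + edgesWeight es)
        ≡⟨ solve 1 (λ w → con (+ 4) :+ con (+ 2) :* (w :+ w) := con (+ 4) :+ con (+ 4) :* w) refl (edgesWeight es) ⟩
      fromℕ 4 + fromℕ 4 * edgesWeight es ∎)
    where
    open ≤-Reasoning
    X = bumped (proj₁ ∘ cell) bx
    Y = bumped (proj₂ ∘ cell) by
    pred+1 : ∀ i → i ≡ ℤ.pred (i ℤ.+ + 1)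
    pred+1 i = sym (≡.trans (cong ℤ.pred (ℤ.+-comm i (+ 1))) (ℤ.pred-suc i))
    -- A raised coordinate lies on the far side of the cell, so the cell is found one step back from
    -- the corner.
    cell∈squares : ∀ v → cell v ∈ squares X Y v
    cell∈squares v with bx v | by v
    ... | false | false = here (cong₂ _,_ (sym (ℤ.+-identityʳ _)) (sym (ℤ.+-identityʳ _)))
    ... | true  | false = there (here (cong₂ _,_ (pred+1 _) (sym (ℤ.+-identityʳ _))))
    ... | false | true  = there (there (here (cong₂ _,_ (sym (ℤ.+-identityʳ _)) (pred+1 _))))
    ... | true  | true  = there (there (there (here (cong₂ _,_ (pred+1 _) (pred+1 _)))))
    cs⊆L : cs ⊆ L
    cs⊆L c∈ with occupied c∈
    ... | v , v∈ , refl = covers v∈ (cell∈squares v)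

-- Results of the timed list operations

module TimedValues where

  private
    variable
      A B : Set

  appendᵗ-value : (xs ys : List A) → value (appendᵗ xs ys) ≡ xs ++ ys
  appendᵗ-value []       ys = refl
  appendᵗ-value (x ∷ xs) ys = cong (x ∷_) (appendᵗ-value xs ys)

  ∈-appendᵗ⁺ˡ : {xs ys : List A} {x : A} → x ∈ xs → x ∈ value (appendᵗ xs ys)
  ∈-appendᵗ⁺ˡ {xs = xs} {ys} {x} x∈ = subst (x ∈_) (sym (appendᵗ-value xs ys)) (∈-++⁺ˡ x∈)

  ∈-appendᵗ⁺ʳ : (xs : List A) {ys : List A} {x : A} → x ∈ ys → x ∈ value (appendᵗ xs ys)
  ∈-appendᵗ⁺ʳ xs {ys} {x} x∈ = subst (x ∈_) (sym (appendᵗ-value xs ys)) (∈-++⁺ʳ xs x∈)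

  ∈-appendᵗ⁻ : (xs ys : List A) {x : A} → x ∈ value (appendᵗ xs ys) → x ∈ xs ⊎ x ∈ ys
  ∈-appendᵗ⁻ xs ys {x} x∈ = ∈-++⁻ xs (subst (x ∈_) (appendᵗ-value xs ys) x∈)

  mapᵗ-value : (f : A → Timed B) (xs : List A) → value (mapᵗ f xs) ≡ map (value ∘ f) xs
  mapᵗ-value f []       = refl
  mapᵗ-value f (x ∷ xs) = cong (value (f x) ∷_) (mapᵗ-value f xs)

  map⁺ᵗ-value : (f : A → Timed B) (xs : List⁺ A) → toList (value (map⁺ᵗ f xs)) ≡ map (value ∘ f) (toList xs)
  map⁺ᵗ-value f (x ∷ xs) = cong (value (f x) ∷_) (mapᵗ-value f xs)

  concatMapᵗ-value : (f : A → Timed (List⁺ B)) (xs : List A) →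
                     value (concatMapᵗ f xs) ≡ concatMap (toList ∘ value ∘ f) xs
  concatMapᵗ-value f []       = refl
  concatMapᵗ-value f (x ∷ xs) = ≡.trans (appendᵗ-value (toList (value (f x))) _)
    (cong (toList (value (f x)) ++_) (concatMapᵗ-value f xs))

  concatMap⁺ᵗ-value : (f : A → Timed (List⁺ B)) (xs : List⁺ A) →
                      toList (value (concatMap⁺ᵗ f xs)) ≡ concatMap (toList ∘ value ∘ f) (toList xs)
  concatMap⁺ᵗ-value f (x ∷ xs) = cong (List⁺.head (value (f x)) ∷_)
    (≡.trans (appendᵗ-value (List⁺.tail (value (f x))) _)
      (cong (List⁺.tail (value (f x)) ++_) (concatMapᵗ-value f xs)))

  ∈-concatMap⁺ᵗ⁺ : (f : A → Timed (List⁺ B)) {xs : List⁺ A} {x : A} {y : B} →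
                   x ∈ toList xs → y ∈ toList (value (f x)) → y ∈ toList (value (concatMap⁺ᵗ f xs))
  ∈-concatMap⁺ᵗ⁺ f {xs} {x} {y} x∈ y∈ = subst (y ∈_) (sym (concatMap⁺ᵗ-value f xs))
    (∈-concatMap⁺ (toList ∘ value ∘ f) (Any.map (λ { refl → y∈ }) x∈))

  ∈-concatMap⁺ᵗ⁻ : (f : A → Timed (List⁺ B)) (xs : List⁺ A) {y : B} →
                   y ∈ toList (value (concatMap⁺ᵗ f xs)) → ∃ λ x → x ∈ toList xs × y ∈ toList (value (f x))
  ∈-concatMap⁺ᵗ⁻ f xs {y} y∈ = find (∈-concatMap⁻ (toList ∘ value ∘ f) (subst (y ∈_) (concatMap⁺ᵗ-value f xs) y∈))

  ∈-mapᵗ⁺ : (f : A → Timed B) {xs : List A} {x : A} → x ∈ xs → value (f x) ∈ value (mapᵗ f xs)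
  ∈-mapᵗ⁺ f {xs} x∈ = subst (_ ∈_) (sym (mapᵗ-value f xs)) (∈-map⁺ _ x∈)

  ∈-mapᵗ⁻ : (f : A → Timed B) (xs : List A) {y : B} → y ∈ value (mapᵗ f xs) → ∃ λ x → x ∈ xs × y ≡ value (f x)
  ∈-mapᵗ⁻ f xs y∈ = ∈-map⁻ _ (subst (_ ∈_) (mapᵗ-value f xs) y∈)

  ∈-map⁺ᵗ⁺ : (f : A → Timed B) {xs : List⁺ A} {x : A} → x ∈ toList xs → value (f x) ∈ toList (value (map⁺ᵗ f xs))
  ∈-map⁺ᵗ⁺ f {xs} {x} x∈ = subst (value (f x) ∈_) (sym (map⁺ᵗ-value f xs)) (∈-map⁺ _ x∈)

  ∈-map⁺ᵗ⁻ : (f : A → Timed B) (xs : List⁺ A) {y : B} →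
             y ∈ toList (value (map⁺ᵗ f xs)) → ∃ λ x → x ∈ toList xs × y ≡ value (f x)
  ∈-map⁺ᵗ⁻ f xs {y} y∈ = ∈-map⁻ (value ∘ f) (subst (y ∈_) (map⁺ᵗ-value f xs) y∈)

  ∈-filterᵗ⁺ : (p : A → Timed Bool) {xs : List A} {x : A} → x ∈ xs → value (p x) ≡ true → x ∈ value (filterᵗ p xs)
  ∈-filterᵗ⁺ p {y ∷ xs} (here refl) eq rewrite eq = here refl
  ∈-filterᵗ⁺ p {y ∷ xs} (there x∈) eq with value (p y)
  ... | true  = there (∈-filterᵗ⁺ p x∈ eq)
  ... | false = ∈-filterᵗ⁺ p x∈ eq

  ∈-filterᵗ⁻ : (p : A → Timed Bool) (xs : List A) {x : A} → x ∈ value (filterᵗ p xs) → x ∈ xs × value (p x) ≡ true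
  ∈-filterᵗ⁻ p (y ∷ xs) x∈ with value (p y) in eq
  ∈-filterᵗ⁻ p (y ∷ xs) (here refl) | true = here refl , eq
  ∈-filterᵗ⁻ p (y ∷ xs) (there x∈)  | true with ∈-filterᵗ⁻ p xs x∈
  ... | x∈′ , eq′ = there x∈′ , eq′
  ∈-filterᵗ⁻ p (y ∷ xs) x∈ | false with ∈-filterᵗ⁻ p xs x∈
  ... | x∈′ , eq′ = there x∈′ , eq′

  filterᵗ-unique : (p : A → Timed Bool) {xs : List A} → Unique xs → Unique (value (filterᵗ p xs))
  filterᵗ-unique p []       = []
  filterᵗ-unique p {x ∷ xs} (x∉ ∷ u) with value (p x)
  ... | true  = All.tabulate (λ y∈ → All.lookup x∉ (proj₁ (∈-filterᵗ⁻ p xs y∈))) ∷ filterᵗ-unique p u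
  ... | false = filterᵗ-unique p u

  toVecᵗ-value : (xs : List A) → Vec.toList (value (toVecᵗ xs)) ≡ xs
  toVecᵗ-value []       = refl
  toVecᵗ-value (x ∷ xs) = cong (x ∷_) (toVecᵗ-value xs)

  lengthᵗ-value : (xs : List A) → value (lengthᵗ xs) ≡ length xs
  lengthᵗ-value []       = refl
  lengthᵗ-value (x ∷ xs) = cong suc (lengthᵗ-value xs)

  selectᵗ-complete : ∀ {n} (xs : Vec A (suc n)) {x} → x ∈ Vec.toList xs →
                     ∃ λ rest → (x , rest) ∈ toList (value (selectᵗ xs))
  selectᵗ-complete (x ∷ [])           (here refl) = [] , here refl
  selectᵗ-complete (x ∷ xs@(_ ∷ _))   (here refl) = xs , here refl
  selectᵗ-complete (x ∷ xs@(_ ∷ _))   (there x∈) with selectᵗ-complete xs x∈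
  ... | rest , sel∈ = x ∷ rest , there (∈-mapᵗ⁺ (λ (y , rest) → pure (y , x ∷ rest)) sel∈)

  selectᵗ-sound : ∀ {n} (xs : Vec A (suc n)) {x rest} → (x , rest) ∈ toList (value (selectᵗ xs)) →
                  Vec.toList xs ↭ x ∷ Vec.toList rest
  selectᵗ-sound (x ∷ [])         (here refl) = refl
  selectᵗ-sound (x ∷ xs@(_ ∷ _)) (here refl) = refl
  selectᵗ-sound (x ∷ xs@(_ ∷ _)) (there sel∈)
    with ∈-mapᵗ⁻ (λ (y , rest) → pure (y , x ∷ rest)) (toList (value (selectᵗ xs))) sel∈
  ... | (y , rest) , sel∈′ , refl = trans (prep x (selectᵗ-sound xs sel∈′)) (swap x y refl)

-- Lists without repetitions

unique-resp-↭ : ∀ {A : Set} {xs ys : List A} → xs ↭ ys → Unique xs → Unique ys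
unique-resp-↭ refl         u                     = u
unique-resp-↭ (prep x p)   (x∉ ∷ u)              = All-resp-↭ p x∉ ∷ unique-resp-↭ p u
unique-resp-↭ (swap x y p) ((x≢y ∷ x∉) ∷ y∉ ∷ u) =
  ((x≢y ∘ sym) ∷ All-resp-↭ p y∉) ∷ All-resp-↭ p x∉ ∷ unique-resp-↭ p u
unique-resp-↭ (trans p q)  u                     = unique-resp-↭ q (unique-resp-↭ p u)

unique-++ˡ : ∀ {A : Set} (xs : List A) {ys} → Unique (xs ++ ys) → Unique xs
unique-++ˡ []       u        = []
unique-++ˡ (x ∷ xs) (x∉ ∷ u) = All.tabulate (λ y∈ → All.lookup x∉ (∈-++⁺ˡ y∈)) ∷ unique-++ˡ xs u

unique-++ʳ : ∀ {A : Set} (xs : List A) {ys} → Unique (xs ++ ys) → Unique ys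
unique-++ʳ []       u       = u
unique-++ʳ (x ∷ xs) (_ ∷ u) = unique-++ʳ xs u

unique-++-disjoint : ∀ {A : Set} (xs : List A) {ys z} → Unique (xs ++ ys) → z ∈ xs → z ∉ ys
unique-++-disjoint (x ∷ xs) (x∉ ∷ u) (here refl) z∈ys = All.lookup x∉ (∈-++⁺ʳ xs z∈ys) refl
unique-++-disjoint (x ∷ xs) (x∉ ∷ u) (there z∈)  z∈ys = unique-++-disjoint xs u z∈ z∈ys

unique-map⁻ : ∀ {A B : Set} (f : A → B) {xs} → Unique (map f xs) → Unique xs
unique-map⁻ f {[]}     u        = []
unique-map⁻ f {x ∷ xs} (x∉ ∷ u) =
  All.tabulate (λ { y∈ refl → All.lookup x∉ (∈-map⁺ f y∈) refl }) ∷ unique-map⁻ f u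

unique-map-injective : ∀ {A B : Set} (f : A → B) {xs x y} → Unique (map f xs) → x ∈ xs → y ∈ xs → f x ≡ f y → x ≡ y
unique-map-injective f u (here refl) (here refl) eq = refl
unique-map-injective f (x∉ ∷ u) (here refl) (there y∈) eq = contradiction eq (All.lookup x∉ (∈-map⁺ f y∈))
unique-map-injective f (x∉ ∷ u) (there x∈) (here refl) eq = contradiction (sym eq) (All.lookup x∉ (∈-map⁺ f x∈))
unique-map-injective f (_ ∷ u) (there x∈) (there y∈) eq = unique-map-injective f u x∈ y∈ eq

-- The partition into clusters, and feasibility

module Clustering (R : Reals) (I : GGMST.Instance R) where

  open GGMST R
  open Instance I
  open TimedValues

  clusterCell : Cluster → Cell
  clusterCell C = cell (List⁺.head C)

  clusterPoints : List Cluster → List Point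
  clusterPoints = concatMap toList

  Homogeneous : Cluster → Set
  Homogeneous C = ∀ {p} → p ∈ toList C → cell p ≡ clusterCell C

  insertᵗ-points : ∀ p Cs → clusterPoints (toList (value (insertᵗ I p Cs))) ↭ p ∷ clusterPoints Cs
  insertᵗ-points p []       = refl
  insertᵗ-points p (C ∷ Cs) with does (cell p ≟ᶜ clusterCell C)
  ... | true  = refl
  ... | false = trans (++⁺ˡ (toList C) (insertᵗ-points p Cs)) (shift p (toList C) (clusterPoints Cs))

  insertᵗ-homogeneous : ∀ p {Cs} → All Homogeneous Cs → All Homogeneous (toList (value (insertᵗ I p Cs)))
  insertᵗ-homogeneous p []               = (λ { (here refl) → refl }) ∷ []
  insertᵗ-homogeneous p {C ∷ Cs} (h ∷ hs) with cell p ≟ᶜ clusterCell C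
  ... | yes eq = (λ { (here refl) → refl ; (there q∈) → ≡.trans (h q∈) (sym eq) }) ∷ hs
  ... | no _   = h ∷ insertᵗ-homogeneous p hs

  insertᵗ-cells : ∀ p Cs → map clusterCell (toList (value (insertᵗ I p Cs))) ⊆ cell p ∷ map clusterCell Cs
  insertᵗ-cells p []       c∈ = c∈
  insertᵗ-cells p (C ∷ Cs) c∈ with cell p ≟ᶜ clusterCell C
  insertᵗ-cells p (C ∷ Cs) (here eq)  | yes _ = here eq
  insertᵗ-cells p (C ∷ Cs) (there c∈) | yes _ = there (there c∈)
  insertᵗ-cells p (C ∷ Cs) (here eq)  | no _  = there (here eq)
  insertᵗ-cells p (C ∷ Cs) (there c∈) | no _  with insertᵗ-cells p Cs c∈
  ... | here eq   = here eq
  ... | there c∈′ = there (there c∈′)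

  insertᵗ-cells-unique : ∀ p {Cs} → Unique (map clusterCell Cs) →
                         Unique (map clusterCell (toList (value (insertᵗ I p Cs))))
  insertᵗ-cells-unique p {[]}     u = [] ∷ []
  insertᵗ-cells-unique p {C ∷ Cs} (C∉ ∷ u) with cell p ≟ᶜ clusterCell C
  ... | yes eq = All.map (λ ≢ → ≢ ∘ ≡.trans (sym eq)) C∉ ∷ u
  ... | no neq = All.tabulate fresh ∷ insertᵗ-cells-unique p u
    where
    fresh : ∀ {c} → c ∈ map clusterCell (toList (value (insertᵗ I p Cs))) → clusterCell C ≢ c
    fresh c∈ with insertᵗ-cells p Cs c∈
    ... | here refl = neq ∘ sym
    ... | there c∈′ = All.lookup C∉ c∈′

  clustersFromᵗ-points : ∀ p ps → clusterPoints (toList (value (clustersFromᵗ I p ps))) ↭ p ∷ ps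
  clustersFromᵗ-points p []       = refl
  clustersFromᵗ-points p (q ∷ qs) =
    trans (insertᵗ-points p (toList (value (clustersFromᵗ I q qs)))) (prep p (clustersFromᵗ-points q qs))

  clustersFromᵗ-homogeneous : ∀ p ps → All Homogeneous (toList (value (clustersFromᵗ I p ps)))
  clustersFromᵗ-homogeneous p []       = insertᵗ-homogeneous p []
  clustersFromᵗ-homogeneous p (q ∷ qs) = insertᵗ-homogeneous p (clustersFromᵗ-homogeneous q qs)

  clustersFromᵗ-cells-unique : ∀ p ps → Unique (map clusterCell (toList (value (clustersFromᵗ I p ps))))
  clustersFromᵗ-cells-unique p []       = insertᵗ-cells-unique p []
  clustersFromᵗ-cells-unique p (q ∷ qs) = insertᵗ-cells-unique p (clustersFromᵗ-cells-unique q qs)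

  clusters : List Cluster
  clusters = toList (value (clustersᵗ I))

  C₀ : Cluster
  C₀ = List⁺.head (value (clustersᵗ I))

  Cs₀ : List Cluster
  Cs₀ = List⁺.tail (value (clustersᵗ I))

  C₀∈ : C₀ ∈ clusters
  C₀∈ = here refl

  clusters-points : clusterPoints clusters ↭ toList points
  clusters-points = clustersFromᵗ-points (List⁺.head points) (List⁺.tail points)

  clusters-homogeneous : ∀ {C p} → C ∈ clusters → p ∈ toList C → cell p ≡ clusterCell C
  clusters-homogeneous C∈ = All.lookup (clustersFromᵗ-homogeneous (List⁺.head points) (List⁺.tail points)) C∈

  clusters-cells-unique : Unique (map clusterCell clusters)
  clusters-cells-unique = clustersFromᵗ-cells-unique (List⁺.head points) (List⁺.tail points)

  cluster-point : ∀ {C p} → C ∈ clusters → p ∈ toList C → p ∈ toList points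
  cluster-point {C} C∈ p∈ = ∈-resp-↭ clusters-points (∈-concatMap⁺ toList (Any.map (λ { refl → p∈ }) C∈))

  point-cluster : ∀ {p} → p ∈ toList points → ∃ λ C → C ∈ clusters × p ∈ toList C
  point-cluster p∈ = find (∈-concatMap⁻ toList (∈-resp-↭ (↭-sym clusters-points) p∈))

  same-cluster : ∀ {C D} → C ∈ clusters → D ∈ clusters → clusterCell C ≡ clusterCell D → C ≡ D
  same-cluster = unique-map-injective clusterCell clusters-cells-unique

  in-cluster : ∀ {C p} → C ∈ clusters → p ∈ toList points → cell p ≡ clusterCell C → p ∈ toList C
  in-cluster {C} C∈ p∈ eq with point-cluster p∈
  ... | D , D∈ , p∈D with same-cluster C∈ D∈ (≡.trans (sym eq) (clusters-homogeneous D∈ p∈D))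
  ...   | refl = p∈D

  cluster-unique : ∀ {C} → C ∈ clusters → Unique (toList C)
  cluster-unique = go clusters (unique-resp-↭ (↭-sym clusters-points) distinct)
    where
    go : ∀ Cs {C} → Unique (clusterPoints Cs) → C ∈ Cs → Unique (toList C)
    go (C ∷ Cs) u (here refl) = unique-++ˡ (toList C) u
    go (C ∷ Cs) u (there C∈)  = go Cs (unique-++ʳ (toList C) u) C∈

  point-in-cell : ∀ {p} → p ∈ toList points → p ∈ᶜ cell p
  point-in-cell = All.lookup cell-contains

  open EdgeLists {Point}
  open ForestGrowth _≟ₚ_
  open Exchange _≟ₚ_
  open SpanningGrowth _≟ₚ_
  open PlaneGeometry R using (⊑-weight)

  -- Freshness of the heads excludes loops and repeated edges: a later edge points to a vertex that
  -- no earlier edge contains.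
  grow-tree : ∀ {r es vs} → Grow (r ∷ []) es → Unique vs →
              (∀ {v} → v ∈ vs → v ∈ r ∷ heads es) → (∀ {v} → v ∈ r ∷ heads es → v ∈ vs) →
              IsTree (graph vs es)
  grow-tree {r} {es} {vs} grow unique vs⊆ ⊆vs = record
    { simple = record
      { vertices-distinct = unique
      ; edges-endpoints   = All.tabulate λ e∈ → ⊆vs (tail∈ (grow-tails grow e∈)) , ⊆vs (there (grow-heads grow e∈))
      ; no-loops          = loops grow
      ; edges-distinct    = distinct-edges grow }
    ; nonempty  = r , ⊆vs (here refl)
    ; connected = λ u∈ v∈ → Star.reverse Sum.swap (from-root (vs⊆ u∈)) ◅◅ from-root (vs⊆ v∈)
    ; acyclic   = λ v vs cycle → grow-acyclic grow v vs (IsCycle.closed-walk cycle)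
                                   (IsCycle.no-repeats cycle) (IsCycle.long cycle) }
    where
    tail∈ : ∀ {u} → u ∈ r ∷ [] ⊎ u ∈ heads es → u ∈ r ∷ heads es
    tail∈ (inj₁ (here refl)) = here refl
    tail∈ (inj₂ p)           = there p
    from-root : ∀ {v} → v ∈ r ∷ heads es → Star (Adj es) r v
    from-root (here refl) = Star.ε
    from-root (there v∈)  = grow-connected grow id (λ { (here refl) → Star.ε }) v∈
    loops : ∀ {S es} → Grow S es → All (λ (u , v) → u ≢ v) es
    loops []                = []
    loops (step u∈ v∉ grow) = (λ { refl → v∉ u∈ }) ∷ loops grow
    distinct-edges : ∀ {S es} → Grow S es → AllPairs (λ e e′ → ¬ SameEdge e e′) es
    distinct-edges []                = []
    distinct-edges (step u∈ v∉ grow) = All.tabulate (λ where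
        e∈ (inj₁ (refl , refl)) → grow-fresh grow (grow-heads grow e∈) (here refl)
        e∈ (inj₂ (refl , refl)) → grow-fresh grow (grow-heads grow e∈) (there u∈))
      ∷ distinct-edges grow

  -- Feasibility of both branches is derived from this criterion. `meets` gives the point in each
  -- cell and `injective` its uniqueness.
  grow-feasible : ∀ {r es vs} → Grow (r ∷ []) es → Unique vs →
                  (∀ {v} → v ∈ vs → v ∈ r ∷ heads es) → (∀ {v} → v ∈ r ∷ heads es → v ∈ vs) →
                  (∀ {v} → v ∈ vs → v ∈ toList points) →
                  (∀ {u v} → u ∈ vs → v ∈ vs → cell u ≡ cell v → u ≡ v) →
                  (∀ {C} → C ∈ clusters → ∃ λ v → v ∈ vs × v ∈ toList C) →
                  IsFeasible I (graph vs es)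
  grow-feasible {vs = vs} grow unique vs⊆ ⊆vs from injective meets = record
    { isTree       = grow-tree grow unique vs⊆ ⊆vs
    ; from-points  = All.tabulate from
    ; one-per-cell = one }
    where
    one : ∀ c → NonEmpty c → _
    one c (p , p∈ , refl) with point-cluster p∈
    ... | C , C∈ , p∈C with meets C∈
    ...   | v , v∈ , v∈C = v , (v∈ , eq) , λ { (w∈ , eq′) → injective v∈ w∈ (≡.trans eq (sym eq′)) }
      where eq = ≡.trans (clusters-homogeneous C∈ v∈C) (sym (clusters-homogeneous C∈ p∈C))

  module Feasible {G : Graph} (feasible : IsFeasible I G) where

    open IsFeasible feasible public
    open IsTree isTree public
    open IsSimpleGraph simple public

    representative : ∀ {C} → C ∈ clusters → ∃ λ v → v ∈ vertices G × v ∈ toList C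
    representative {C@(p ∷ _)} C∈ with one-per-cell (clusterCell C) (p , cluster-point C∈ (here refl) , refl)
    ... | v , (v∈ , eq) , _ = v , v∈ , in-cluster C∈ (All.lookup from-points v∈) eq

    cell-injective : ∀ {u v} → u ∈ vertices G → v ∈ vertices G → cell u ≡ cell v → u ≡ v
    cell-injective {u} {v} u∈ v∈ eq with one-per-cell (cell v) (v , All.lookup from-points v∈ , refl)
    ... | w , _ , unique = ≡.trans (sym (unique (u∈ , eq))) (unique (v∈ , refl))

    reach : ∀ {r v} → r ∈ vertices G → v ∈ vertices G → Reach (r ∷ []) (edges G) v
    reach r∈ v∈ = star-reach (connected v∈ r∈) (here (here refl))

    -- Supplies the growth order of a competing solution, which drives both the comparison with the
    -- enumeration and the lattice bound.
    growth : ∀ {r} → r ∈ vertices G → ∃ λ es → Grow (r ∷ []) es ×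
             (∀ {v} → v ∈ vertices G → v ∈ r ∷ [] ⊎ v ∈ heads es) ×
             All (λ (u , v) → u ∈ vertices G × v ∈ vertices G) es × edgesWeight es ≤ weight G
    growth r∈ with spanning-growth (length (edges G)) (vertices G) ℕ.≤-refl (reach r∈)
    ... | es , grow , covers , sub = es , grow , covers , ⊑-ends sub edges-endpoints , ⊑-weight sub

-- Minimisers and closest pairs

module TimedChoices (R : Reals) where

  open GGMST R
  open PlaneGeometry R
  open TimedValues

  private
    variable
      A B : Set

  argminFromᵗ-∈ : (f : A → Timed ℝ) (x : A) (xs : List A) → value (argminFromᵗ f x xs) ∈ x ∷ xs
  argminFromᵗ-∈ f x []       = here refl
  argminFromᵗ-∈ f x (y ∷ ys) with does (value (f x) ≤? value (f (value (argminFromᵗ f y ys))))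
  ... | true  = here refl
  ... | false = there (argminFromᵗ-∈ f y ys)

  argminFromᵗ-min : (f : A → Timed ℝ) (x : A) (xs : List A) {y : A} → y ∈ x ∷ xs →
                    value (f (value (argminFromᵗ f x xs))) ≤ value (f y)
  argminFromᵗ-min f x []       (here refl) = ≤-refl
  argminFromᵗ-min f x (y ∷ ys) z∈ with value (f x) ≤? value (f (value (argminFromᵗ f y ys)))
  argminFromᵗ-min f x (y ∷ ys) (here refl) | yes _  = ≤-refl
  argminFromᵗ-min f x (y ∷ ys) (there z∈)  | yes le = ≤-trans le (argminFromᵗ-min f y ys z∈)
  argminFromᵗ-min f x (y ∷ ys) (here refl) | no ¬le = ≰⇒≥ ¬le
  argminFromᵗ-min f x (y ∷ ys) (there z∈)  | no ¬le = argminFromᵗ-min f y ys z∈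

  argminᵗ-∈ : (f : A → Timed ℝ) (xs : List⁺ A) → value (argminᵗ f xs) ∈ toList xs
  argminᵗ-∈ f (x ∷ xs) = argminFromᵗ-∈ f x xs

  argminᵗ-min : (f : A → Timed ℝ) (xs : List⁺ A) {y : A} → y ∈ toList xs →
                value (f (value (argminᵗ f xs))) ≤ value (f y)
  argminᵗ-min f (x ∷ xs) = argminFromᵗ-min f x xs

  ∈-pairsᵗ⁺ : {xs : List⁺ A} {ys : List⁺ B} {x : A} {y : B} → x ∈ toList xs → y ∈ toList ys →
              (x , y) ∈ toList (value (pairsᵗ xs ys))
  ∈-pairsᵗ⁺ {ys = ys} {x} x∈ y∈ =
    ∈-concatMap⁺ᵗ⁺ (λ x → map⁺ᵗ (λ y → pure (x , y)) ys) x∈ (∈-map⁺ᵗ⁺ (λ y → pure (x , y)) {ys} y∈)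

  ∈-pairsᵗ⁻ : (xs : List⁺ A) (ys : List⁺ B) {x : A} {y : B} → (x , y) ∈ toList (value (pairsᵗ xs ys)) →
              x ∈ toList xs × y ∈ toList ys
  ∈-pairsᵗ⁻ xs ys xy∈ with ∈-concatMap⁺ᵗ⁻ (λ x → map⁺ᵗ (λ y → pure (x , y)) ys) xs xy∈
  ... | x , x∈ , xy∈′ with ∈-map⁺ᵗ⁻ (λ y → pure (x , y)) ys xy∈′
  ...   | y , y∈ , refl = x∈ , y∈

  closestPairᵗ-∈ : ∀ C D → let u , v = value (closestPairᵗ C D) in u ∈ toList C × v ∈ toList D
  closestPairᵗ-∈ C D = ∈-pairsᵗ⁻ C D (argminᵗ-∈ edgeWeightᵗ (value (pairsᵗ C D)))

  closestPairᵗ-min : ∀ {C D u v} → u ∈ toList C → v ∈ toList D → value (cellDistanceᵗ C D) ≤ dist u v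
  closestPairᵗ-min {C} {D} u∈ v∈ = argminᵗ-min edgeWeightᵗ (value (pairsᵗ C D)) (∈-pairsᵗ⁺ u∈ v∈)

-- Correctness of the dynamic program and of the enumeration of trees

module Selections (R : Reals) where

  open GGMST R
  open PlaneGeometry R
  open Solver
  open TimedValues
  open TimedChoices R
  open EdgeLists {Point}
  open Entry

  mutual
    clustersOf : CellTree → List Cluster
    clustersOf (node C ts) = clustersBelow C ts

    clustersBelow : Cluster → List CellTree → List Cluster
    clustersBelow C []       = C ∷ []
    clustersBelow C (t ∷ ts) = clustersOf t ++ clustersBelow C ts

  -- Vertices and edges of a selection are listed below in the order in which
  -- the dynamic program assembles them.
  mutual
    data Selection : CellTree → Set where
      node : ∀ {C ts} p → p ∈ toList C → Selections ts → Selection (node C ts)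

    data Selections : List CellTree → Set where
      []  : Selections []
      _∷_ : ∀ {t ts} → Selection t → Selections ts → Selections (t ∷ ts)

  root : ∀ {t} → Selection t → Point
  root (node p _ _) = p

  mutual
    chosen : ∀ {t} → Selection t → List Point
    chosen (node p _ ss) = chosenBelow p ss

    chosenBelow : ∀ {ts} → Point → Selections ts → List Point
    chosenBelow p []       = p ∷ []
    chosenBelow p (s ∷ ss) = chosen s ++ chosenBelow p ss

  mutual
    links : ∀ {t} → Selection t → List Edge
    links (node p _ ss) = linksBelow p ss

    linksBelow : ∀ {ts} → Point → Selections ts → List Edge
    linksBelow p []       = []
    linksBelow p (s ∷ ss) = (p , root s) ∷ links s ++ linksBelow p ss

  _∈ᵖ_ : Point → Cluster → Set
  p ∈ᵖ C = p ∈ toList C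

  mutual
    chosen-clusters : ∀ {t} (s : Selection t) → Pointwise _∈ᵖ_ (chosen s) (clustersOf t)
    chosen-clusters (node p p∈ ss) = chosenBelow-clusters p∈ ss

    chosenBelow-clusters : ∀ {C ts p} → p ∈ toList C → (ss : Selections ts) →
                           Pointwise _∈ᵖ_ (chosenBelow p ss) (clustersBelow C ts)
    chosenBelow-clusters p∈ []       = p∈ ∷ []
    chosenBelow-clusters p∈ (s ∷ ss) = Pointwise.++⁺ (chosen-clusters s) (chosenBelow-clusters p∈ ss)

  mutual
    -- Every chosen point except the root is the head of exactly one link, the one from its parent.
    chosen-↭ : ∀ {t} (s : Selection t) → chosen s ↭ root s ∷ heads (links s)
    chosen-↭ (node p _ ss) = chosenBelow-↭ p ss

    chosenBelow-↭ : ∀ {ts} p (ss : Selections ts) → chosenBelow p ss ↭ p ∷ heads (linksBelow p ss)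
    chosenBelow-↭ p []       = refl
    chosenBelow-↭ p (s ∷ ss) = begin
      chosen s ++ chosenBelow p ss
        ↭⟨ ++⁺ (chosen-↭ s) (chosenBelow-↭ p ss) ⟩
      (root s ∷ heads (links s)) ++ p ∷ heads (linksBelow p ss)
        ↭⟨ shift p (root s ∷ heads (links s)) _ ⟩
      p ∷ root s ∷ heads (links s) ++ heads (linksBelow p ss)
        ≡⟨ cong (λ hs → p ∷ root s ∷ hs) (map-++ proj₂ (links s) (linksBelow p ss)) ⟨
      p ∷ heads (linksBelow p (s ∷ ss)) ∎
      where open ↭.PermutationReasoning

  root∈chosen : ∀ {t} (s : Selection t) → root s ∈ chosen s
  root∈chosen s = ∈-resp-↭ (↭-sym (chosen-↭ s)) (here refl)

  heads∈chosen : ∀ {t v} (s : Selection t) → v ∈ heads (links s) → v ∈ chosen s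
  heads∈chosen s v∈ = ∈-resp-↭ (↭-sym (chosen-↭ s)) (there v∈)

  mutual
    -- Preorder is a growth order: a subtree is entered through its root, and since all chosen
    -- points differ, siblings cannot spoil the freshness of each other's heads.
    links-grow : ∀ {t} (s : Selection t) → Unique (chosen s) → Grow (root s ∷ []) (links s)
    links-grow (node p _ ss) u = linksBelow-grow p ss u

    linksBelow-grow : ∀ {ts} p (ss : Selections ts) → Unique (chosenBelow p ss) →
                      Grow (p ∷ []) (linksBelow p ss)
    linksBelow-grow p []       u = []
    linksBelow-grow p (s ∷ ss) u = step (here refl) (λ { (here eq) → disjoint (root∈chosen s) (subst (_∈ chosenBelow p ss) (sym eq) p∈) })
      (grow-++ (grow-mono (λ { (here refl) → here refl }) fresh₁ g₁)
               (grow-mono (λ { (here refl) → there (here refl) }) fresh₂ g₂)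
               (λ v∈ v∈′ → disjoint (heads∈chosen s v∈) (heads∈below v∈′)))
      where
      g₁ = links-grow s (unique-++ˡ (chosen s) u)
      g₂ = linksBelow-grow p ss (unique-++ʳ (chosen s) u)
      disjoint : ∀ {v} → v ∈ chosen s → v ∉ chosenBelow p ss
      disjoint = unique-++-disjoint (chosen s) u
      p∈ : p ∈ chosenBelow p ss
      p∈ = ∈-resp-↭ (↭-sym (chosenBelow-↭ p ss)) (here refl)
      heads∈below : ∀ {v} → v ∈ heads (linksBelow p ss) → v ∈ chosenBelow p ss
      heads∈below v∈ = ∈-resp-↭ (↭-sym (chosenBelow-↭ p ss)) (there v∈)
      fresh₁ : ∀ {v} → v ∈ heads (links s) → v ∉ root s ∷ p ∷ []
      fresh₁ v∈ (here refl)         = grow-fresh g₁ v∈ (here refl)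
      fresh₁ v∈ (there (here refl)) = disjoint (heads∈chosen s v∈) p∈
      fresh₂ : ∀ {v} → v ∈ heads (linksBelow p ss) → v ∉ root s ∷ p ∷ []
      fresh₂ v∈ (here refl)         = disjoint (root∈chosen s) (heads∈below v∈)
      fresh₂ v∈ (there (here refl)) = grow-fresh g₂ v∈ (here refl)

  -- Reproduces the objective `via` that is local to `entryᵗ`, so that its minimiser can be spoken
  -- of.
  viaᵗ : Point → Entry → Timed ℝ
  viaᵗ p q = distᵗ p (point q) >>= λ d → W q +ᵗ d

  mutual
    tableᵗ-sound : ∀ t {e} → e ∈ toList (value (tableᵗ t)) → ∃ λ (s : Selection t) →
                   point e ≡ root s × solution e ≡ graph (chosen s) (links s) × W e ≡ edgesWeight (links s)
    tableᵗ-sound (node C ts) e∈ with ∈-map⁺ᵗ⁻ (λ p → entryᵗ p (value (tablesᵗ ts))) C e∈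
    ... | p , p∈ , refl with entryᵗ-sound p ts
    ...   | ss , eqs = node p p∈ ss , eqs

    entryᵗ-sound : ∀ p ts → ∃ λ (ss : Selections ts) → let e = value (entryᵗ p (value (tablesᵗ ts))) in
                   point e ≡ p × solution e ≡ graph (chosenBelow p ss) (linksBelow p ss) ×
                   W e ≡ edgesWeight (linksBelow p ss)
    entryᵗ-sound p []       = [] , refl , refl , refl
    entryᵗ-sound p (t ∷ ts) with entryᵗ-sound p ts | tableᵗ-sound t (argminᵗ-∈ (viaᵗ p) (value (tableᵗ t)))
    ... | ss , _ , sol , w | s , pt , sol′ , w′ = s ∷ ss , refl ,
      cong₂ graph (≡.trans (appendᵗ-value (vertices (solution q)) _) (cong₂ _++_ (cong vertices sol′) (cong vertices sol)))
                  (cong₂ _∷_ (cong (p ,_) pt)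
                    (≡.trans (appendᵗ-value (edges (solution q)) _) (cong₂ _++_ (cong edges sol′) (cong edges sol)))) ,
      ≡.trans (cong₂ _+_ (cong₂ _+_ w′ (cong (dist p) pt)) w)
        (≡.trans (solve 3 (λ a d b → a :+ d :+ b := d :+ (a :+ b)) refl _ _ _)
          (cong (λ z → dist p (root s) + z) (sym (edgesWeight-++ (links s) (linksBelow p ss)))))
      where q = value (argminᵗ (viaᵗ p) (value (tableᵗ t)))

  mutual
    -- The entry has to match the root point of the selection, because the link to the parent is
    -- weighed from there. With `tableᵗ-sound` this makes the dynamic program optimal for the given
    -- tree.
    tableᵗ-min : ∀ {t} (s : Selection t) → ∃ λ e → e ∈ toList (value (tableᵗ t)) ×
                 point e ≡ root s × W e ≤ edgesWeight (links s)
    tableᵗ-min (node {C} {ts} p p∈ ss) = _ , ∈-map⁺ᵗ⁺ (λ p → entryᵗ p (value (tablesᵗ ts))) {C} p∈ ,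
      proj₁ (proj₂ (entryᵗ-sound p ts)) , entryᵗ-min p ss

    entryᵗ-min : ∀ {ts} p (ss : Selections ts) → W (value (entryᵗ p (value (tablesᵗ ts)))) ≤ edgesWeight (linksBelow p ss)
    entryᵗ-min p []       = ≤-refl
    entryᵗ-min {t ∷ ts} p (s ∷ ss) with tableᵗ-min s
    ... | q , q∈ , refl , Wq≤ = ≤-trans
      (+-mono-≤ (≤-trans (argminᵗ-min (viaᵗ p) (value (tableᵗ t)) q∈) (+-monoˡ-≤ (dist p (point q)) Wq≤))
                (entryᵗ-min p ss))
      (≤-reflexive (≡.trans (solve 3 (λ a d b → a :+ d :+ b := d :+ (a :+ b)) refl _ _ _)
        (cong (λ z → dist p (root s) + z) (sym (edgesWeight-++ (links s) (linksBelow p ss))))))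

  mutual
    attachᵗ-sound : ∀ D t {t′} → t′ ∈ toList (value (attachᵗ D t)) → clustersOf t′ ↭ D ∷ clustersOf t
    attachᵗ-sound D (node C ts) (here refl) = refl
    attachᵗ-sound D (node C ts) (there t∈) with ∈-mapᵗ⁻ (λ ts′ → pure (node C ts′)) (value (attachBelowᵗ D ts)) t∈
    ... | ts′ , ts∈ , refl = attachBelowᵗ-sound D C ts ts∈

    attachBelowᵗ-sound : ∀ D C ts {ts′} → ts′ ∈ value (attachBelowᵗ D ts) →
                         clustersBelow C ts′ ↭ D ∷ clustersBelow C ts
    attachBelowᵗ-sound D C (t ∷ ts) ts∈
      with ∈-appendᵗ⁻ (value (mapᵗ (λ t′ → pure (t′ ∷ ts)) (toList (value (attachᵗ D t))))) _ ts∈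
    ... | inj₁ ts∈₁ with ∈-mapᵗ⁻ (λ t′ → pure (t′ ∷ ts)) (toList (value (attachᵗ D t))) ts∈₁
    ...   | t′ , t∈ , refl = ++⁺ʳ (clustersBelow C ts) (attachᵗ-sound D t t∈)
    attachBelowᵗ-sound D C (t ∷ ts) ts∈ | inj₂ ts∈₂ with ∈-mapᵗ⁻ (λ ts′ → pure (t ∷ ts′)) (value (attachBelowᵗ D ts)) ts∈₂
    ...   | ts′ , ts∈′ , refl =
      trans (++⁺ˡ (clustersOf t) (attachBelowᵗ-sound D C ts ts∈′)) (shift D (clustersOf t) (clustersBelow C ts))

  mutual
    -- Any chosen point can become the parent of the new leaf. The new link lands somewhere inside
    -- the list, hence the permutations.
    attachᵗ-complete : ∀ {D t a b} (s : Selection t) → a ∈ chosen s → b ∈ toList D →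
      ∃ λ t′ → ∃ λ (s′ : Selection t′) → t′ ∈ toList (value (attachᵗ D t)) ×
        root s′ ≡ root s × chosen s′ ↭ b ∷ chosen s × links s′ ↭ (a , b) ∷ links s
    attachᵗ-complete {D} {node C ts} {a} {b} (node p p∈ ss) a∈ b∈ with attachBelowᵗ-complete p ss a∈ b∈
    ... | inj₁ refl = _ , node p p∈ (node b b∈ [] ∷ ss) , here refl , refl , refl , refl
    ... | inj₂ (ts′ , ss′ , ts∈ , vs↭ , es↭) =
      node C ts′ , node p p∈ ss′ , there (∈-mapᵗ⁺ (λ ts′ → pure (node C ts′)) ts∈) , refl , vs↭ , es↭

    -- The case `a ≡ p` is handed back to the caller, since `attachBelowᵗ` never adds a child to the
    -- root itself.
    attachBelowᵗ-complete : ∀ {D ts a b} p (ss : Selections ts) → a ∈ chosenBelow p ss → b ∈ toList D →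
      a ≡ p ⊎ ∃ λ ts′ → ∃ λ (ss′ : Selections ts′) → ts′ ∈ value (attachBelowᵗ D ts) ×
        chosenBelow p ss′ ↭ b ∷ chosenBelow p ss × linksBelow p ss′ ↭ (a , b) ∷ linksBelow p ss
    attachBelowᵗ-complete p [] (here refl) b∈ = inj₁ refl
    attachBelowᵗ-complete {D} {t ∷ ts} {a} {b} p (s ∷ ss) a∈ b∈ with ∈-++⁻ (chosen s) a∈
    ... | inj₁ a∈₁ with attachᵗ-complete s a∈₁ b∈
    ...   | t′ , s′ , t∈ , root≡ , vs↭ , es↭ = inj₂ (t′ ∷ ts , s′ ∷ ss ,
      ∈-appendᵗ⁺ˡ (∈-mapᵗ⁺ (λ t′ → pure (t′ ∷ ts)) t∈) ,
      ++⁺ʳ (chosenBelow p ss) vs↭ ,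
      trans (↭-reflexive (cong (λ r → (p , r) ∷ links s′ ++ linksBelow p ss) root≡))
        (trans (prep (p , root s) (++⁺ʳ (linksBelow p ss) es↭)) (swap _ _ refl)))
    attachBelowᵗ-complete {D} {t ∷ ts} {a} {b} p (s ∷ ss) a∈ b∈ | inj₂ a∈₂ with attachBelowᵗ-complete p ss a∈₂ b∈
    ... | inj₁ a≡p = inj₁ a≡p
    ... | inj₂ (ts′ , ss′ , ts∈ , vs↭ , es↭) = inj₂ (t ∷ ts′ , s ∷ ss′ ,
      ∈-appendᵗ⁺ʳ (value (mapᵗ (λ t′ → pure (t′ ∷ ts)) (toList (value (attachᵗ D t)))))
        (∈-mapᵗ⁺ (λ ts′ → pure (t ∷ ts′)) ts∈) ,
      trans (++⁺ˡ (chosen s) vs↭) (shift b (chosen s) (chosenBelow p ss)) ,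
      trans (prep (p , root s) (trans (++⁺ˡ (links s) es↭) (shift (a , b) (links s) (linksBelow p ss)))) (swap _ _ refl))

  spanningTreesᵗ-sound : ∀ {n} t (todo : Vec Cluster n) {t′} → t′ ∈ toList (value (spanningTreesᵗ t todo)) →
                         clustersOf t′ ↭ Vec.toList todo ++ clustersOf t
  spanningTreesᵗ-sound {zero}  t []   (here refl) = refl
  spanningTreesᵗ-sound {suc n} t todo {t′} t∈
    with ∈-concatMap⁺ᵗ⁻ (λ (D , rest) → attachᵗ D t >>= λ us → concatMap⁺ᵗ (λ u → spanningTreesᵗ {n} u rest) us)
           (value (selectᵗ todo)) t∈
  ... | (D , rest) , sel∈ , t∈′ with ∈-concatMap⁺ᵗ⁻ (λ u → spanningTreesᵗ {n} u rest) (value (attachᵗ D t)) t∈′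
  ...   | u , u∈ , t∈″ = begin
    clustersOf t′                              ↭⟨ spanningTreesᵗ-sound u rest t∈″ ⟩
    Vec.toList rest ++ clustersOf u            ↭⟨ ++⁺ˡ (Vec.toList rest) (attachᵗ-sound D t u∈) ⟩
    Vec.toList rest ++ D ∷ clustersOf t        ↭⟨ shift D (Vec.toList rest) (clustersOf t) ⟩
    (D ∷ Vec.toList rest) ++ clustersOf t      ↭⟨ ++⁺ʳ (clustersOf t) (↭-sym (selectᵗ-sound todo sel∈)) ⟩
    Vec.toList todo ++ clustersOf t            ∎
    where open ↭.PermutationReasoning

  -- The points lie in the given clusters, one in each, in the order in which
  -- the clusters are selected.
  data Transversal : ∀ {n} → Vec Cluster n → List Point → Set where
    []   : Transversal [] []
    pick : ∀ {n} {todo : Vec Cluster (suc n)} {D rest h hs} → (D , rest) ∈ toList (value (selectᵗ todo)) →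
           h ∈ toList D → Transversal rest hs → Transversal todo (h ∷ hs)

  -- The enumeration can imitate a growth sequence: each edge attaches the cluster of its head as a
  -- leaf below the cluster of its tail.
  spanningTreesᵗ-complete : ∀ {n S es t} (todo : Vec Cluster n) (s : Selection t) →
    Grow S es → (∀ {v} → v ∈ S → v ∈ chosen s) → Transversal todo (heads es) →
    ∃ λ t′ → ∃ λ (s′ : Selection t′) → t′ ∈ toList (value (spanningTreesᵗ t todo)) ×
      edgesWeight (links s′) ≡ edgesWeight (links s) + edgesWeight es
  spanningTreesᵗ-complete {t = t} [] s [] S⊆ [] = t , s , here refl , sym (+-identityʳ _)
  spanningTreesᵗ-complete {suc n} {S} {t = t} todo s (step {u} {v} {es} u∈ v∉ grow) S⊆ (pick {D = D} {rest} sel∈ h∈ tr)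
    with attachᵗ-complete s (S⊆ u∈) h∈
  ... | t₁ , s₁ , t₁∈ , _ , vs↭ , es↭ with spanningTreesᵗ-complete rest s₁ grow S⊆′ tr
    where
    S⊆′ : ∀ {w} → w ∈ v ∷ S → w ∈ chosen s₁
    S⊆′ (here refl) = ∈-resp-↭ (↭-sym vs↭) (here refl)
    S⊆′ (there w∈)  = ∈-resp-↭ (↭-sym vs↭) (there (S⊆ w∈))
  ...   | t₂ , s₂ , t₂∈ , w≡ = t₂ , s₂ ,
    ∈-concatMap⁺ᵗ⁺ (λ (D , rest) → attachᵗ D t >>= λ us → concatMap⁺ᵗ (λ u → spanningTreesᵗ {n} u rest) us)
      sel∈ (∈-concatMap⁺ᵗ⁺ (λ u → spanningTreesᵗ {n} u rest) t₁∈ t₂∈) ,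
    ≡.trans w≡ (≡.trans (cong (_+ edgesWeight es) (edgesWeight-↭ es↭))
      (solve 3 (λ d a b → d :+ a :+ b := a :+ (d :+ b)) refl (dist u v) (edgesWeight (links s)) (edgesWeight es)))

pointwise-∈ˡ : ∀ {A B : Set} {R : A → B → Set} {xs ys x} → Pointwise R xs ys → x ∈ xs → ∃ λ y → y ∈ ys × R x y
pointwise-∈ˡ (r ∷ rs) (here refl) = _ , here refl , r
pointwise-∈ˡ (r ∷ rs) (there x∈) with pointwise-∈ˡ rs x∈
... | y , y∈ , r′ = y , there y∈ , r′

pointwise-∈ʳ : ∀ {A B : Set} {R : A → B → Set} {xs ys y} → Pointwise R xs ys → y ∈ ys → ∃ λ x → x ∈ xs × R x y
pointwise-∈ʳ (r ∷ rs) (here refl) = _ , here refl , r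
pointwise-∈ʳ (r ∷ rs) (there y∈) with pointwise-∈ʳ rs y∈
... | x , x∈ , r′ = x , there x∈ , r′

unique-map⁺ : ∀ {A B : Set} (f : A → B) {xs} → (∀ {x y} → x ∈ xs → y ∈ xs → f x ≡ f y → x ≡ y) →
              Unique xs → Unique (map f xs)
unique-map⁺ f inj []       = []
unique-map⁺ f {x ∷ xs} inj (x∉ ∷ u) =
  All.tabulate fresh ∷ unique-map⁺ f (λ x∈ y∈ → inj (there x∈) (there y∈)) u
  where
  fresh : ∀ {z} → z ∈ map f xs → f x ≢ z
  fresh z∈ fx≡z with ∈-map⁻ f z∈
  ... | y , y∈ , refl = All.lookup x∉ y∈ (inj (here refl) (there y∈) fx≡z)

-- Optimality of the exhaustive branch

module Exhaustive (R : Reals) (I : GGMST.Instance R) where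

  open GGMST R
  open Instance I
  open TimedValues
  open TimedChoices R
  open PlaneGeometry R
  open Selections R
  open Clustering R I
  open EdgeLists {Point}
  open Entry

  -- The last two hypotheses match points with clusters in both directions. Taking out the cluster
  -- of the first point preserves them because points and clusters have pairwise distinct cells.
  transversal : ∀ {n} (todo : Vec Cluster n) hs → (∀ {D} → D ∈ Vec.toList todo → D ∈ clusters) →
    Unique (map clusterCell (Vec.toList todo)) → Unique (map cell hs) →
    (∀ {h} → h ∈ hs → ∃ λ D → D ∈ Vec.toList todo × h ∈ toList D) →
    (∀ {D} → D ∈ Vec.toList todo → ∃ λ h → h ∈ hs × h ∈ toList D) → Transversal todo hs
  transversal []         []       sub u u′ cover meet = []
  transversal (D ∷ todo) []       sub u u′ cover meet with meet (here refl)
  ... | _ , () , _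
  transversal []         (h ∷ hs) sub u u′ cover meet with cover (here refl)
  ... | _ , () , _
  transversal todo@(_ ∷ _) (h ∷ hs) sub u (h∉ ∷ u′) cover meet with cover (here refl)
  ... | D , D∈ , h∈D with selectᵗ-complete todo D∈
  ...   | rest , sel∈ = pick sel∈ h∈D
      (transversal rest hs (sub ∘ ∈-resp-↭ (↭-sym todo↭) ∘ there) (AllPairs.tail u-rest) u′ cover′ meet′)
    where
    todo↭ : Vec.toList todo ↭ D ∷ Vec.toList rest
    todo↭ = selectᵗ-sound todo sel∈
    u-rest : Unique (map clusterCell (D ∷ Vec.toList rest))
    u-rest = unique-resp-↭ (map⁺ clusterCell todo↭) u
    cover′ : ∀ {k} → k ∈ hs → ∃ λ E → E ∈ Vec.toList rest × k ∈ toList E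
    cover′ {k} k∈ with cover (there k∈)
    ... | E , E∈ , k∈E with ∈-resp-↭ todo↭ E∈
    ...   | there E∈′ = E , E∈′ , k∈E
    ...   | here refl = contradiction
      (≡.trans (clusters-homogeneous (sub D∈) h∈D) (sym (clusters-homogeneous (sub D∈) k∈E)))
      (All.lookup h∉ (∈-map⁺ cell k∈))
    meet′ : ∀ {E} → E ∈ Vec.toList rest → ∃ λ k → k ∈ hs × k ∈ toList E
    meet′ {E} E∈ with meet (∈-resp-↭ (↭-sym todo↭) (there E∈))
    ... | k , there k∈ , k∈E = k , k∈ , k∈E
    ... | k , here refl , h∈E = contradiction
      (≡.trans (sym (clusters-homogeneous (sub D∈) h∈D))
        (clusters-homogeneous (sub (∈-resp-↭ (↭-sym todo↭) (there E∈))) h∈E))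
      (All.lookup (AllPairs.head u-rest) (∈-map⁺ clusterCell E∈))

  selection-feasible : ∀ {t} (s : Selection t) → clustersOf t ↭ clusters →
                       IsFeasible I (graph (chosen s) (links s))
  selection-feasible {t} s t↭ = grow-feasible (links-grow s unique) unique
    (∈-resp-↭ (chosen-↭ s)) (∈-resp-↭ (↭-sym (chosen-↭ s))) from (unique-map-injective cell unique-cells) meets
    where
    same-cells : ∀ {vs Cs} → (∀ {C} → C ∈ Cs → C ∈ clusters) → Pointwise _∈ᵖ_ vs Cs → map cell vs ≡ map clusterCell Cs
    same-cells sub []       = refl
    same-cells sub (v∈ ∷ p) = cong₂ _∷_ (clusters-homogeneous (sub (here refl)) v∈) (same-cells (sub ∘ there) p)
    unique-cells : Unique (map cell (chosen s))
    unique-cells = subst Unique (sym (same-cells (∈-resp-↭ t↭) (chosen-clusters s)))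
      (unique-resp-↭ (map⁺ clusterCell (↭-sym t↭)) clusters-cells-unique)
    unique : Unique (chosen s)
    unique = unique-map⁻ cell unique-cells
    from : ∀ {v} → v ∈ chosen s → v ∈ toList points
    from v∈ with pointwise-∈ˡ (chosen-clusters s) v∈
    ... | C , C∈ , v∈C = cluster-point (∈-resp-↭ t↭ C∈) v∈C
    meets : ∀ {C} → C ∈ clusters → ∃ λ v → v ∈ chosen s × v ∈ toList C
    meets C∈ = pointwise-∈ʳ (chosen-clusters s) (∈-resp-↭ (↭-sym t↭) C∈)

  private
    todo = value (toVecᵗ Cs₀)
    trees = value (spanningTreesᵗ (node C₀ []) todo)
    entries = value (map⁺ᵗ bestForᵗ trees)

  exhaustiveᵗ-sound : ∃ λ t → ∃ λ (s : Selection t) → clustersOf t ↭ clusters ×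
    value (exhaustiveᵗ C₀ Cs₀) ≡ graph (chosen s) (links s) ×
    W (value (argminᵗ (pure ∘ W) entries)) ≡ edgesWeight (links s)
  exhaustiveᵗ-sound with ∈-map⁺ᵗ⁻ bestForᵗ trees (argminᵗ-∈ (pure ∘ W) entries)
  ... | t , t∈ , best≡ with tableᵗ-sound t (argminᵗ-∈ (pure ∘ W) (value (tableᵗ t)))
  ...   | s , _ , sol , w = t , s , t↭ , ≡.trans (cong solution best≡) sol , ≡.trans (cong W best≡) w
    where
    t↭ : clustersOf t ↭ clusters
    t↭ = trans (spanningTreesᵗ-sound (node C₀ []) todo t∈)
      (trans (shift C₀ (Vec.toList todo) []) (↭-reflexive (cong (C₀ ∷_)
        (≡.trans (++-identityʳ _) (toVecᵗ-value Cs₀)))))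

  exhaustiveᵗ-feasible : IsFeasible I (value (exhaustiveᵗ C₀ Cs₀))
  exhaustiveᵗ-feasible with exhaustiveᵗ-sound
  ... | t , s , t↭ , G≡ , _ = subst (IsFeasible I) (sym G≡) (selection-feasible s t↭)

  exhaustiveᵗ-≤-selection : ∀ {t} → t ∈ toList trees → (s : Selection t) →
                            weight (value (exhaustiveᵗ C₀ Cs₀)) ≤ edgesWeight (links s)
  exhaustiveᵗ-≤-selection {t} t∈ s = begin
    weight (value (exhaustiveᵗ C₀ Cs₀))     ≡⟨ cong weight (proj₁ (proj₂ (proj₂ (proj₂ exhaustiveᵗ-sound)))) ⟩
    edgesWeight (links best)                ≡⟨ proj₂ (proj₂ (proj₂ (proj₂ exhaustiveᵗ-sound))) ⟨
    W (value (argminᵗ (pure ∘ W) entries))  ≤⟨ argminᵗ-min (pure ∘ W) entries (∈-map⁺ᵗ⁺ bestForᵗ {trees} t∈) ⟩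
    W (value (bestForᵗ t))                  ≤⟨ argminᵗ-min (pure ∘ W) (value (tableᵗ t)) (proj₁ (proj₂ attained)) ⟩
    W (proj₁ attained)                      ≤⟨ proj₂ (proj₂ (proj₂ attained)) ⟩
    edgesWeight (links s)                   ∎
    where
    open ≤-Reasoning
    best     = proj₁ (proj₂ exhaustiveᵗ-sound)
    attained = tableᵗ-min s

  module _ {G r es} (feasible : IsFeasible I G) (r∈ : r ∈ vertices G) (r∈C : r ∈ toList C₀)
    (grow : Grow (r ∷ []) es) (covers : ∀ {v} → v ∈ vertices G → v ∈ r ∷ [] ⊎ v ∈ heads es)
    (ends : All (λ (u , v) → u ∈ vertices G × v ∈ vertices G) es) where

    open Feasible feasible using (cell-injective; representative; from-points)

    heads⊆ : ∀ {h} → h ∈ heads es → h ∈ vertices G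
    heads⊆ h∈ with ∈-map⁻ proj₂ h∈
    ... | e , e∈ , refl = proj₂ (All.lookup ends e∈)

    heads-avoid-C₀ : ∀ {h} → h ∈ heads es → h ∉ toList C₀
    heads-avoid-C₀ h∈ h∈C = grow-fresh grow h∈ (here (cell-injective (heads⊆ h∈) r∈
      (≡.trans (clusters-homogeneous C₀∈ h∈C) (sym (clusters-homogeneous C₀∈ r∈C)))))

    head-cluster : ∀ {h} → h ∈ heads es → ∃ λ D → D ∈ Cs₀ × h ∈ toList D
    head-cluster {h} h∈ with point-cluster (All.lookup from-points (heads⊆ h∈))
    ... | D , there D∈ , h∈D = D , D∈ , h∈D
    ... | D , here refl , h∈D = contradiction h∈D (heads-avoid-C₀ h∈)

    cluster-head : ∀ {D} → D ∈ Cs₀ → ∃ λ h → h ∈ heads es × h ∈ toList D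
    cluster-head {D} D∈ = let h , h∈ , h∈D = representative (there D∈) in h , in-heads h∈D (covers h∈) , h∈D
      where
      in-heads : ∀ {h} → h ∈ toList D → h ∈ r ∷ [] ⊎ h ∈ heads es → h ∈ heads es
      in-heads h∈D (inj₂ h∈)         = h∈
      in-heads h∈D (inj₁ (here refl)) = contradiction
        (≡.trans (sym (clusters-homogeneous C₀∈ r∈C)) (clusters-homogeneous (there D∈) h∈D))
        (All.lookup (AllPairs.head clusters-cells-unique) (∈-map⁺ clusterCell D∈))

    heads-transversal : Transversal todo (heads es)
    heads-transversal = transversal todo (heads es) (there ∘ Cs⊆)
      (subst (Unique ∘ map clusterCell) (sym (toVecᵗ-value Cs₀)) (AllPairs.tail clusters-cells-unique))
      (unique-map⁺ cell (λ h∈ k∈ → cell-injective (heads⊆ h∈) (heads⊆ k∈)) (heads-unique grow))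
      (λ h∈ → let D , D∈ , h∈D = head-cluster h∈ in D , subst (D ∈_) (sym (toVecᵗ-value Cs₀)) D∈ , h∈D)
      (λ D∈ → cluster-head (Cs⊆ D∈))
      where
      Cs⊆ : ∀ {D} → D ∈ Vec.toList todo → D ∈ Cs₀
      Cs⊆ {D} = subst (D ∈_) (toVecᵗ-value Cs₀)

    -- The growth is rooted in `C₀`, where the enumeration starts, and each of its heads names the
    -- cluster to attach next.
    exhaustiveᵗ-≤-growth : weight (value (exhaustiveᵗ C₀ Cs₀)) ≤ edgesWeight es
    exhaustiveᵗ-≤-growth = let t , s , t∈ , w≡ = spanned in
      ≤-trans (exhaustiveᵗ-≤-selection t∈ s) (≤-reflexive (≡.trans w≡ (+-identityˡ _)))
      where
      spanned = spanningTreesᵗ-complete todo (node {C₀} r r∈C []) grow (λ { (here refl) → here refl }) heads-transversal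

  exhaustiveᵗ-minimum : ∀ {G} → IsFeasible I G → weight (value (exhaustiveᵗ C₀ Cs₀)) ≤ weight G
  exhaustiveᵗ-minimum feasible =
    let r , r∈ , r∈C = Feasible.representative feasible C₀∈
        es , grow , covers , ends , es≤ = Feasible.growth feasible r∈
    in ≤-trans (exhaustiveᵗ-≤-growth feasible r∈ r∈C grow covers ends) es≤

-- Prim's algorithm on clusters

module PrimTree (R : Reals) (I : GGMST.Instance R) where

  open GGMST R
  open Instance I
  open TimedValues
  open TimedChoices R
  open PlaneGeometry R
  open Solver
  open Clustering R I

  closest : Cluster × Cluster → Edge
  closest (C , D) = value (closestPairᵗ C D)

  cellEdge : Cluster × Cluster → Cell × Cell
  cellEdge (C , D) = clusterCell C , clusterCell D

  module _ {n} (reached : List⁺ Cluster) (todo : Vec Cluster (suc n)) where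

    private
      distanceᵗ : Cluster × Cluster × Vec Cluster n → Timed ℝ
      distanceᵗ (C , (D , _)) = cellDistanceᵗ C D
      pairs = value (pairsᵗ reached (value (selectᵗ todo)))

    nearest : Cluster × Cluster × Vec Cluster n
    nearest = value (argminᵗ distanceᵗ pairs)

    nearest-∈ : let C , D , rest = nearest in C ∈ toList reached × Vec.toList todo ↭ D ∷ Vec.toList rest
    nearest-∈ = let C∈ , sel∈ = ∈-pairsᵗ⁻ reached (value (selectᵗ todo)) (argminᵗ-∈ distanceᵗ pairs)
                in C∈ , selectᵗ-sound todo sel∈

    nearest-min : ∀ {C D u v} → C ∈ toList reached → D ∈ Vec.toList todo → u ∈ toList C → v ∈ toList D →
                  let C′ , D′ , _ = nearest in value (cellDistanceᵗ C′ D′) ≤ dist u v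
    nearest-min C∈ D∈ u∈ v∈ = ≤-trans
      (argminᵗ-min distanceᵗ pairs (∈-pairsᵗ⁺ C∈ (proj₂ (selectᵗ-complete todo D∈))))
      (closestPairᵗ-min u∈ v∈)

  private
    module Cells = EdgeLists {Cell}
    module Points = EdgeLists {Point}

  -- Closest pairs may use different points of the same cluster, so at this stage the tree structure
  -- exists on cells only. It returns to points after merging, through `grow-pullback`.
  record PrimSpec {n} (reached : List⁺ Cluster) (todo : Vec Cluster n) (T : List (Cluster × Cluster)) : Set where
    field
      grows    : Cells.Grow (map clusterCell (toList reached)) (map cellEdge T)
      covers   : ∀ {D} → D ∈ Vec.toList todo → clusterCell D ∈ Cells.heads (map cellEdge T)
      clusters-∈ : All (λ (C , D) → C ∈ clusters × D ∈ clusters) T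
      size-T   : length T ≡ n

  primᵗ-spec : ∀ {n} reached (todo : Vec Cluster n) →
    (∀ {C} → C ∈ toList reached → C ∈ clusters) → (∀ {C} → C ∈ Vec.toList todo → C ∈ clusters) →
    Unique (map clusterCell (Vec.toList todo)) →
    (∀ {C D} → C ∈ toList reached → D ∈ Vec.toList todo → clusterCell C ≢ clusterCell D) →
    PrimSpec reached todo (value (primᵗ reached todo))
  primᵗ-spec {zero} reached [] reached⊆ todo⊆ u disjoint =
    record { grows = Cells.[] ; covers = λ () ; clusters-∈ = [] ; size-T = refl }
  primᵗ-spec {suc n} reached todo reached⊆ todo⊆ u disjoint = record
    { grows      = Cells.step (∈-map⁺ clusterCell C∈) D∉ IH.grows
    ; covers     = λ E∈ → covers (∈-resp-↭ todo↭ E∈)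
    ; clusters-∈ = (reached⊆ C∈ , todo⊆ D∈) ∷ IH.clusters-∈
    ; size-T     = cong suc IH.size-T }
    where
    C = proj₁ (nearest reached todo)
    D = proj₁ (proj₂ (nearest reached todo))
    rest = proj₂ (proj₂ (nearest reached todo))
    C∈ = proj₁ (nearest-∈ reached todo)
    todo↭ = proj₂ (nearest-∈ reached todo)
    D∈ : D ∈ Vec.toList todo
    D∈ = ∈-resp-↭ (↭-sym todo↭) (here refl)
    D∉ : clusterCell D ∉ map clusterCell (toList reached)
    D∉ cD∈ = let E , E∈ , eq = ∈-map⁻ clusterCell cD∈ in disjoint E∈ D∈ (sym eq)
    u′ : Unique (map clusterCell (D ∷ Vec.toList rest))
    u′ = unique-resp-↭ (map⁺ clusterCell todo↭) u
    disjoint′ : ∀ {E F} → E ∈ D ∷ toList reached → F ∈ Vec.toList rest → clusterCell E ≢ clusterCell F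
    disjoint′ (here refl) F∈ eq = All.lookup (AllPairs.head u′) (∈-map⁺ clusterCell F∈) eq
    disjoint′ (there E∈)  F∈ eq = disjoint E∈ (∈-resp-↭ (↭-sym todo↭) (there F∈)) eq
    reached⊆′ : ∀ {E} → E ∈ D ∷ toList reached → E ∈ clusters
    reached⊆′ (here refl) = todo⊆ D∈
    reached⊆′ (there E∈)  = reached⊆ E∈
    module IH = PrimSpec (primᵗ-spec {n} (D ∷⁺ reached) rest reached⊆′
      (λ F∈ → todo⊆ (∈-resp-↭ (↭-sym todo↭) (there F∈))) (AllPairs.tail u′) disjoint′)
    covers : ∀ {E} → E ∈ D ∷ Vec.toList rest →
             clusterCell E ∈ clusterCell D ∷ Cells.heads (map cellEdge (value (primᵗ {n} (D ∷⁺ reached) rest)))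
    covers (here refl) = here refl
    covers (there E∈)  = there (IH.covers E∈)

  open Exchange _≟ₚ_

  module _ {Vs : List Point} (cell-injective : ∀ {u v} → u ∈ Vs → v ∈ Vs → cell u ≡ cell v → u ≡ v) where

    -- F keeps connecting the remaining clusters to the reached ones after the
    -- edge that leaves the reached part is traded for the one that is chosen.
    primᵗ-weight : ∀ {n} reached (todo : Vec Cluster n) S F →
      (∀ {C} → C ∈ Vec.toList todo → C ∈ clusters) →
      Unique (map clusterCell (Vec.toList todo)) →
      All (λ (u , v) → u ∈ Vs × v ∈ Vs) F →
      (∀ {s} → s ∈ S → ∃ λ C → C ∈ toList reached × s ∈ toList C) →
      (∀ {v} → v ∈ Vs → v ∉ S → ∃ λ D → D ∈ Vec.toList todo × v ∈ toList D) →
      (∀ {D} → D ∈ Vec.toList todo → ∃ λ z → z ∈ toList D × z ∈ Vs × z ∉ S × Reach S F z) →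
      edgesWeight (map closest (value (primᵗ reached todo))) ≤ edgesWeight F
    primᵗ-weight {zero} reached [] S F todo⊆ u F⊆ S⊆ Vs⊆ reach = edgesWeight-nonNegative F
    primᵗ-weight {suc n} reached todo S F todo⊆ u F⊆ S⊆ Vs⊆ reach =
      ≤-trans (+-mono-≤ chosen≤ (primᵗ-weight {n} (D ∷⁺ reached) rest (z ∷ S) X.rest todo⊆′ (AllPairs.tail u′)
                (All.tail F⊆′) S⊆′ Vs⊆′ reach′))
              (≤-reflexive (sym (edgesWeight-↭ X.removed)))
      where
      C = proj₁ (nearest reached todo)
      D = proj₁ (proj₂ (nearest reached todo))
      rest = proj₂ (proj₂ (nearest reached todo))
      todo↭ = proj₂ (nearest-∈ reached todo)
      D∈ : D ∈ Vec.toList todo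
      D∈ = ∈-resp-↭ (↭-sym todo↭) (here refl)
      u′ : Unique (map clusterCell (D ∷ Vec.toList rest))
      u′ = unique-resp-↭ (map⁺ clusterCell todo↭) u
      -- From now on the competitor's vertex `z` stands for the cluster `D`, even though Prim's edge
      -- may end at another point of it.
      z    = proj₁ (reach D∈)
      z∈D  = proj₁ (proj₂ (reach D∈))
      z∈Vs = proj₁ (proj₂ (proj₂ (reach D∈)))
      module X = Crossing (crossing (proj₁ (proj₂ (proj₂ (proj₂ (reach D∈))))) (proj₂ (proj₂ (proj₂ (proj₂ (reach D∈))))))
      F⊆′ : All (λ (u , v) → u ∈ Vs × v ∈ Vs) (X.e ∷ X.rest)
      F⊆′ = All-resp-↭ X.removed F⊆
      outer∈Vs : ∀ {e} → e ≡ (X.outer , X.inner) ⊎ e ≡ (X.inner , X.outer) → proj₁ e ∈ Vs × proj₂ e ∈ Vs → X.outer ∈ Vs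
      outer∈Vs (inj₁ refl) (o∈ , _) = o∈
      outer∈Vs (inj₂ refl) (_ , o∈) = o∈
      crossing-weight : ∀ {e} → e ≡ (X.outer , X.inner) ⊎ e ≡ (X.inner , X.outer) → dist X.inner X.outer ≡ dist (proj₁ e) (proj₂ e)
      crossing-weight (inj₁ refl) = dist-sym X.inner X.outer
      crossing-weight (inj₂ refl) = refl
      -- The traded edge of F also joins a reached cluster to an unreached one, so the minimum was
      -- taken over a pair at most as far apart as its ends.
      chosen≤ : value (cellDistanceᵗ C D) ≤ dist (proj₁ X.e) (proj₂ X.e)
      chosen≤ = let C′ , C′∈ , i∈ = S⊆ X.inner∈
                    D′ , D′∈ , o∈ = Vs⊆ (outer∈Vs X.joins (All.head F⊆′)) X.outer∉
                in ≤-trans (nearest-min reached todo C′∈ D′∈ i∈ o∈) (≤-reflexive (crossing-weight X.joins))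
      todo⊆′ : ∀ {E} → E ∈ Vec.toList rest → E ∈ clusters
      todo⊆′ E∈ = todo⊆ (∈-resp-↭ (↭-sym todo↭) (there E∈))
      S⊆′ : ∀ {s} → s ∈ z ∷ S → ∃ λ E → E ∈ D ∷ toList reached × s ∈ toList E
      S⊆′ (here refl) = D , here refl , z∈D
      S⊆′ (there s∈)  = let E , E∈ , s∈E = S⊆ s∈ in E , there E∈ , s∈E
      Vs⊆′ : ∀ {v} → v ∈ Vs → v ∉ z ∷ S → ∃ λ E → E ∈ Vec.toList rest × v ∈ toList E
      Vs⊆′ {v} v∈ v∉ = let E , E∈ , v∈E = Vs⊆ v∈ (v∉ ∘ there) in other v∈E (∈-resp-↭ todo↭ E∈)
        where
        other : ∀ {E} → v ∈ toList E → E ∈ D ∷ Vec.toList rest → ∃ λ E → E ∈ Vec.toList rest × v ∈ toList E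
        other v∈E (there E∈)  = _ , E∈ , v∈E
        other v∈D (here refl) = contradiction (here (cell-injective v∈ z∈Vs
          (≡.trans (clusters-homogeneous (todo⊆ D∈) v∈D) (sym (clusters-homogeneous (todo⊆ D∈) z∈D))))) v∉
      reach′ : ∀ {E} → E ∈ Vec.toList rest → ∃ λ y → y ∈ toList E × y ∈ Vs × y ∉ z ∷ S × Reach (z ∷ S) X.rest y
      reach′ {E} E∈ = let y , y∈E , y∈Vs , y∉ , r = reach (∈-resp-↭ (↭-sym todo↭) (there E∈))
                      in y , y∈E , y∈Vs , fresh y∈E y∉ , X.relink r
        where
        fresh : ∀ {y} → y ∈ toList E → y ∉ S → y ∉ z ∷ S
        fresh y∈E y∉ (there y∈S)  = y∉ y∈S
        fresh y∈E y∉ (here refl)  = All.lookup (AllPairs.head u′) (∈-map⁺ clusterCell E∈)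
          (≡.trans (sym (clusters-homogeneous (todo⊆ D∈) z∈D)) (clusters-homogeneous (todo⊆′ E∈) y∈E))

-- Counting the ends of edges cell by cell

unique-⊆-↭ : ∀ {A : Set} {xs ys : List A} → Unique xs → xs ⊆ ys → ∃ λ zs → ys ↭ xs ++ zs
unique-⊆-↭ [] sub = _ , refl
unique-⊆-↭ {A} {x ∷ xs} (x∉ ∷ u) sub with ∈-∃++ (sub (here refl))
... | as , bs , refl = let zs , p = unique-⊆-↭ u sub′ in zs , trans (shift x as bs) (prep x p)
  where
  sub′ : xs ⊆ as ++ bs
  sub′ z∈ with ∈-resp-↭ (shift x as bs) (sub (there z∈))
  ... | here refl = contradiction refl (All.lookup x∉ z∈)
  ... | there z∈′ = z∈′

module Counting {A : Set} (_≟_ : DecidableEquality A) where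

  count : A → List A → ℕ
  count c xs = length (filter (_≟ c) xs)

  counts : List A → List A → ℕ
  counts []       xs = 0
  counts (c ∷ cs) xs = count c xs ℕ.+ counts cs xs

  counts-skip : ∀ {x} cs xs → x ∉ cs → counts cs (x ∷ xs) ≡ counts cs xs
  counts-skip []       xs x∉ = refl
  counts-skip {x} (c ∷ cs) xs x∉ with x ≟ c
  ... | yes refl = contradiction (here refl) x∉
  ... | no _     = cong (count c xs ℕ.+_) (counts-skip cs xs (x∉ ∘ there))

  -- As `cs` has no repetitions, one more entry can be counted for at most one of its members.
  counts-∷ : ∀ {x cs} xs → Unique cs → counts cs (x ∷ xs) ℕ.≤ suc (counts cs xs)
  counts-∷ {x} {[]}     xs u = z≤n
  counts-∷ {x} {c ∷ cs} xs (c∉ ∷ u) with x ≟ c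
  ... | yes refl = s≤s (ℕ.≤-reflexive (cong (count c xs ℕ.+_) (counts-skip cs xs (λ x∈ → All.lookup c∉ x∈ refl))))
  ... | no _     = ℕ.≤-trans (ℕ.+-monoʳ-≤ (count c xs) (counts-∷ xs u)) (ℕ.≤-reflexive (ℕ.+-suc _ _))

  counts-≤ : ∀ {cs} xs → Unique cs → counts cs xs ℕ.≤ length xs
  counts-≤ {cs} []       u = ℕ.≤-reflexive (none cs)
    where
    none : ∀ cs → counts cs [] ≡ 0
    none []       = refl
    none (c ∷ cs) = none cs
  counts-≤ (x ∷ xs) u = ℕ.≤-trans (counts-∷ xs u) (s≤s (counts-≤ xs u))

  count-positive : ∀ {c xs} → c ∈ xs → 1 ℕ.≤ count c xs
  count-positive {c} {x ∷ xs} c∈ with x ≟ c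
  ... | yes _ = s≤s z≤n
  count-positive (here refl) | no neq = contradiction refl neq
  count-positive (there c∈)  | no _   = count-positive c∈

  count-map : ∀ {B : Set} (f : B → A) c xs → count c (map f xs) ≡ length (filter (λ x → f x ≟ c) xs)
  count-map f c []       = refl
  count-map f c (x ∷ xs) with f x ≟ c
  ... | yes _ = cong suc (count-map f c xs)
  ... | no _  = count-map f c xs

-- The cost of uniting the ends in each cell

module Merging (R : Reals) (I : GGMST.Instance R) where

  open GGMST R
  open Instance I
  open TimedValues
  open TimedChoices R
  open PlaneGeometry R
  open Solver
  open Clustering R I
  open Counting _≟ᶜ_

  sumOver : (Point → ℝ) → List Point → ℝ
  sumOver f []       = 0#
  sumOver f (x ∷ xs) = f x + sumOver f xs

  sumOver-++ : ∀ f xs ys → sumOver f (xs ++ ys) ≡ sumOver f xs + sumOver f ys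
  sumOver-++ f []       ys = sym (+-identityˡ _)
  sumOver-++ f (x ∷ xs) ys = ≡.trans (cong (λ z → f x + z) (sumOver-++ f xs ys)) (sym (+-assoc _ _ _))

  sumOver-↭ : ∀ f {xs ys} → xs ↭ ys → sumOver f xs ≡ sumOver f ys
  sumOver-↭ f refl         = refl
  sumOver-↭ f (prep x p)   = cong (λ z → f x + z) (sumOver-↭ f p)
  sumOver-↭ f (swap x y p) = ≡.trans (cong (λ z → f x + (f y + z)) (sumOver-↭ f p))
    (solve 3 (λ a b c → a :+ (b :+ c) := b :+ (a :+ c)) refl _ _ _)
  sumOver-↭ f (trans p q)  = ≡.trans (sumOver-↭ f p) (sumOver-↭ f q)

  sumOver-≤ : ∀ f {b} xs → (∀ {x} → x ∈ xs → f x ≤ b) → sumOver f xs ≤ fromℕ (length xs) * b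
  sumOver-≤ f {b} []       le = ≤-reflexive (sym (zeroˡ b))
  sumOver-≤ f {b} (x ∷ xs) le = ≤-trans (+-mono-≤ (le (here refl)) (sumOver-≤ f xs (le ∘ there)))
    (≤-reflexive (≡.trans (cong (_+ fromℕ (length xs) * b) (sym (*-identityˡ b))) (sym (distribʳ b 1# _))))

  sumᵗ-value : ∀ f xs → value (sumᵗ f xs) ≡ sumOver (value ∘ f) xs
  sumᵗ-value f []       = refl
  sumᵗ-value f (x ∷ xs) = cong (λ z → value (f x) + z) (sumᵗ-value f xs)

  -- A vertex of degree d occurs d times: the multiplicity is what the cost of merging is charged
  -- to.
  endpoints : List Edge → List Point
  endpoints []             = []
  endpoints ((u , v) ∷ es) = u ∷ v ∷ endpoints es

  mapEdges : (Point → Point) → List Edge → List Edge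
  mapEdges f = map (λ (u , v) → f u , f v)

  endpoints-map : ∀ f es → endpoints (mapEdges f es) ≡ map f (endpoints es)
  endpoints-map f []             = refl
  endpoints-map f ((u , v) ∷ es) = cong (λ l → f u ∷ f v ∷ l) (endpoints-map f es)

  endpoints-fst : ∀ {u v es} → (u , v) ∈ es → u ∈ endpoints es
  endpoints-fst (here refl) = here refl
  endpoints-fst (there e∈)  = there (there (endpoints-fst e∈))

  endpoints-snd : ∀ {u v es} → (u , v) ∈ es → v ∈ endpoints es
  endpoints-snd (here refl) = there (here refl)
  endpoints-snd (there e∈)  = there (there (endpoints-snd e∈))

  length-endpoints : ∀ es → length (endpoints es) ≡ 2 ℕ.* length es
  length-endpoints []       = refl
  length-endpoints (e ∷ es) = ≡.trans (cong (2 ℕ.+_) (length-endpoints es)) (sym (ℕ.*-suc 2 (length es)))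

  cellEdges : List Edge → List (Cell × Cell)
  cellEdges = map (λ (u , v) → cell u , cell v)

  samePointᵗ-refl : ∀ p → value (samePointᵗ p p) ≡ true
  samePointᵗ-refl (x , y) with x ≟ x | y ≟ y
  ... | yes _  | yes _  = refl
  ... | no neq | _      = contradiction refl neq
  ... | yes _  | no neq = contradiction refl neq

  samePointᵗ-sound : ∀ p q → value (samePointᵗ p q) ≡ true → p ≡ q
  samePointᵗ-sound (x₁ , y₁) (x₂ , y₂) eq with x₁ ≟ x₂ | y₁ ≟ y₂
  ... | yes refl | yes refl = refl
  samePointᵗ-sound (x₁ , y₁) (x₂ , y₂) () | yes _ | no _
  samePointᵗ-sound (x₁ , y₁) (x₂ , y₂) () | no _  | _

  incidentᵗ-complete : ∀ {p} es → p ∈ endpoints es → value (incidentᵗ es p) ≡ true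
  incidentᵗ-complete {p} (_ ∷ es) (here refl) rewrite samePointᵗ-refl p = refl
  incidentᵗ-complete {p} ((u , _) ∷ es) (there (here refl)) rewrite samePointᵗ-refl p = ∨-zeroʳ (value (samePointᵗ p u))
  incidentᵗ-complete {p} ((u , v) ∷ es) (there (there p∈)) rewrite incidentᵗ-complete es p∈
    | ∨-zeroʳ (value (samePointᵗ p v)) = ∨-zeroʳ (value (samePointᵗ p u))

  incidentᵗ-sound : ∀ {p} es → value (incidentᵗ es p) ≡ true → p ∈ endpoints es
  incidentᵗ-sound {p} ((u , v) ∷ es) eq
    with value (samePointᵗ p u) in eq₁ | value (samePointᵗ p v) in eq₂ | value (incidentᵗ es p) in eq₃
  ... | true  | _     | _     = here (samePointᵗ-sound p u eq₁)
  ... | false | true  | _     = there (here (samePointᵗ-sound p v eq₂))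
  ... | false | false | true  = there (there (incidentᵗ-sound es eq₃))
  incidentᵗ-sound {p} ((u , v) ∷ es) () | false | false | false

  moved : Point → Point → Point
  moved p u = if does (cell u ≟ᶜ cell p) then p else u

  reconnectᵗ-value : ∀ p es → value (reconnectᵗ I p es) ≡ mapEdges (moved p) es
  reconnectᵗ-value p []       = refl
  reconnectᵗ-value p (e ∷ es) = cong (_ ∷_) (reconnectᵗ-value p es)

  cell-moved : ∀ p u → cell (moved p u) ≡ cell u
  cell-moved p u with cell u ≟ᶜ cell p
  ... | yes eq = sym eq
  ... | no _   = refl

  cellEdges-moved : ∀ p es → cellEdges (mapEdges (moved p) es) ≡ cellEdges es
  cellEdges-moved p []             = refl
  cellEdges-moved p ((u , v) ∷ es) = cong₂ _∷_ (cong₂ _,_ (cell-moved p u) (cell-moved p v)) (cellEdges-moved p es)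

  -- By the triangle inequality, applied at both ends of an edge, each end pays for its own
  -- displacement.
  moved-weight : ∀ p es → edgesWeight (mapEdges (moved p) es)
                          ≤ edgesWeight es + sumOver (λ u → dist (moved p u) u) (endpoints es)
  moved-weight p []             = ≤-reflexive (sym (+-identityˡ _))
  moved-weight p ((u , v) ∷ es) = ≤-trans
    (+-mono-≤ (≤-trans (dist-triangle u′ u v′) (+-monoʳ-≤ (dist u′ u)
                (≤-trans (dist-triangle u v v′) (+-monoʳ-≤ (dist u v) (≤-reflexive (dist-sym v v′))))))
              (moved-weight p es))
    (≤-reflexive (solve 5 (λ a b c d e → a :+ (b :+ c) :+ (d :+ e) := b :+ d :+ (a :+ (c :+ e))) refl
      (dist u′ u) (dist u v) (dist v′ v) (edgesWeight es) _))
    where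
    u′ = moved p u
    v′ = moved p v

  inCell : Cell → List Point → List Point
  inCell c = filter (λ u → cell u ≟ᶜ c)

  moved-sum : ∀ p us → sumOver (λ u → dist (moved p u) u) us ≡ sumOver (λ u → dist u p) (inCell (cell p) us)
  moved-sum p []       = refl
  moved-sum p (u ∷ us) with cell u ≟ᶜ cell p
  ... | yes _ = cong₂ _+_ (dist-sym p u) (moved-sum p us)
  ... | no _  = ≡.trans (cong₂ _+_ (dist-refl u) (moved-sum p us)) (+-identityˡ _)

  √2 : ℝ
  √2 = √ (fromℕ 2)

  -- What merging achieves in a cell. It is kept through the merging of other cells, since their
  -- moves do not change the cell of any point.
  Settled : Cell → List Edge → Set
  Settled c es = ∀ {u v} → u ∈ endpoints es → v ∈ endpoints es → cell u ≡ c → cell v ≡ c → u ≡ v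

  moved-settled : ∀ {p c es} → Settled c es → Settled c (mapEdges (moved p) es)
  moved-settled {p} {c} {es} settled u∈ v∈ cu cv
    with ∈-map⁻ (moved p) (subst (_ ∈_) (endpoints-map (moved p) es) u∈)
       | ∈-map⁻ (moved p) (subst (_ ∈_) (endpoints-map (moved p) es) v∈)
  ... | u₀ , u₀∈ , refl | v₀ , v₀∈ , refl = cong (moved p)
    (settled u₀∈ v₀∈ (≡.trans (sym (cell-moved p u₀)) cu) (≡.trans (sym (cell-moved p v₀)) cv))

  moved-settles : ∀ {p es} → Settled (cell p) (mapEdges (moved p) es)
  moved-settles {p} {es} u∈ v∈ cu cv = ≡.trans (is-p u∈ cu) (sym (is-p v∈ cv))
    where
    is-p : ∀ {u} → u ∈ endpoints (mapEdges (moved p) es) → cell u ≡ cell p → u ≡ p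
    is-p {u} u∈ cu with ∈-map⁻ (moved p) (subst (u ∈_) (endpoints-map (moved p) es) u∈)
    ... | u₀ , _ , refl with cell u₀ ≟ᶜ cell p
    ...   | yes _  = refl
    ...   | no neq = contradiction cu neq

  -- `bound` is the total charge of (d - 1)√2 per cell, rearranged to avoid subtraction. Since
  -- `cells` is an invariant, the ends may be counted once and for all in the original `es`.
  record Merged (Cs : List Cluster) (es es′ : List Edge) : Set where
    field
      cells     : cellEdges es′ ≡ cellEdges es
      ends⊆     : All (_∈ toList points) (endpoints es′)
      keeps     : ∀ {c} → Settled c es → Settled c es′
      settles   : ∀ {C} → C ∈ Cs → Settled (clusterCell C) es′
      bound     : edgesWeight es′ + fromℕ (length Cs) * √2
                  ≤ edgesWeight es + fromℕ (counts (map clusterCell Cs) (map cell (endpoints es))) * √2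

  module _ {C es} (C∈ : C ∈ clusters) (ends⊆ : All (_∈ toList points) (endpoints es))
    (occupied : clusterCell C ∈ map cell (endpoints es)) where

    private
      C-G = value (filterᵗ (incidentᵗ es) (toList C))
      n   = count (clusterCell C) (map cell (endpoints es))

    C-G-complete : ∀ {u} → u ∈ endpoints es → cell u ≡ clusterCell C → u ∈ C-G
    C-G-complete u∈ eq = ∈-filterᵗ⁺ (incidentᵗ es) (in-cluster C∈ (All.lookup ends⊆ u∈) eq) (incidentᵗ-complete es u∈)

    C-G-sound : ∀ {u} → u ∈ C-G → u ∈ toList C × u ∈ endpoints es
    C-G-sound u∈ = let u∈C , eq = ∈-filterᵗ⁻ (incidentᵗ es) (toList C) u∈ in u∈C , incidentᵗ-sound es eq

    -- A cell left alone is charged (d - 1)√2 all the same, which is non-negative because the cell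
    -- contains an end.
    single-bound : edgesWeight es + fromℕ 1 * √2 ≤ edgesWeight es + fromℕ (n ℕ.+ 0) * √2
    single-bound = +-monoʳ-≤ (edgesWeight es) (subst₂ _≤_ (*-comm √2 _) (*-comm √2 _)
      (*-monoˡ-≤ √2 0≤√2 (fromℕ-mono-≤ (ℕ.≤-trans (count-positive occupied) (ℕ.≤-reflexive (sym (ℕ.+-identityʳ n)))))))

    unchanged : (∀ {u v} → u ∈ C-G → v ∈ C-G → u ≡ v) → Merged (C ∷ []) es es
    unchanged single = record
      { cells = refl ; ends⊆ = ends⊆ ; keeps = id
      ; settles = λ { (here refl) u∈ v∈ cu cv → single (C-G-complete u∈ cu) (C-G-complete v∈ cv) }
      ; bound = single-bound }

    module _ {q qs} (C-G≡ : C-G ≡ q ∷ qs) where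

      private
        cost : Point → Timed ℝ
        cost p = sumᵗ (λ c → distᵗ c p) (q ∷ qs)
        p = value (argminᵗ cost C)
        ends-C = inCell (clusterCell C) (endpoints es)

      p∈C : p ∈ toList C
      p∈C = argminᵗ-∈ cost C

      cell-p : cell p ≡ clusterCell C
      cell-p = clusters-homogeneous C∈ p∈C

      near : ∀ {u v} → u ∈ toList C → v ∈ toList C → dist u v ≤ √2
      near u∈ v∈ = dist-same-cell {c = clusterCell C} (in-C u∈) (in-C v∈)
        where
        in-C : ∀ {u} → u ∈ toList C → u ∈ᶜ clusterCell C
        in-C {u} u∈ = subst (u ∈ᶜ_) (clusters-homogeneous C∈ u∈) (point-in-cell (cluster-point C∈ u∈))

      in-C-G : ∀ {u} → u ∈ q ∷ qs → u ∈ toList C × u ∈ endpoints es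
      in-C-G {u} u∈ = C-G-sound (subst (u ∈_) (sym C-G≡) u∈)

      -- The minimiser is compared with the point `q` of the graph, which costs nothing for itself
      -- and at most √2 for each of the others.
      best-sum : sumOver (λ u → dist u p) (q ∷ qs) ≤ fromℕ (length qs) * √2
      best-sum = begin
        sumOver (λ u → dist u p) (q ∷ qs)          ≡⟨ sumᵗ-value (λ c → distᵗ c p) (q ∷ qs) ⟨
        value (cost p)                              ≤⟨ argminᵗ-min cost C (proj₁ (in-C-G (here refl))) ⟩
        value (cost q)                              ≡⟨ sumᵗ-value (λ c → distᵗ c q) (q ∷ qs) ⟩
        dist q q + sumOver (λ u → dist u q) qs      ≡⟨ cong (_+ sumOver (λ u → dist u q) qs) (dist-refl q) ⟩
        0# + sumOver (λ u → dist u q) qs            ≡⟨ +-identityˡ _ ⟩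
        sumOver (λ u → dist u q) qs                 ≤⟨ sumOver-≤ (λ u → dist u q) qs
                                                         (λ u∈ → near (proj₁ (in-C-G (there u∈))) (proj₁ (in-C-G (here refl)))) ⟩
        fromℕ (length qs) * √2                      ∎
        where open ≤-Reasoning

      -- The algorithm minimises over distinct points, whereas every end has to be moved. The
      -- repeated ends `zs` are later charged √2 each, so that of all d ends only the one at `q`
      -- comes free.
      others : ∃ λ zs → ends-C ↭ (q ∷ qs) ++ zs
      others = unique-⊆-↭ (subst Unique C-G≡ (filterᵗ-unique (incidentᵗ es) (cluster-unique C∈)))
        (λ u∈ → ∈-filter⁺ (λ u → cell u ≟ᶜ clusterCell C) (proj₂ (in-C-G u∈)) (clusters-homogeneous C∈ (proj₁ (in-C-G u∈))))

      moving-cost : sumOver (λ u → dist u p) ends-C + √2 ≤ fromℕ n * √2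
      moving-cost = begin
        sumOver d ends-C + √2
          ≡⟨ cong (_+ √2) (≡.trans (sumOver-↭ d ends↭) (sumOver-++ d (q ∷ qs) zs)) ⟩
        sumOver d (q ∷ qs) + sumOver d zs + √2
          ≤⟨ +-monoˡ-≤ √2 (+-mono-≤ best-sum (sumOver-≤ d zs (λ u∈ → near (zs⊆C u∈) p∈C))) ⟩
        fromℕ (length qs) * √2 + fromℕ (length zs) * √2 + √2
          ≡⟨ solve 3 (λ a b s → a :* s :+ b :* s :+ s := (con (+ 1) :+ (a :+ b)) :* s) refl _ _ √2 ⟩
        (fromℕ 1 + (fromℕ (length qs) + fromℕ (length zs))) * √2
          ≡⟨ cong (_* √2) (≡.trans (cong (λ z → fromℕ 1 + z) (sym (fromℕ-+ (length qs) (length zs))))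
               (sym (fromℕ-+ 1 (length qs ℕ.+ length zs)))) ⟩
        fromℕ (suc (length qs ℕ.+ length zs)) * √2
          ≡⟨ cong (λ k → fromℕ k * √2) (≡.trans (sym (length-++ (q ∷ qs))) (≡.trans (sym (↭-length ends↭))
               (sym (count-map cell (clusterCell C) (endpoints es))))) ⟩
        fromℕ n * √2 ∎
        where
        open ≤-Reasoning
        d : Point → ℝ
        d u = dist u p
        zs = proj₁ others
        ends↭ = proj₂ others
        zs⊆C : ∀ {u} → u ∈ zs → u ∈ toList C
        zs⊆C u∈ = let u∈ends , eq = ∈-filter⁻ (λ u → cell u ≟ᶜ clusterCell C) {xs = endpoints es}
                                       (∈-resp-↭ (↭-sym ends↭) (∈-++⁺ʳ (q ∷ qs) u∈))
                  in in-cluster C∈ (All.lookup ends⊆ u∈ends) eq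

      reconnected : Merged (C ∷ []) es (value (reconnectᵗ I p es))
      reconnected = subst (Merged (C ∷ []) es) (sym (reconnectᵗ-value p es)) (record
        { cells   = cellEdges-moved p es
        ; ends⊆   = subst (All (_∈ toList points)) (sym (endpoints-map (moved p) es)) (moved⊆ ends⊆)
        ; keeps   = moved-settled
        ; settles = λ { (here refl) → subst (λ c → Settled c (mapEdges (moved p) es)) cell-p moved-settles }
        ; bound   = begin
            edgesWeight (mapEdges (moved p) es) + fromℕ 1 * √2
              ≤⟨ +-monoˡ-≤ _ (moved-weight p es) ⟩
            edgesWeight es + sumOver (λ u → dist (moved p u) u) (endpoints es) + fromℕ 1 * √2
              ≡⟨ cong (λ s → edgesWeight es + s + fromℕ 1 * √2) (≡.trans (moved-sum p (endpoints es))
                   (cong (λ c → sumOver (λ u → dist u p) (inCell c (endpoints es))) cell-p)) ⟩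
            edgesWeight es + sumOver (λ u → dist u p) ends-C + fromℕ 1 * √2
              ≡⟨ solve 3 (λ a b s → a :+ b :+ con (+ 1) :* s := a :+ (b :+ s)) refl _ _ √2 ⟩
            edgesWeight es + (sumOver (λ u → dist u p) ends-C + √2)
              ≤⟨ +-monoʳ-≤ (edgesWeight es) moving-cost ⟩
            edgesWeight es + fromℕ n * √2
              ≡⟨ cong (λ k → edgesWeight es + fromℕ k * √2) (ℕ.+-identityʳ n) ⟨
            edgesWeight es + fromℕ (n ℕ.+ 0) * √2 ∎ })
        where
        open ≤-Reasoning
        moved⊆ : ∀ {us} → All (_∈ toList points) us → All (_∈ toList points) (map (moved p) us)
        moved⊆ []        = []
        moved⊆ {u ∷ _} (u∈ ∷ us⊆) with cell u ≟ᶜ cell p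
        ... | yes _ = cluster-point C∈ p∈C ∷ moved⊆ us⊆
        ... | no _  = u∈ ∷ moved⊆ us⊆

    mergeᵗ-merged : Merged (C ∷ []) es (value (mergeᵗ I C C-G es))
    mergeᵗ-merged = by-size C-G refl
      where
      by-size : ∀ us → C-G ≡ us → Merged (C ∷ []) es (value (mergeᵗ I C us es))
      by-size []           eq = unchanged λ u∈ → contradiction (subst (_ ∈_) eq u∈) λ ()
      by-size (x ∷ [])     eq = unchanged λ u∈ v∈ → ≡.trans (only (subst (_ ∈_) eq u∈)) (sym (only (subst (_ ∈_) eq v∈)))
        where
        only : ∀ {u} → u ∈ x ∷ [] → u ≡ x
        only (here eq) = eq
      by-size (q ∷ r ∷ qs) eq = reconnected eq

  cells-of-endpoints : ∀ {es es′} → cellEdges es ≡ cellEdges es′ → map cell (endpoints es) ≡ map cell (endpoints es′)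
  cells-of-endpoints {es} {es′} eq = ≡.trans (flat es) (≡.trans (cong flatten eq) (sym (flat es′)))
    where
    flatten : List (Cell × Cell) → List Cell
    flatten []             = []
    flatten ((c , d) ∷ es) = c ∷ d ∷ flatten es
    flat : ∀ es → map cell (endpoints es) ≡ flatten (cellEdges es)
    flat []       = refl
    flat (e ∷ es) = cong (λ l → _ ∷ _ ∷ l) (flat es)

  mergeAllᵗ-merged : ∀ Cs {es} → (∀ {C} → C ∈ Cs → C ∈ clusters) → All (_∈ toList points) (endpoints es) →
    (∀ {C} → C ∈ Cs → clusterCell C ∈ map cell (endpoints es)) → Merged Cs es (value (mergeAllᵗ I Cs es))
  mergeAllᵗ-merged [] Cs⊆ ends⊆ occupied = record
    { cells = refl ; ends⊆ = ends⊆ ; keeps = id ; settles = λ () ; bound = ≤-refl }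
  mergeAllᵗ-merged (C ∷ Cs) {es} Cs⊆ ends⊆ occupied = record
    { cells   = ≡.trans Rest.cells First.cells
    ; ends⊆   = Rest.ends⊆
    ; keeps   = λ settled → Rest.keeps (First.keeps settled)
    ; settles = λ { (here refl) → Rest.keeps (First.settles (here refl)) ; (there D∈) → Rest.settles D∈ }
    ; bound   = begin
        edgesWeight es″ + fromℕ (suc (length Cs)) * √2
          ≡⟨ solve 4 (λ w o k s → w :+ (o :+ k) :* s := w :+ k :* s :+ (o :+ con (+ 0)) :* s)
               refl _ 1# (fromℕ (length Cs)) √2 ⟩
        edgesWeight es″ + fromℕ (length Cs) * √2 + fromℕ 1 * √2
          ≤⟨ +-monoˡ-≤ _ Rest.bound ⟩
        edgesWeight es′ + fromℕ (counts cs (map cell (endpoints es′))) * √2 + fromℕ 1 * √2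
          ≡⟨ solve 3 (λ a b c → a :+ b :+ c := a :+ c :+ b) refl _ _ _ ⟩
        edgesWeight es′ + fromℕ 1 * √2 + fromℕ (counts cs (map cell (endpoints es′))) * √2
          ≤⟨ +-mono-≤ First.bound (≤-reflexive (cong (λ l → fromℕ (counts cs l) * √2) (cells-of-endpoints First.cells))) ⟩
        edgesWeight es + fromℕ (n ℕ.+ 0) * √2 + fromℕ (counts cs (map cell (endpoints es))) * √2
          ≡⟨ solve 4 (λ w a b s → w :+ a :* s :+ b :* s := w :+ (a :+ b) :* s) refl _ _ _ √2 ⟩
        edgesWeight es + (fromℕ (n ℕ.+ 0) + fromℕ (counts cs (map cell (endpoints es)))) * √2
          ≡⟨ cong (λ k → edgesWeight es + k * √2) (≡.trans (cong (λ k → fromℕ k + _) (ℕ.+-identityʳ n)) (sym (fromℕ-+ n _))) ⟩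
        edgesWeight es + fromℕ (counts (map clusterCell (C ∷ Cs)) (map cell (endpoints es))) * √2 ∎ }
    where
    open ≤-Reasoning
    cs = map clusterCell Cs
    n = count (clusterCell C) (map cell (endpoints es))
    C-G = value (filterᵗ (incidentᵗ es) (toList C))
    es′ = value (mergeᵗ I C C-G es)
    es″ = value (mergeAllᵗ I Cs es′)
    module First = Merged (mergeᵗ-merged (Cs⊆ (here refl)) ends⊆ (occupied (here refl)))
    module Rest = Merged (mergeAllᵗ-merged Cs {es′} (Cs⊆ ∘ there) First.ends⊆
      (λ D∈ → subst (_ ∈_) (sym (cells-of-endpoints First.cells)) (occupied (there D∈))))

-- Freshness of a head lifts along any map. Presence of a tail does not: the image only shows that
-- something above it is present, and the two hypotheses identify that member of S, or that head,
-- with the tail.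
grow-pullback : ∀ {V W : Set} (f : V → W) {S es} →
  EdgeLists.Grow (map f S) (map (λ (u , v) → f u , f v) es) →
  (∀ {u v} → u ∈ S → (∃ λ w → (v , w) ∈ es) → f u ≡ f v → u ≡ v) →
  (∀ {u v w} → (w , u) ∈ es → (∃ λ x → (v , x) ∈ es) → f u ≡ f v → u ≡ v) → EdgeLists.Grow S es
grow-pullback f {es = []} g inj inj′ = EdgeLists.[]
grow-pullback {V} f {S} {(u , v) ∷ es} (EdgeLists.step u∈ v∉ g) inj inj′ =
  EdgeLists.step u∈′ (v∉ ∘ ∈-map⁺ f) (grow-pullback f g inj₁′ (λ e∈ (x , e∈′) → inj′ (there e∈) (x , there e∈′)))
  where
  u∈′ : u ∈ S
  u∈′ with ∈-map⁻ f u∈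
  ... | s , s∈ , eq = subst (_∈ S) (inj s∈ (v , here refl) (sym eq)) s∈
  inj₁′ : ∀ {x y} → x ∈ v ∷ S → (∃ λ w → (y , w) ∈ es) → f x ≡ f y → x ≡ y
  inj₁′ (here refl) (w , e∈) = inj′ (here refl) (w , there e∈)
  inj₁′ (there x∈)  (w , e∈) = inj x∈ (w , there e∈)

-- Feasibility and weight of the tree obtained by merging

module MstBased (R : Reals) (I : GGMST.Instance R) where

  open GGMST R
  open Instance I
  open TimedValues
  open TimedChoices R
  open PlaneGeometry R
  open Solver
  open Clustering R I
  open PrimTree R I
  open Merging R I
  open Counting _≟ᶜ_
  open Exchange _≟ₚ_ using (Reach)
  private
    module Cells = EdgeLists {Cell}
    module Points = EdgeLists {Point}

  todo : Vec Cluster (length Cs₀)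
  todo = value (toVecᵗ Cs₀)

  todo⊆ : ∀ {D} → D ∈ Vec.toList todo → D ∈ Cs₀
  todo⊆ {D} = subst (D ∈_) (toVecᵗ-value Cs₀)

  ⊆todo : ∀ {D} → D ∈ Cs₀ → D ∈ Vec.toList todo
  ⊆todo {D} = subst (D ∈_) (sym (toVecᵗ-value Cs₀))

  C₀-differs : ∀ {D} → D ∈ Cs₀ → clusterCell C₀ ≢ clusterCell D
  C₀-differs D∈ = All.lookup (AllPairs.head clusters-cells-unique) (∈-map⁺ clusterCell D∈)

  todo-unique : Unique (map clusterCell (Vec.toList todo))
  todo-unique = subst (Unique ∘ map clusterCell) (sym (toVecᵗ-value Cs₀)) (AllPairs.tail clusters-cells-unique)

  closest-cells : ∀ {T} → All (λ (C , D) → C ∈ clusters × D ∈ clusters) T →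
                  cellEdges (map closest T) ≡ map cellEdge T × All (_∈ toList points) (endpoints (map closest T))
  closest-cells [] = refl , []
  closest-cells {(C , D) ∷ T} ((C∈ , D∈) ∷ T⊆) =
    let u∈ , v∈ = closestPairᵗ-∈ C D
        eq , ends = closest-cells T⊆
    in cong₂ _∷_ (cong₂ _,_ (clusters-homogeneous C∈ u∈) (clusters-homogeneous D∈ v∈)) eq ,
       cluster-point C∈ u∈ ∷ cluster-point D∈ v∈ ∷ ends

  head-endpoint : ∀ es {c} → c ∈ Cells.heads (cellEdges es) → ∃ λ v → v ∈ Points.heads es × cell v ≡ c
  head-endpoint ((u , v) ∷ es) (here refl) = v , here refl , refl
  head-endpoint (e ∷ es)       (there c∈)  = let v , v∈ , eq = head-endpoint es c∈ in v , there v∈ , eq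

  heads⊆endpoints : ∀ es {v} → v ∈ Points.heads es → v ∈ endpoints es
  heads⊆endpoints (e ∷ es) (here refl) = there (here refl)
  heads⊆endpoints (e ∷ es) (there v∈)  = there (there (heads⊆endpoints es v∈))

  endpoint-edge : ∀ es {v} → v ∈ endpoints es → ∃ λ w → (v , w) ∈ es ⊎ (w , v) ∈ es
  endpoint-edge ((u , v) ∷ es) (here refl)         = v , inj₁ (here refl)
  endpoint-edge ((u , v) ∷ es) (there (here refl)) = u , inj₂ (here refl)
  endpoint-edge ((u , v) ∷ es) (there (there w∈))  = let x , e∈ = endpoint-edge es w∈ in x , Sum.map there there e∈

  -- The root cell is never the head of an edge; it is met as the tail of the first one, so there
  -- must be an edge.
  first-tail : ∀ {c} es → Cells.Grow (c ∷ []) (cellEdges es) → 1 ℕ.≤ length es →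
               ∃ λ r → r ∈ endpoints es × cell r ≡ c
  first-tail ((u , v) ∷ es) (Cells.step (here eq) _ _) _ = u , here refl , eq

  N : ℕ
  N = length Cs₀

  private
    prim-tree : List (Cluster × Cluster)
    prim-tree = value (primᵗ (C₀ ∷ []) todo)

    prim-edges : List Edge
    prim-edges = value (mapᵗ (λ (D , E) → closestPairᵗ D E) prim-tree)

  prim-spec : PrimSpec (C₀ ∷ []) todo prim-tree
  prim-spec = primᵗ-spec (C₀ ∷ []) todo (λ { (here refl) → C₀∈ }) (λ D∈ → there (todo⊆ D∈))
    todo-unique (λ { (here refl) D∈ → C₀-differs (todo⊆ D∈) })

  prim-edges≡ : prim-edges ≡ map closest prim-tree
  prim-edges≡ = mapᵗ-value (λ (D , E) → closestPairᵗ D E) prim-tree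

  module SpanningTree {T es₀} (spec : PrimSpec (C₀ ∷ []) todo T) (es₀≡ : es₀ ≡ map closest T) (several : 1 ℕ.≤ length Cs₀) where

    module Prim = PrimSpec spec

    cells₀ : cellEdges es₀ ≡ map cellEdge T
    cells₀ = ≡.trans (cong cellEdges es₀≡) (proj₁ (closest-cells Prim.clusters-∈))

    ends₀⊆ : All (_∈ toList points) (endpoints es₀)
    ends₀⊆ = subst (All (_∈ toList points) ∘ endpoints) (sym es₀≡) (proj₂ (closest-cells Prim.clusters-∈))

    size₀ : length es₀ ≡ length Cs₀
    size₀ = ≡.trans (cong length es₀≡) (≡.trans (length-map closest T) Prim.size-T)

    cluster-endpoint : ∀ es → cellEdges es ≡ map cellEdge T → 1 ℕ.≤ length es →
                       ∀ {C} → C ∈ clusters → ∃ λ v → v ∈ endpoints es × cell v ≡ clusterCell C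
    cluster-endpoint es eq 1≤ (here refl) = first-tail es (subst (Cells.Grow _) (sym eq) Prim.grows) 1≤
    cluster-endpoint es eq 1≤ (there C∈)  =
      let v , v∈ , cv = head-endpoint es (subst (λ l → _ ∈ Cells.heads l) (sym eq) (Prim.covers (⊆todo C∈)))
      in v , heads⊆endpoints es v∈ , cv

    occupied : ∀ {C} → C ∈ clusters → clusterCell C ∈ map cell (endpoints es₀)
    occupied C∈ = let v , v∈ , cv = cluster-endpoint es₀ cells₀ (ℕ.≤-trans several (ℕ.≤-reflexive (sym size₀))) C∈
                  in subst (_∈ map cell (endpoints es₀)) cv (∈-map⁺ cell v∈)

    merged₀ : Merged clusters es₀ (value (mergeAllᵗ I clusters es₀))
    merged₀ = mergeAllᵗ-merged clusters {es₀} id ends₀⊆ occupied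

  module MergedTree {T es₀ es′} (spec : PrimSpec (C₀ ∷ []) todo T) (es₀≡ : es₀ ≡ map closest T) (several : 1 ℕ.≤ length Cs₀)
    (merged : Merged clusters es₀ es′) where

    open SpanningTree spec es₀≡ several
    module M = Merged merged

    cells′ : cellEdges es′ ≡ map cellEdge T
    cells′ = ≡.trans M.cells cells₀

    size′ : length es′ ≡ length Cs₀
    size′ = begin
      length es′                ≡⟨ length-map _ es′ ⟨
      length (cellEdges es′)    ≡⟨ cong length M.cells ⟩
      length (cellEdges es₀)    ≡⟨ length-map _ es₀ ⟩
      length es₀                ≡⟨ size₀ ⟩
      length Cs₀                ∎
      where open ≡-Reasoning

    settled : ∀ {u v} → u ∈ endpoints es′ → v ∈ endpoints es′ → cell u ≡ cell v → u ≡ v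
    settled {u} {v} u∈ v∈ eq =
      let C , C∈ , v∈C = point-cluster (All.lookup M.ends⊆ v∈)
          cv = clusters-homogeneous C∈ v∈C
      in M.settles C∈ u∈ v∈ (≡.trans eq cv) cv

    endpoint′ : ∀ {C} → C ∈ clusters → ∃ λ v → v ∈ endpoints es′ × cell v ≡ clusterCell C
    endpoint′ = cluster-endpoint es′ cells′ (ℕ.≤-trans several (ℕ.≤-reflexive (sym size′)))

    r : Point
    r = proj₁ (endpoint′ C₀∈)

    r∈ : r ∈ endpoints es′
    r∈ = proj₁ (proj₂ (endpoint′ C₀∈))

    -- Merging keeps Prim's tree on cells and leaves one end per cell, so the growth lifts from
    -- cells to points.
    es′-grow : Points.Grow (r ∷ []) es′
    es′-grow = grow-pullback cell
      (subst₂ (λ c es → Cells.Grow (c ∷ []) es) (sym (proj₂ (proj₂ (endpoint′ C₀∈)))) (sym cells′) Prim.grows)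
      (λ { (here refl) (_ , e∈) → settled r∈ (endpoints-fst e∈) })
      (λ e∈ (_ , e∈′) → settled (endpoints-snd e∈) (endpoints-fst e∈′))

    vs′ : List Point
    vs′ = value (filterᵗ (incidentᵗ es′) (toList points))

    ∈vs′ : ∀ {v} → v ∈ endpoints es′ → v ∈ vs′
    ∈vs′ v∈ = ∈-filterᵗ⁺ (incidentᵗ es′) (All.lookup M.ends⊆ v∈) (incidentᵗ-complete es′ v∈)

    vs′⊆ : ∀ {v} → v ∈ vs′ → v ∈ toList points × v ∈ endpoints es′
    vs′⊆ v∈ = let v∈points , eq = ∈-filterᵗ⁻ (incidentᵗ es′) (toList points) v∈ in v∈points , incidentᵗ-sound es′ eq

    grown : ∀ {v} → v ∈ endpoints es′ → v ∈ r ∷ Points.heads es′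
    grown v∈ with endpoint-edge es′ v∈
    ... | w , inj₂ e∈ = there (Points.grow-heads es′-grow e∈)
    ... | w , inj₁ e∈ with Points.grow-tails es′-grow e∈
    ...   | inj₁ (here refl) = here refl
    ...   | inj₂ v∈heads     = there v∈heads

    merged-feasible : IsFeasible I (graph vs′ es′)
    merged-feasible = grow-feasible {vs = vs′} es′-grow (filterᵗ-unique (incidentᵗ es′) distinct)
      (λ v∈ → grown (proj₂ (vs′⊆ v∈)))
      (λ { (here refl) → ∈vs′ r∈ ; (there v∈) → ∈vs′ (heads⊆endpoints es′ v∈) })
      (λ v∈ → proj₁ (vs′⊆ v∈))
      (λ u∈ v∈ → settled (proj₂ (vs′⊆ u∈)) (proj₂ (vs′⊆ v∈)))
      (λ C∈ → let v , v∈ , cv = endpoint′ C∈ in v , ∈vs′ v∈ , in-cluster C∈ (All.lookup M.ends⊆ v∈) cv)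

    -- N edges have 2 N ends, which lie in N + 1 cells, so the charges d - 1 add up to N - 1.
    merging-bound : edgesWeight es′ + √2 ≤ edgesWeight es₀ + fromℕ N * √2
    merging-bound = +-cancelʳ-≤ (fromℕ N * √2) (begin
      edgesWeight es′ + √2 + fromℕ N * √2
        ≡⟨ solve 4 (λ w o n s → w :+ s :+ n :* s := w :+ (con (+ 1) :+ n) :* s) refl _ 1# (fromℕ N) √2 ⟩
      edgesWeight es′ + (fromℕ 1 + fromℕ N) * √2
        ≡⟨ cong (λ k → edgesWeight es′ + k * √2) (fromℕ-+ 1 N) ⟨
      edgesWeight es′ + fromℕ (length clusters) * √2
        ≤⟨ M.bound ⟩
      edgesWeight es₀ + fromℕ (counts (map clusterCell clusters) (map cell (endpoints es₀))) * √2
        ≤⟨ +-monoʳ-≤ (edgesWeight es₀) (subst₂ _≤_ (*-comm √2 _) (*-comm √2 _) (*-monoˡ-≤ √2 0≤√2 (fromℕ-mono-≤ counted))) ⟩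
      edgesWeight es₀ + fromℕ (N ℕ.+ N) * √2
        ≡⟨ cong (λ k → edgesWeight es₀ + k * √2) (fromℕ-+ N N) ⟩
      edgesWeight es₀ + (fromℕ N + fromℕ N) * √2
        ≡⟨ solve 3 (λ w n s → w :+ (n :+ n) :* s := w :+ n :* s :+ n :* s) refl _ (fromℕ N) √2 ⟩
      edgesWeight es₀ + fromℕ N * √2 + fromℕ N * √2 ∎)
      where
      open ≤-Reasoning
      counted : counts (map clusterCell clusters) (map cell (endpoints es₀)) ℕ.≤ N ℕ.+ N
      counted = ℕ.≤-trans (counts-≤ (map cell (endpoints es₀)) clusters-cells-unique) (ℕ.≤-reflexive
        (≡.trans (length-map cell (endpoints es₀)) (≡.trans (length-endpoints es₀)
          (≡.trans (cong (2 ℕ.*_) size₀) (cong (N ℕ.+_) (ℕ.+-identityʳ N))))))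

  module _ {G} (feasible : IsFeasible I G) where

    open Feasible feasible using (cell-injective; representative; reach; from-points; edges-endpoints; growth)

    -- The exchange starts with the vertex of G in `C₀` as the attached part and with all edges of G
    -- available for trade.
    prim-bound : edgesWeight (map closest prim-tree) ≤ weight G
    prim-bound =
      (let r , r∈ , r∈C = representative C₀∈ in
       primᵗ-weight cell-injective (C₀ ∷ []) todo (r ∷ []) (edges G) (there ∘ todo⊆) todo-unique edges-endpoints
        (λ { (here refl) → C₀ , here refl , r∈C }) (cluster-of r∈ r∈C) (reaches r∈ r∈C))
      where
      cluster-of : ∀ {r} → r ∈ vertices G → r ∈ toList C₀ → ∀ {v} → v ∈ vertices G → v ∉ r ∷ [] →
                   ∃ λ D → D ∈ Vec.toList todo × v ∈ toList D
      cluster-of r∈ r∈C v∈ v∉ with point-cluster (All.lookup from-points v∈)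
      ... | D , there D∈ , v∈D  = D , ⊆todo D∈ , v∈D
      ... | D , here refl , v∈C = contradiction (here (cell-injective v∈ r∈
        (≡.trans (clusters-homogeneous C₀∈ v∈C) (sym (clusters-homogeneous C₀∈ r∈C))))) v∉
      reaches : ∀ {r} → r ∈ vertices G → r ∈ toList C₀ → ∀ {D} → D ∈ Vec.toList todo →
                ∃ λ z → z ∈ toList D × z ∈ vertices G × z ∉ r ∷ [] × Reach (r ∷ []) (edges G) z
      reaches r∈ r∈C D∈ = let z , z∈ , z∈D = representative (there (todo⊆ D∈)) in z , z∈D , z∈ ,
        (λ { (here refl) → C₀-differs (todo⊆ D∈) (≡.trans (sym (clusters-homogeneous C₀∈ r∈C))
                             (clusters-homogeneous (there (todo⊆ D∈)) z∈D)) }) ,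
        reach r∈ z∈

    size-bound : fromℕ (suc N) ≤ fromℕ 4 + fromℕ 4 * weight G
    size-bound = let r , r∈ , r∈C = representative C₀∈
                     es , grow , covers , ends , es≤ = growth r∈
                 in ≤-trans
      (subst (λ k → fromℕ k ≤ fromℕ 4 + fromℕ 4 * edgesWeight es) (length-map clusterCell clusters)
        (cells-bound cell (vertices G) grow ends (λ v∈ → point-in-cell (All.lookup from-points v∈))
          (map clusterCell clusters) clusters-cells-unique
          (λ c∈ → let C , C∈ , eq = ∈-map⁻ clusterCell c∈
                      v , v∈ , v∈C = representative C∈
                  in v , covers v∈ , ≡.trans (clusters-homogeneous C∈ v∈C) (sym eq))))
      (+-monoʳ-≤ (fromℕ 4) (*-monoˡ-≤ (fromℕ 4) (fromℕ-nonNegative 4) es≤))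

  module _ (several : 1 ℕ.≤ N) where

    private
      merged : Merged clusters prim-edges (value (mergeAllᵗ I clusters prim-edges))
      merged = SpanningTree.merged₀ prim-spec prim-edges≡ several

    -- The vertices are recovered from the edges, so with a single cluster the result would have
    -- none; hence `several`.
    mstBasedᵗ-feasible : IsFeasible I (value (mstBasedᵗ I C₀ Cs₀))
    mstBasedᵗ-feasible = MergedTree.merged-feasible prim-spec prim-edges≡ several merged

    mstBasedᵗ-weight : ∀ {G} → IsFeasible I G → weight (value (mstBasedᵗ I C₀ Cs₀)) + √2 ≤ weight G + fromℕ N * √2
    mstBasedᵗ-weight {G} feasible = ≤-trans (MergedTree.merging-bound prim-spec prim-edges≡ several merged)
      (+-monoˡ-≤ (fromℕ N * √2) (subst (λ es → edgesWeight es ≤ weight G) (sym prim-edges≡) (prim-bound feasible)))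

-- Polynomial bounds

infixl 6 _⊞_
infixl 7 _⊠_

-- A syntax of bounds that follows the shape of the code being measured; the form c n^k is produced
-- only at the very end.
data Polynomial : Set where
  X       : Polynomial
  K       : ℕ → Polynomial
  _⊞_ _⊠_ : Polynomial → Polynomial → Polynomial

⟦_⟧ : Polynomial → ℕ → ℕ
⟦ X ⟧     n = n
⟦ K c ⟧   n = c
⟦ P ⊞ Q ⟧ n = ⟦ P ⟧ n ℕ.+ ⟦ Q ⟧ n
⟦ P ⊠ Q ⟧ n = ⟦ P ⟧ n ℕ.* ⟦ Q ⟧ n

-- Degrees are added even for a sum: the exponent is cruder than the maximum, but both powers are
-- visibly below the common one when n ≥ 1.
coefficient degree : Polynomial → ℕ
coefficient X       = 1
coefficient (K c)   = c
coefficient (P ⊞ Q) = coefficient P ℕ.+ coefficient Q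
coefficient (P ⊠ Q) = coefficient P ℕ.* coefficient Q
degree X       = 1
degree (K c)   = 0
degree (P ⊞ Q) = degree P ℕ.+ degree Q
degree (P ⊠ Q) = degree P ℕ.+ degree Q

polynomial-≤ : ∀ P {n} → 1 ℕ.≤ n → ⟦ P ⟧ n ℕ.≤ coefficient P ℕ.* n ℕ.^ degree P
polynomial-≤ X {n} 1≤n = ℕ.≤-reflexive (sym (≡.trans (ℕ.*-identityˡ (n ℕ.* 1)) (ℕ.*-identityʳ n)))
polynomial-≤ (K c) 1≤n = ℕ.≤-reflexive (sym (ℕ.*-identityʳ c))
polynomial-≤ (P ⊞ Q) {n@(suc _)} 1≤n = begin
  ⟦ P ⟧ n ℕ.+ ⟦ Q ⟧ n
    ≤⟨ ℕ.+-mono-≤ (polynomial-≤ P 1≤n) (polynomial-≤ Q 1≤n) ⟩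
  a ℕ.* n ℕ.^ d ℕ.+ b ℕ.* n ℕ.^ e
    ≤⟨ ℕ.+-mono-≤ (ℕ.*-monoʳ-≤ a (ℕ.^-monoʳ-≤ n (ℕ.m≤m+n d e))) (ℕ.*-monoʳ-≤ b (ℕ.^-monoʳ-≤ n (ℕ.m≤n+m e d))) ⟩
  a ℕ.* n ℕ.^ (d ℕ.+ e) ℕ.+ b ℕ.* n ℕ.^ (d ℕ.+ e)
    ≡⟨ ℕ.*-distribʳ-+ (n ℕ.^ (d ℕ.+ e)) a b ⟨
  (a ℕ.+ b) ℕ.* n ℕ.^ (d ℕ.+ e) ∎
  where
  open ℕ.≤-Reasoning
  a = coefficient P
  b = coefficient Q
  d = degree P
  e = degree Q
polynomial-≤ (P ⊠ Q) {n} 1≤n = begin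
  ⟦ P ⟧ n ℕ.* ⟦ Q ⟧ n
    ≤⟨ ℕ.*-mono-≤ (polynomial-≤ P 1≤n) (polynomial-≤ Q 1≤n) ⟩
  (a ℕ.* n ℕ.^ d) ℕ.* (b ℕ.* n ℕ.^ e)
    ≡⟨ ℕ.[m*n]*[o*p]≡[m*o]*[n*p] a (n ℕ.^ d) b (n ℕ.^ e) ⟩
  (a ℕ.* b) ℕ.* (n ℕ.^ d ℕ.* n ℕ.^ e)
    ≡⟨ cong ((a ℕ.* b) ℕ.*_) (ℕ.^-distribˡ-+-* n d e) ⟨
  (a ℕ.* b) ℕ.* n ℕ.^ (d ℕ.+ e) ∎
  where
  open ℕ.≤-Reasoning
  a = coefficient P
  b = coefficient Q
  d = degree P
  e = degree Q

polynomially-bounded : ∀ {A : Set} (size f : A → ℕ) P → (∀ x → 1 ℕ.≤ size x) → (∀ x → f x ℕ.≤ ⟦ P ⟧ (size x)) →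
                       ∃[ c ] ∃[ k ] (∀ x → f x ℕ.≤ c ℕ.* size x ℕ.^ k)
polynomially-bounded size f P 1≤ f≤ = coefficient P , degree P , λ x → ℕ.≤-trans (f≤ x) (polynomial-≤ P (1≤ x))

-- Running times of the list operations

module StepCounts where

  open Data.Nat.Solver.+-*-Solver using (solve; _:+_; _:*_; _:=_; con)
  open TimedValues

  private
    variable
      A B : Set

  appendᵗ-steps : (xs ys : List A) → steps (appendᵗ xs ys) ≡ suc (length xs)
  appendᵗ-steps []       ys = refl
  appendᵗ-steps (x ∷ xs) ys = ≡.trans (ℕ.+-comm _ 1) (cong suc (appendᵗ-steps xs ys))

  private
    -- The induction step shared by the list traversals: one more element costs at most b for its
    -- own computation and c for putting the results together.
    loop : ∀ {a r} b L c → a ℕ.≤ b → r ℕ.≤ (1 ℕ.+ L) ℕ.* (c ℕ.+ b) → a ℕ.+ (r ℕ.+ c) ℕ.≤ (2 ℕ.+ L) ℕ.* (c ℕ.+ b)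
    loop b L c a≤ r≤ = ℕ.≤-trans (ℕ.+-mono-≤ a≤ (ℕ.+-monoˡ-≤ c r≤))
      (ℕ.≤-reflexive (solve 3 (λ b c L → b :+ ((con 1 :+ L) :* (c :+ b) :+ c) := (con 2 :+ L) :* (c :+ b)) refl b c L))

  mapᵗ-steps : ∀ L b (f : A → Timed B) xs → length xs ℕ.≤ L → (∀ {x} → x ∈ xs → steps (f x) ℕ.≤ b) →
               steps (mapᵗ f xs) ℕ.≤ (1 ℕ.+ L) ℕ.* (1 ℕ.+ b)
  mapᵗ-steps L b f []       _       _  = s≤s z≤n
  mapᵗ-steps (suc L) b f (x ∷ xs) (s≤s l) f≤ = loop b L 1 (f≤ (here refl)) (mapᵗ-steps L b f xs l (f≤ ∘ there))

  map⁺ᵗ-steps : ∀ L b (f : A → Timed B) xs → length (toList xs) ℕ.≤ L → (∀ {x} → x ∈ toList xs → steps (f x) ℕ.≤ b) →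
                steps (map⁺ᵗ f xs) ℕ.≤ (1 ℕ.+ L) ℕ.* (1 ℕ.+ b)
  map⁺ᵗ-steps (suc L) b f (x ∷ xs) (s≤s l) f≤ = loop b L 1 (f≤ (here refl)) (mapᵗ-steps L b f xs l (f≤ ∘ there))

  concatMapᵗ-steps : ∀ L b l (f : A → Timed (List⁺ B)) xs → length xs ℕ.≤ L →
    (∀ {x} → x ∈ xs → steps (f x) ℕ.≤ b) → (∀ {x} → x ∈ xs → length (toList (value (f x))) ℕ.≤ l) →
    steps (concatMapᵗ f xs) ℕ.≤ (1 ℕ.+ L) ℕ.* (1 ℕ.+ l ℕ.+ b)
  concatMapᵗ-steps L b l f [] _ _ _ = s≤s z≤n
  concatMapᵗ-steps (suc L) b l f (x ∷ xs) (s≤s ≤L) f≤ l≤ = ℕ.≤-trans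
    (ℕ.+-monoʳ-≤ (steps (f x)) (ℕ.+-monoʳ-≤ (steps (concatMapᵗ f xs))
      (ℕ.≤-trans (ℕ.≤-reflexive (appendᵗ-steps (toList (value (f x))) _)) (s≤s (l≤ (here refl))))))
    (loop b L (1 ℕ.+ l) (f≤ (here refl)) (concatMapᵗ-steps L b l f xs ≤L (f≤ ∘ there) (l≤ ∘ there)))

  concatMap⁺ᵗ-steps : ∀ L b l (f : A → Timed (List⁺ B)) xs → length (toList xs) ℕ.≤ L →
    (∀ {x} → x ∈ toList xs → steps (f x) ℕ.≤ b) → (∀ {x} → x ∈ toList xs → length (toList (value (f x))) ℕ.≤ l) →
    steps (concatMap⁺ᵗ f xs) ℕ.≤ (1 ℕ.+ L) ℕ.* (1 ℕ.+ l ℕ.+ b)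
  concatMap⁺ᵗ-steps (suc L) b l f (x ∷ xs) (s≤s ≤L) f≤ l≤ = ℕ.≤-trans
    (ℕ.+-monoʳ-≤ (steps (f x)) (ℕ.+-monoʳ-≤ (steps (concatMapᵗ f xs)) (ℕ.≤-trans
      -- Appending only the tail saves one step, which the final `pure` spends.
      (ℕ.≤-reflexive (≡.trans (cong (ℕ._+ 1) (appendᵗ-steps (List⁺.tail (value (f x))) _)) (ℕ.+-comm _ 1)))
      (s≤s (l≤ (here refl))))))
    (loop b L (1 ℕ.+ l) (f≤ (here refl)) (concatMapᵗ-steps L b l f xs ≤L (f≤ ∘ there) (l≤ ∘ there)))

  concatMap-length : ∀ L l (f : A → List B) xs → length xs ℕ.≤ L → (∀ {x} → x ∈ xs → length (f x) ℕ.≤ l) →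
                     length (concatMap f xs) ℕ.≤ L ℕ.* l
  concatMap-length L l f []       _       l≤ = z≤n
  concatMap-length (suc L) l f (x ∷ xs) (s≤s ≤L) l≤ = ℕ.≤-trans (ℕ.≤-reflexive (length-++ (f x)))
    (ℕ.+-mono-≤ (l≤ (here refl)) (concatMap-length L l f xs ≤L (l≤ ∘ there)))

  concatMap⁺ᵗ-length : ∀ L l (f : A → Timed (List⁺ B)) xs → length (toList xs) ℕ.≤ L →
    (∀ {x} → x ∈ toList xs → length (toList (value (f x))) ℕ.≤ l) →
    length (toList (value (concatMap⁺ᵗ f xs))) ℕ.≤ L ℕ.* l
  concatMap⁺ᵗ-length L l f xs ≤L l≤ = ℕ.≤-trans (ℕ.≤-reflexive (cong length (concatMap⁺ᵗ-value f xs)))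
    (concatMap-length L l (toList ∘ value ∘ f) (toList xs) ≤L l≤)

  mapᵗ-length : (f : A → Timed B) (xs : List A) → length (value (mapᵗ f xs)) ≡ length xs
  mapᵗ-length f xs = ≡.trans (cong length (mapᵗ-value f xs)) (length-map (value ∘ f) xs)

  map⁺ᵗ-length : (f : A → Timed B) (xs : List⁺ A) → length (toList (value (map⁺ᵗ f xs))) ≡ length (toList xs)
  map⁺ᵗ-length f (x ∷ xs) = cong suc (mapᵗ-length f xs)

  filterᵗ-steps : ∀ L b (p : A → Timed Bool) xs → length xs ℕ.≤ L → (∀ x → steps (p x) ℕ.≤ b) →
                  steps (filterᵗ p xs) ℕ.≤ (1 ℕ.+ L) ℕ.* (1 ℕ.+ b)
  filterᵗ-steps L b p []       _       _  = s≤s z≤n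
  filterᵗ-steps (suc L) b p (x ∷ xs) (s≤s l) p≤ = loop b L 1 (p≤ x) (filterᵗ-steps L b p xs l p≤)

  filterᵗ-length : (p : A → Timed Bool) (xs : List A) → length (value (filterᵗ p xs)) ℕ.≤ length xs
  filterᵗ-length p []       = z≤n
  filterᵗ-length p (x ∷ xs) with value (p x)
  ... | true  = s≤s (filterᵗ-length p xs)
  ... | false = ℕ.≤-trans (filterᵗ-length p xs) (ℕ.n≤1+n _)

  lengthᵗ-steps : (xs : List A) → steps (lengthᵗ xs) ≡ suc (length xs)
  lengthᵗ-steps []       = refl
  lengthᵗ-steps (x ∷ xs) = ≡.trans (ℕ.+-comm _ 1) (cong suc (lengthᵗ-steps xs))

  toVecᵗ-steps : (xs : List A) → steps (toVecᵗ xs) ≡ suc (length xs)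
  toVecᵗ-steps []       = refl
  toVecᵗ-steps (x ∷ xs) = ≡.trans (ℕ.+-comm _ 1) (cong suc (toVecᵗ-steps xs))

  selectᵗ-length : ∀ {n} (xs : Vec A (suc n)) → length (toList (value (selectᵗ xs))) ≡ suc n
  selectᵗ-length (x ∷ [])         = refl
  selectᵗ-length (x ∷ xs@(_ ∷ _)) =
    cong suc (≡.trans (mapᵗ-length _ (toList (value (selectᵗ xs)))) (selectᵗ-length xs))

  selectᵗ-steps : ∀ {n L} (xs : Vec A (suc n)) → suc n ℕ.≤ L →
                  steps (selectᵗ xs) ℕ.≤ (1 ℕ.+ n) ℕ.* (3 ℕ.+ L ℕ.* 2)
  selectᵗ-steps (x ∷ []) _ = s≤s z≤n
  selectᵗ-steps {L = L} (x ∷ xs@(_ ∷ _)) le = ℕ.≤-trans (ℕ.+-mono-≤ (selectᵗ-steps xs (ℕ.≤-trans (ℕ.n≤1+n _) le))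
    (ℕ.+-monoˡ-≤ 1 (mapᵗ-steps L 1 _ (toList (value (selectᵗ xs)))
      (ℕ.≤-trans (ℕ.≤-reflexive (selectᵗ-length xs)) (ℕ.≤-trans (ℕ.n≤1+n _) le)) (λ _ → ℕ.≤-refl))))
    (ℕ.≤-reflexive (solve 2 (λ r L → r :+ ((con 1 :+ L) :* con 2 :+ con 1) := con 3 :+ L :* con 2 :+ r) refl _ L))

-- Running times of the parts that compare distances

module RealSteps (R : Reals) where

  open GGMST R
  open Data.Nat.Solver.+-*-Solver using (solve; _:+_; _:*_; _:=_; con)
  open StepCounts
  open TimedValues
  open TimedChoices R
  open Selections R
  open Entry

  private
    variable
      A B : Set

  -- Each comparison evaluates the objective afresh at both candidates, hence b twice.
  argminFromᵗ-steps : ∀ L b (f : A → Timed ℝ) x xs → length (x ∷ xs) ℕ.≤ L → (∀ {y} → y ∈ x ∷ xs → steps (f y) ℕ.≤ b) →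
                      steps (argminFromᵗ f x xs) ℕ.≤ L ℕ.* (2 ℕ.+ (b ℕ.+ b))
  argminFromᵗ-steps (suc L) b f x [] _ f≤ = s≤s z≤n
  argminFromᵗ-steps (suc L) b f x (y ∷ ys) (s≤s l) f≤ = ℕ.≤-trans
    (ℕ.+-mono-≤ (argminFromᵗ-steps L b f y ys l (f≤ ∘ there))
      (ℕ.+-mono-≤ (f≤ (here refl)) (ℕ.+-monoˡ-≤ 2 (f≤ (there (argminFromᵗ-∈ f y ys))))))
    (ℕ.≤-reflexive (solve 2 (λ r b → r :+ (b :+ (b :+ con 2)) := con 2 :+ (b :+ b) :+ r) refl _ b))

  argminᵗ-steps : ∀ L b (f : A → Timed ℝ) xs → length (toList xs) ℕ.≤ L → (∀ {y} → y ∈ toList xs → steps (f y) ℕ.≤ b) →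
                  steps (argminᵗ f xs) ℕ.≤ L ℕ.* (2 ℕ.+ (b ℕ.+ b))
  argminᵗ-steps L b f (x ∷ xs) = argminFromᵗ-steps L b f x xs

  sumᵗ-steps : ∀ L b (f : A → Timed ℝ) xs → length xs ℕ.≤ L → (∀ x → steps (f x) ℕ.≤ b) →
               steps (sumᵗ f xs) ℕ.≤ (1 ℕ.+ L) ℕ.* (1 ℕ.+ b)
  sumᵗ-steps L b f []       _       _  = s≤s z≤n
  sumᵗ-steps (suc L) b f (x ∷ xs) (s≤s l) f≤ = ℕ.≤-trans (ℕ.+-mono-≤ (f≤ x) (ℕ.+-monoˡ-≤ 1 (sumᵗ-steps L b f xs l f≤)))
    (ℕ.≤-reflexive (solve 2 (λ r b → b :+ (r :+ con 1) := con 1 :+ b :+ r) refl _ b))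

  fromℕᵗ-steps : ∀ n → steps (fromℕᵗ n) ≡ suc n
  fromℕᵗ-steps zero    = refl
  fromℕᵗ-steps (suc n) = ≡.trans (ℕ.+-comm _ 1) (cong suc (fromℕᵗ-steps n))

  pairsᵗ-steps : ∀ k l (xs : List⁺ A) (ys : List⁺ B) → length (toList xs) ℕ.≤ k → length (toList ys) ℕ.≤ l →
                 steps (pairsᵗ xs ys) ℕ.≤ (1 ℕ.+ k) ℕ.* (1 ℕ.+ l ℕ.+ (1 ℕ.+ l) ℕ.* 2)
  pairsᵗ-steps k l xs ys k≤ l≤ = concatMap⁺ᵗ-steps k _ l _ xs k≤
    (λ _ → map⁺ᵗ-steps l 1 _ ys l≤ (λ _ → ℕ.≤-refl)) (λ _ → ℕ.≤-trans (ℕ.≤-reflexive (map⁺ᵗ-length _ ys)) l≤)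

  pairsᵗ-length : ∀ k l (xs : List⁺ A) (ys : List⁺ B) → length (toList xs) ℕ.≤ k → length (toList ys) ℕ.≤ l →
                  length (toList (value (pairsᵗ xs ys))) ℕ.≤ k ℕ.* l
  pairsᵗ-length k l xs ys k≤ l≤ = concatMap⁺ᵗ-length k l (λ x → map⁺ᵗ (λ y → pure (x , y)) ys) xs k≤
    (λ _ → ℕ.≤-trans (ℕ.≤-reflexive (map⁺ᵗ-length _ ys)) l≤)

  -- The polynomials bound the running times in terms of a common upper bound n
  -- on the numbers of points and clusters.
  pairsP closestP : Polynomial
  pairsP   = (K 1 ⊞ X) ⊠ (K 1 ⊞ X ⊞ (K 1 ⊞ X) ⊠ K 2)
  closestP = pairsP ⊞ (X ⊠ X) ⊠ (K 2 ⊞ K 12)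

  Small : ℕ → Cluster → Set
  Small n C = length (toList C) ℕ.≤ n

  closestPairᵗ-steps : ∀ n C D → Small n C → Small n D → steps (closestPairᵗ C D) ℕ.≤ ⟦ closestP ⟧ n
  closestPairᵗ-steps n C D C≤ D≤ = ℕ.+-mono-≤ (pairsᵗ-steps n n C D C≤ D≤)
    (argminᵗ-steps (n ℕ.* n) 6 edgeWeightᵗ (value (pairsᵗ C D)) (pairsᵗ-length n n C D C≤ D≤) (λ _ → ℕ.≤-refl))

  primP : Polynomial
  primP = X ⊠ (K 3 ⊞ X ⊠ K 2) ⊞ (pairsP ⊞ ((X ⊠ X) ⊠ (K 2 ⊞ ((closestP ⊞ K 6) ⊞ (closestP ⊞ K 6))) ⊞ K 1))

  primᵗ-steps : ∀ {n k} reached (todo : Vec Cluster k) → All (Small n) (toList reached) → All (Small n) (Vec.toList todo) →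
                length (toList reached) ℕ.+ k ℕ.≤ n → steps (primᵗ reached todo) ℕ.≤ 1 ℕ.+ k ℕ.* ⟦ primP ⟧ n
  primᵗ-steps {k = zero} reached [] _ _ _ = ℕ.≤-refl
  primᵗ-steps {n} {suc k} reached todo reached≤ todo≤ total≤ = ℕ.≤-trans
    (ℕ.+-mono-≤ (ℕ.≤-trans (selectᵗ-steps todo 1+k≤n) (ℕ.*-monoˡ-≤ (3 ℕ.+ n ℕ.* 2) 1+k≤n))
      (ℕ.+-mono-≤ (pairsᵗ-steps n n reached choices reached≤n choices≤n)
        (ℕ.+-mono-≤ (argminᵗ-steps (n ℕ.* n) (⟦ closestP ⟧ n ℕ.+ 6) _ (value (pairsᵗ reached choices))
                      (pairsᵗ-length n n reached choices reached≤n choices≤n)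
                      (λ {y} y∈ → link-steps y y∈))
          (ℕ.+-monoˡ-≤ 1 (primᵗ-steps {n} {k} (D ∷⁺ reached) rest (D≤ ∷ reached≤) rest≤ total≤′)))))
    (ℕ.≤-reflexive (solve 5 (λ a b c k p → a :+ (b :+ (c :+ (con 1 :+ k :* p :+ con 1)))
        := con 1 :+ (a :+ (b :+ (c :+ con 1)) :+ k :* p)) refl
      (n ℕ.* (3 ℕ.+ n ℕ.* 2)) (⟦ pairsP ⟧ n) _ k (⟦ primP ⟧ n)))
    where
    choices = value (selectᵗ todo)
    chosen-link : Cluster × Cluster × Vec Cluster k
    chosen-link = value (argminᵗ (λ (C , (D , _)) → cellDistanceᵗ C D) (value (pairsᵗ reached choices)))
    D = proj₁ (proj₂ chosen-link)
    rest = proj₂ (proj₂ chosen-link)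
    chosen∈ = ∈-pairsᵗ⁻ reached choices (argminᵗ-∈ (λ (C , (D , _)) → cellDistanceᵗ C D) (value (pairsᵗ reached choices)))
    todo≤′ : All (Small n) (D ∷ Vec.toList rest)
    todo≤′ = All-resp-↭ (selectᵗ-sound todo (proj₂ chosen∈)) todo≤
    D≤ = All.head todo≤′
    rest≤ = All.tail todo≤′
    total≤′ : suc (length (toList reached)) ℕ.+ k ℕ.≤ n
    total≤′ = ℕ.≤-trans (ℕ.≤-reflexive (sym (ℕ.+-suc _ k))) total≤
    1+k≤n : suc k ℕ.≤ n
    1+k≤n = ℕ.≤-trans (ℕ.m≤n+m (suc k) (length (toList reached))) total≤
    reached≤n : length (toList reached) ℕ.≤ n
    reached≤n = ℕ.≤-trans (ℕ.m≤m+n _ (suc k)) total≤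
    choices≤n : length (toList choices) ℕ.≤ n
    choices≤n = ℕ.≤-trans (ℕ.≤-reflexive (selectᵗ-length todo)) 1+k≤n
    link-steps : ∀ y → y ∈ toList (value (pairsᵗ reached choices)) →
                 steps (cellDistanceᵗ (proj₁ y) (proj₁ (proj₂ y))) ℕ.≤ ⟦ closestP ⟧ n ℕ.+ 6
    link-steps (C , (D , _)) y∈ = let C∈ , sel∈ = ∈-pairsᵗ⁻ reached choices y∈ in
      ℕ.+-monoˡ-≤ 6 (closestPairᵗ-steps n C D (All.lookup reached≤ C∈)
        (All.lookup todo≤ (∈-resp-↭ (↭-sym (selectᵗ-sound todo sel∈)) (here refl))))

  nodes : CellTree → ℕ
  nodes t = length (clustersOf t)

  nodesBelow : List CellTree → ℕ
  nodesBelow []       = 0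
  nodesBelow (t ∷ ts) = nodes t ℕ.+ nodesBelow ts

  clustersBelow-length : ∀ C ts → length (clustersBelow C ts) ≡ suc (nodesBelow ts)
  clustersBelow-length C []       = refl
  clustersBelow-length C (t ∷ ts) = ≡.trans (length-++ (clustersOf t))
    (≡.trans (cong (nodes t ℕ.+_) (clustersBelow-length C ts)) (ℕ.+-suc (nodes t) (nodesBelow ts)))

  mutual
    attachᵗ-length : ∀ D t → length (toList (value (attachᵗ D t))) ≡ nodes t
    attachᵗ-length D (node C ts) = ≡.trans
      (cong suc (≡.trans (mapᵗ-length (λ ts′ → pure (node C ts′)) (value (attachBelowᵗ D ts))) (attachBelowᵗ-length D ts)))
      (sym (clustersBelow-length C ts))

    attachBelowᵗ-length : ∀ D ts → length (value (attachBelowᵗ D ts)) ≡ nodesBelow ts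
    attachBelowᵗ-length D []       = refl
    attachBelowᵗ-length D (t ∷ ts) = ≡.trans (cong length (appendᵗ-value us _)) (≡.trans (length-++ us)
      (cong₂ ℕ._+_ (≡.trans (mapᵗ-length (λ t′ → pure (t′ ∷ ts)) (toList (value (attachᵗ D t)))) (attachᵗ-length D t))
                   (≡.trans (mapᵗ-length (λ ts′ → pure (t ∷ ts′)) (value (attachBelowᵗ D ts))) (attachBelowᵗ-length D ts))))
      where us = value (mapᵗ (λ t′ → pure (t′ ∷ ts)) (toList (value (attachᵗ D t))))

  nodes-positive : ∀ t → 1 ℕ.≤ nodes t
  nodes-positive (node C ts) = subst (1 ℕ.≤_) (sym (clustersBelow-length C ts)) (s≤s z≤n)

  mutual
    -- Rebuilding the trees costs a linear amount at every level. In the bound 8 (k² + k) for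
    -- forests the linear term pays for it, and 8 is large enough for both recursions.
    attachᵗ-steps : ∀ D t → steps (attachᵗ D t) ℕ.≤ 8 ℕ.* (nodes t ℕ.* nodes t)
    attachᵗ-steps D (node C ts) rewrite clustersBelow-length C ts = ℕ.≤-trans
      (ℕ.+-mono-≤ (attachBelowᵗ-steps D ts)
        (ℕ.+-monoˡ-≤ 1 (mapᵗ-steps k 1 (λ ts′ → pure (node C ts′)) (value (attachBelowᵗ D ts))
          (ℕ.≤-reflexive (attachBelowᵗ-length D ts)) (λ _ → ℕ.≤-refl))))
      (ℕ.≤-trans (ℕ.m≤m+n _ (4 ℕ.+ 6 ℕ.* k)) (ℕ.≤-reflexive (solve 1 (λ k →
        con 1 :+ con 8 :* (k :* k :+ k) :+ ((con 1 :+ k) :* con 2 :+ con 1) :+ (con 4 :+ con 6 :* k)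
        := con 8 :* ((con 1 :+ k) :* (con 1 :+ k))) refl k)))
      where k = nodesBelow ts

    attachBelowᵗ-steps : ∀ D ts → let k = nodesBelow ts in steps (attachBelowᵗ D ts) ℕ.≤ 1 ℕ.+ 8 ℕ.* (k ℕ.* k ℕ.+ k)
    attachBelowᵗ-steps D []       = ℕ.≤-refl
    attachBelowᵗ-steps D (t ∷ ts) = ℕ.≤-trans
      (ℕ.+-mono-≤ (attachᵗ-steps D t) (ℕ.+-mono-≤ (attachBelowᵗ-steps D ts) (ℕ.+-mono-≤
        (mapᵗ-steps m 1 (λ t′ → pure (t′ ∷ ts)) us (ℕ.≤-reflexive (attachᵗ-length D t)) (λ _ → ℕ.≤-refl))
        (ℕ.+-mono-≤ (mapᵗ-steps k 1 (λ ts′ → pure (t ∷ ts′)) (value (attachBelowᵗ D ts))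
            (ℕ.≤-reflexive (attachBelowᵗ-length D ts)) (λ _ → ℕ.≤-refl))
          (ℕ.≤-reflexive (≡.trans (appendᵗ-steps (value (mapᵗ (λ t′ → pure (t′ ∷ ts)) us)) _)
            (cong suc (≡.trans (mapᵗ-length (λ t′ → pure (t′ ∷ ts)) us) (attachᵗ-length D t)))))))))
      (with-slack m k (nodes-positive t))
      where
      m = nodes t
      k = nodesBelow ts
      us = toList (value (attachᵗ D t))
      with-slack : ∀ m k → 1 ℕ.≤ m →
        8 ℕ.* (m ℕ.* m) ℕ.+ (1 ℕ.+ 8 ℕ.* (k ℕ.* k ℕ.+ k) ℕ.+ ((1 ℕ.+ m) ℕ.* 2 ℕ.+ ((1 ℕ.+ k) ℕ.* 2 ℕ.+ (1 ℕ.+ m))))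
        ℕ.≤ 1 ℕ.+ 8 ℕ.* ((m ℕ.+ k) ℕ.* (m ℕ.+ k) ℕ.+ (m ℕ.+ k))
      with-slack (suc m) k _ = ℕ.≤-trans (ℕ.m≤m+n _ (16 ℕ.* (m ℕ.* k) ℕ.+ 14 ℕ.* k ℕ.+ 5 ℕ.* m)) (ℕ.≤-reflexive (solve 2 (λ m′ k →
        let m = con 1 :+ m′ in
        con 8 :* (m :* m) :+ (con 1 :+ con 8 :* (k :* k :+ k) :+ ((con 1 :+ m) :* con 2 :+ ((con 1 :+ k) :* con 2 :+ (con 1 :+ m))))
          :+ (con 16 :* (m′ :* k) :+ con 14 :* k :+ con 5 :* m′)
        := con 1 :+ con 8 :* ((m :+ k) :* (m :+ k) :+ (m :+ k))) refl m k))

  -- The product n! m (m + 1) ... (m + n - 1), counting a tree once for every order of attachment.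
  -- No polynomial bounds it, but it is evaluated only where N is bounded in terms of ε.
  treeCount : ℕ → ℕ → ℕ
  treeCount zero    m = 1
  treeCount (suc n) m = suc n ℕ.* (m ℕ.* treeCount n (suc m))

  treeSteps : ℕ → ℕ → ℕ
  treeSteps zero    m = 1
  treeSteps (suc n) m = suc n ℕ.* (3 ℕ.+ suc n ℕ.* 2) ℕ.+
    (1 ℕ.+ suc n) ℕ.* (1 ℕ.+ m ℕ.* treeCount n (suc m) ℕ.+
      (8 ℕ.* (m ℕ.* m) ℕ.+ (1 ℕ.+ m) ℕ.* (1 ℕ.+ treeCount n (suc m) ℕ.+ treeSteps n (suc m))))

  attached-nodes : ∀ {D t u} → u ∈ toList (value (attachᵗ D t)) → nodes u ≡ suc (nodes t)
  attached-nodes {D} {t} u∈ = ↭-length (attachᵗ-sound D t u∈)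

  spanningTreesᵗ-length : ∀ {n m} t (todo : Vec Cluster n) → nodes t ≡ m →
                          length (toList (value (spanningTreesᵗ t todo))) ℕ.≤ treeCount n m
  spanningTreesᵗ-length {zero}  t []   refl = ℕ.≤-refl
  spanningTreesᵗ-length {suc n} t todo refl = concatMap⁺ᵗ-length (suc n) _
    (λ (D , rest) → attachᵗ D t >>= λ us → concatMap⁺ᵗ (λ u → spanningTreesᵗ {n} u rest) us)
    (value (selectᵗ todo)) (ℕ.≤-reflexive (selectᵗ-length todo))
    (λ { {D , rest} _ → concatMap⁺ᵗ-length (nodes t) _ (λ u → spanningTreesᵗ {n} u rest) (value (attachᵗ D t))
      (ℕ.≤-reflexive (attachᵗ-length D t)) (λ u∈ → spanningTreesᵗ-length _ rest (attached-nodes {D} {t} u∈)) })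

  spanningTreesᵗ-steps : ∀ {n m} t (todo : Vec Cluster n) → nodes t ≡ m →
                         steps (spanningTreesᵗ t todo) ℕ.≤ treeSteps n m
  spanningTreesᵗ-steps {zero}  t []   refl = ℕ.≤-refl
  spanningTreesᵗ-steps {suc n} t todo refl = ℕ.+-mono-≤ (selectᵗ-steps todo ℕ.≤-refl)
    (concatMap⁺ᵗ-steps (suc n) _ _
      (λ (D , rest) → attachᵗ D t >>= λ us → concatMap⁺ᵗ (λ u → spanningTreesᵗ {n} u rest) us)
      (value (selectᵗ todo)) (ℕ.≤-reflexive (selectᵗ-length todo))
      (λ { {D , rest} _ → ℕ.+-mono-≤ (attachᵗ-steps D t)
        (concatMap⁺ᵗ-steps (nodes t) _ _ (λ u → spanningTreesᵗ {n} u rest) (value (attachᵗ D t))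
          (ℕ.≤-reflexive (attachᵗ-length D t))
          (λ u∈ → spanningTreesᵗ-steps _ rest (attached-nodes {D} {t} u∈))
          (λ u∈ → spanningTreesᵗ-length _ rest (attached-nodes {D} {t} u∈))) })
      (λ { {D , rest} _ → concatMap⁺ᵗ-length (nodes t) _ (λ u → spanningTreesᵗ {n} u rest) (value (attachᵗ D t))
        (ℕ.≤-reflexive (attachᵗ-length D t)) (λ u∈ → spanningTreesᵗ-length _ rest (attached-nodes {D} {t} u∈)) }))

  childP tableP : Polynomial
  childP = X ⊠ (K 2 ⊞ K 14) ⊞ (K 7 ⊞ (K 1 ⊞ ((K 1 ⊞ X) ⊞ ((K 1 ⊞ X) ⊞ K 1))))
  tableP = K 2 ⊞ (K 1 ⊞ X) ⊠ (K 1 ⊞ (K 1 ⊞ X ⊠ childP))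

  length-children : ∀ ts → length ts ℕ.≤ nodesBelow ts
  length-children []       = z≤n
  length-children (t ∷ ts) = ℕ.+-mono-≤ (nodes-positive t) (length-children ts)

  tableᵗ-length : ∀ C ts → length (toList (value (tableᵗ (node C ts)))) ≡ length (toList C)
  tableᵗ-length C ts = map⁺ᵗ-length (λ p → entryᵗ p (value (tablesᵗ ts))) C

  solution-size : ∀ {n t} → nodes t ℕ.≤ n → ∀ {e} → e ∈ toList (value (tableᵗ t)) →
                  length (vertices (solution e)) ℕ.≤ n × length (edges (solution e)) ℕ.≤ n
  solution-size {n} {t} m≤n {e} e∈ = let s , _ , sol , _ = tableᵗ-sound t e∈
                                         vs≤ = ℕ.≤-trans (ℕ.≤-reflexive (Pointwise.Pointwise-length (chosen-clusters s))) m≤n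
    in subst (λ G → length (vertices G) ℕ.≤ n) (sym sol) vs≤ ,
       subst (λ G → length (edges G) ℕ.≤ n) (sym sol) (ℕ.≤-trans (ℕ.≤-trans (ℕ.n≤1+n _)
         (ℕ.≤-reflexive (≡.trans (cong suc (sym (length-map proj₂ (links s)))) (sym (↭-length (chosen-↭ s)))))) vs≤)

  entryᵗ-steps : ∀ n p ts → All (λ t → length (toList (value (tableᵗ t))) ℕ.≤ n × nodes t ℕ.≤ n) ts →
                 steps (entryᵗ p (value (tablesᵗ ts))) ℕ.≤ 1 ℕ.+ length ts ℕ.* ⟦ childP ⟧ n
  entryᵗ-steps n p []       []                 = ℕ.≤-refl
  entryᵗ-steps n p (t ∷ ts) ((l≤ , m≤) ∷ all) = ℕ.≤-trans
    (ℕ.+-mono-≤ (entryᵗ-steps n p ts all) (ℕ.+-mono-≤ (argminᵗ-steps n 7 (viaᵗ p) (value (tableᵗ t)) l≤ (λ _ → ℕ.≤-refl))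
      (ℕ.+-monoʳ-≤ 7 (ℕ.+-monoʳ-≤ 1 (ℕ.+-mono-≤ (append≤ (vertices (solution q)) (proj₁ size))
        (ℕ.+-monoˡ-≤ 1 (append≤ (edges (solution q)) (proj₂ size))))))))
    (ℕ.≤-reflexive (solve 2 (λ l c → con 1 :+ l :* c :+ c := con 1 :+ (con 1 :+ l) :* c) refl (length ts) (⟦ childP ⟧ n)))
    where
    q = value (argminᵗ (viaᵗ p) (value (tableᵗ t)))
    size = solution-size {t = t} m≤ (argminᵗ-∈ (viaᵗ p) (value (tableᵗ t)))
    append≤ : ∀ {A : Set} (xs : List A) {ys} → length xs ℕ.≤ n → steps (appendᵗ xs ys) ℕ.≤ 1 ℕ.+ n
    append≤ xs le = ℕ.≤-trans (ℕ.≤-reflexive (appendᵗ-steps xs _)) (s≤s le)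

  root-small : ∀ {n} D us → All (Small n) (clustersBelow D us) → Small n D
  root-small D []       (s ∷ []) = s
  root-small D (u ∷ us) small    = root-small D us (Allₚ.++⁻ʳ (clustersOf u) small)

  subtrees-small : ∀ {n} C ts → All (Small n) (clustersBelow C ts) → nodesBelow ts ℕ.≤ n →
                   All (λ t → length (toList (value (tableᵗ t))) ℕ.≤ n × nodes t ℕ.≤ n) ts
  subtrees-small C []       small le = []
  subtrees-small C (t@(node D us) ∷ ts) small le =
    (ℕ.≤-trans (ℕ.≤-reflexive (tableᵗ-length D us)) (root-small D us (Allₚ.++⁻ˡ (clustersOf t) small)) ,
     ℕ.≤-trans (ℕ.m≤m+n (nodes t) _) le) ∷
    subtrees-small C ts (Allₚ.++⁻ʳ (clustersOf t) small) (ℕ.≤-trans (ℕ.m≤n+m _ (nodes t)) le)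

  mutual
    -- The spare step on the left pays for the `pure` that `tablesᵗ` adds for each child.
    tableᵗ-steps : ∀ n t → All (Small n) (clustersOf t) → nodes t ℕ.≤ n →
                   suc (steps (tableᵗ t)) ℕ.≤ nodes t ℕ.* ⟦ tableP ⟧ n
    tableᵗ-steps n (node C ts) small m≤ rewrite clustersBelow-length C ts = ℕ.≤-trans
      (s≤s (ℕ.+-mono-≤ (tablesᵗ-steps n C ts small k≤)
        (map⁺ᵗ-steps n (1 ℕ.+ n ℕ.* ⟦ childP ⟧ n) (λ p → entryᵗ p (value (tablesᵗ ts))) C (root-small C ts small) (λ {p} _ →
          ℕ.≤-trans (entryᵗ-steps n p ts (subtrees-small C ts small k≤))
            (s≤s (ℕ.*-monoˡ-≤ (⟦ childP ⟧ n) (ℕ.≤-trans (length-children ts) k≤)))))))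
      (ℕ.≤-reflexive (solve 2 (λ t e → con 1 :+ (con 1 :+ t :+ e) := con 2 :+ e :+ t) refl (nodesBelow ts ℕ.* ⟦ tableP ⟧ n) _))
      where
      k≤ : nodesBelow ts ℕ.≤ n
      k≤ = ℕ.≤-trans (ℕ.n≤1+n _) m≤

    tablesᵗ-steps : ∀ n C ts → All (Small n) (clustersBelow C ts) → nodesBelow ts ℕ.≤ n →
                    steps (tablesᵗ ts) ℕ.≤ 1 ℕ.+ nodesBelow ts ℕ.* ⟦ tableP ⟧ n
    tablesᵗ-steps n C []       small k≤ = ℕ.≤-refl
    tablesᵗ-steps n C (t ∷ ts) small k≤ = ℕ.≤-trans
      (ℕ.+-monoʳ-≤ (steps (tableᵗ t)) (ℕ.+-monoˡ-≤ 1 (tablesᵗ-steps n C ts (Allₚ.++⁻ʳ (clustersOf t) small)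
        (ℕ.≤-trans (ℕ.m≤n+m _ (nodes t)) k≤))))
      (ℕ.≤-trans (ℕ.≤-reflexive (solve 2 (λ s r → s :+ (con 1 :+ r :+ con 1) := con 1 :+ ((con 1 :+ s) :+ r)) refl (steps (tableᵗ t)) _))
        (s≤s (ℕ.≤-trans (ℕ.+-monoˡ-≤ _ (tableᵗ-steps n t (Allₚ.++⁻ˡ (clustersOf t) small) (ℕ.≤-trans (ℕ.m≤m+n (nodes t) _) k≤)))
          (ℕ.≤-reflexive (sym (ℕ.*-distribʳ-+ (⟦ tableP ⟧ n) (nodes t) (nodesBelow ts)))))))

  clustersP mergeP filterP mergeAllP mstP bestP : Polynomial
  clustersP = X ⊠ (K 1 ⊞ K 2 ⊠ X)
  mergeP    = K 1 ⊞ (X ⊠ (K 2 ⊞ ((K 1 ⊞ X) ⊠ K 7 ⊞ (K 1 ⊞ X) ⊠ K 7)) ⊞ (K 1 ⊞ X) ⊠ K 6)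
  filterP   = (K 1 ⊞ X) ⊠ (K 1 ⊞ (K 1 ⊞ X ⊠ K 7))
  mergeAllP = filterP ⊞ mergeP
  mstP      = (K 1 ⊞ X) ⊞ ((K 1 ⊞ X ⊠ primP) ⊞ ((K 1 ⊞ X) ⊠ (K 1 ⊞ closestP) ⊞ ((K 1 ⊞ X ⊠ mergeAllP) ⊞ (filterP ⊞ K 1))))
  bestP     = X ⊠ tableP ⊞ X ⊠ K 4

  -- `s` bounds the steps spent on listing the trees and `l` their number; both are constants once N
  -- is bounded.
  exhaustiveP : ℕ → ℕ → Polynomial
  exhaustiveP s l = (K 1 ⊞ X) ⊞ (K s ⊞ ((K 1 ⊞ K l) ⊠ (K 1 ⊞ bestP) ⊞ (K l ⊠ K 4 ⊞ K 1)))

-- Turns the cost of the enumeration, a function of N alone, into a constant for all N up to the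
-- threshold.
max-below : ∀ (f : ℕ → ℕ) k → ∃ λ c → ∀ {m} → m ℕ.≤ k → f m ℕ.≤ c
max-below f zero    = f 0 , λ { z≤n → ℕ.≤-refl }
max-below f (suc k) = let c , f≤ = max-below f k in f (suc k) ℕ.⊔ c , λ {m} m≤ → bound c f≤ (ℕ.m≤n⇒m<n∨m≡n m≤)
  where
  bound : ∀ c {m} → (∀ {m} → m ℕ.≤ k → f m ℕ.≤ c) → m ℕ.< suc k ⊎ m ≡ suc k → f m ℕ.≤ f (suc k) ℕ.⊔ c
  bound c f≤ (inj₁ (s≤s m≤k)) = ℕ.≤-trans (f≤ m≤k) (ℕ.m≤n⊔m (f (suc k)) c)
  bound c f≤ (inj₂ refl)      = ℕ.m≤m⊔n (f (suc k)) c

-- Running times of both branches in terms of the number of points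

module InstanceSteps (R : Reals) (I : GGMST.Instance R) where

  open GGMST R
  open Instance I
  open Data.Nat.Solver.+-*-Solver using (solve; _:+_; _:*_; _:=_; con)
  open StepCounts
  open RealSteps R
  open TimedValues
  open TimedChoices R
  open Selections R
  open Clustering R I
  open PrimTree R I using (module PrimSpec)
  open MstBased R I using (N; prim-spec)
  open Entry

  n : ℕ
  n = size

  clusters-small : ∀ {C} → C ∈ clusters → Small n C
  clusters-small {C} C∈ = unique-⊆-length (cluster-unique {C} C∈) (cluster-point {C} C∈)

  clusters-few : length clusters ℕ.≤ n
  clusters-few = subst₂ ℕ._≤_ (length-map clusterCell clusters) (length-map cell (toList points))
    (unique-⊆-length clusters-cells-unique cells⊆)
    where
    cells⊆ : map clusterCell clusters ⊆ map cell (toList points)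
    cells⊆ c∈ = let C , C∈ , eq = ∈-map⁻ clusterCell c∈ in
      subst (_∈ map cell (toList points)) (sym eq) (∈-map⁺ cell (cluster-point {C} {List⁺.head C} C∈ (here refl)))

  N≤n : N ℕ.≤ n
  N≤n = ℕ.≤-trans (ℕ.n≤1+n N) clusters-few

  insertᵗ-steps : ∀ p Cs → steps (insertᵗ I p Cs) ≡ 1 ℕ.+ 2 ℕ.* length Cs
  insertᵗ-steps p []       = refl
  insertᵗ-steps p (C ∷ Cs) = ≡.trans (cong (λ k → 1 ℕ.+ (k ℕ.+ 1)) (insertᵗ-steps p Cs))
    (solve 1 (λ l → con 1 :+ (con 1 :+ con 2 :* l :+ con 1) := con 1 :+ con 2 :* (con 1 :+ l)) refl (length Cs))

  insertᵗ-length : ∀ p Cs → length (toList (value (insertᵗ I p Cs))) ℕ.≤ suc (length Cs)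
  insertᵗ-length p []       = ℕ.≤-refl
  insertᵗ-length p (C ∷ Cs) with does (cell p ≟ᶜ clusterCell C)
  ... | true  = ℕ.n≤1+n _
  ... | false = s≤s (insertᵗ-length p Cs)

  clustersFromᵗ-length : ∀ p ps → length (toList (value (clustersFromᵗ I p ps))) ℕ.≤ suc (length ps)
  clustersFromᵗ-length p []       = ℕ.≤-refl
  clustersFromᵗ-length p (q ∷ qs) = ℕ.≤-trans (insertᵗ-length p (toList (value (clustersFromᵗ I q qs)))) (s≤s (clustersFromᵗ-length q qs))

  clustersFromᵗ-steps : ∀ m p ps → suc (length ps) ℕ.≤ m →
                        steps (clustersFromᵗ I p ps) ℕ.≤ suc (length ps) ℕ.* (1 ℕ.+ 2 ℕ.* m)
  clustersFromᵗ-steps m p []       le = s≤s z≤n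
  clustersFromᵗ-steps m p (q ∷ qs) le = ℕ.≤-trans
    (ℕ.+-mono-≤ (clustersFromᵗ-steps m q qs (ℕ.≤-trans (ℕ.n≤1+n _) le))
      (ℕ.≤-trans (ℕ.≤-reflexive (insertᵗ-steps p (toList (value (clustersFromᵗ I q qs)))))
        (s≤s (ℕ.*-monoʳ-≤ 2 (ℕ.≤-trans (clustersFromᵗ-length q qs) (ℕ.≤-trans (ℕ.n≤1+n _) le))))))
    (ℕ.≤-reflexive (ℕ.+-comm _ (1 ℕ.+ 2 ℕ.* m)))

  clustersᵗ-steps : steps (clustersᵗ I) ℕ.≤ ⟦ clustersP ⟧ n
  clustersᵗ-steps = clustersFromᵗ-steps n (List⁺.head points) (List⁺.tail points) ℕ.≤-refl

  incidentᵗ-steps : ∀ {m} es p → length es ℕ.≤ m → steps (incidentᵗ es p) ℕ.≤ 1 ℕ.+ m ℕ.* 7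
  incidentᵗ-steps {m} es p le = ℕ.≤-trans (ℕ.≤-reflexive (exact es)) (s≤s (ℕ.*-monoˡ-≤ 7 le))
    where
    exact : ∀ es → steps (incidentᵗ es p) ≡ 1 ℕ.+ length es ℕ.* 7
    exact []       = refl
    exact (e ∷ es) = ≡.trans (cong (λ k → 3 ℕ.+ (3 ℕ.+ (k ℕ.+ 1))) (exact es))
      (solve 1 (λ l → con 3 :+ (con 3 :+ (con 1 :+ l :* con 7 :+ con 1)) := con 1 :+ (con 1 :+ l) :* con 7) refl (length es))

  mergeᵗ-steps : ∀ {m} C us es → length (toList C) ℕ.≤ m → length us ℕ.≤ m → length es ℕ.≤ m →
                 steps (mergeᵗ I C us es) ℕ.≤ ⟦ mergeP ⟧ m
  mergeᵗ-steps     C []               es C≤ us≤ es≤ = s≤s z≤n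
  mergeᵗ-steps     C (_ ∷ [])         es C≤ us≤ es≤ = s≤s z≤n
  mergeᵗ-steps {m} C us@(_ ∷ _ ∷ _) es C≤ us≤ es≤ = ℕ.≤-trans
    (ℕ.+-mono-≤ (argminᵗ-steps m ((1 ℕ.+ m) ℕ.* 7) cost C C≤ (λ {p} _ → sumᵗ-steps m 6 (λ c → distᵗ c p) us us≤ (λ _ → ℕ.≤-refl)))
                (mapᵗ-steps m 5 _ es es≤ (λ _ → ℕ.≤-refl)))
    (ℕ.n≤1+n _)
    where
    cost : Point → Timed ℝ
    cost p = sumᵗ (λ c → distᵗ c p) us

  mergeᵗ-length : ∀ C us es → length (value (mergeᵗ I C us es)) ≡ length es
  mergeᵗ-length C []            es = refl
  mergeᵗ-length C (_ ∷ [])      es = refl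
  mergeᵗ-length C (_ ∷ _ ∷ _) es = mapᵗ-length _ es

  mergeAllᵗ-length : ∀ Cs es → length (value (mergeAllᵗ I Cs es)) ≡ length es
  mergeAllᵗ-length []       es = refl
  mergeAllᵗ-length (C ∷ Cs) es = ≡.trans (mergeAllᵗ-length Cs _)
    (mergeᵗ-length C (value (filterᵗ (incidentᵗ es) (toList C))) es)

  mergeAllᵗ-steps : ∀ {m} Cs es → All (Small m) Cs → length es ℕ.≤ m →
                    steps (mergeAllᵗ I Cs es) ℕ.≤ 1 ℕ.+ length Cs ℕ.* ⟦ mergeAllP ⟧ m
  mergeAllᵗ-steps     []       es []           es≤ = ℕ.≤-refl
  mergeAllᵗ-steps {m} (C ∷ Cs) es (C≤ ∷ Cs≤) es≤ = ℕ.≤-trans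
    (ℕ.+-mono-≤ (filterᵗ-steps m (1 ℕ.+ m ℕ.* 7) (incidentᵗ es) (toList C) C≤ (λ p → incidentᵗ-steps es p es≤))
      (ℕ.+-mono-≤ (mergeᵗ-steps C C-G es C≤ (ℕ.≤-trans (filterᵗ-length (incidentᵗ es) (toList C)) C≤) es≤)
        (mergeAllᵗ-steps Cs (value (mergeᵗ I C C-G es)) Cs≤ (ℕ.≤-trans (ℕ.≤-reflexive (mergeᵗ-length C C-G es)) es≤))))
    (ℕ.≤-reflexive (solve 3 (λ f g r → f :+ (g :+ (con 1 :+ r)) := con 1 :+ (f :+ g :+ r)) refl (⟦ filterP ⟧ m) (⟦ mergeP ⟧ m) _))
    where C-G = value (filterᵗ (incidentᵗ es) (toList C))

  mstBasedᵗ-steps : steps (mstBasedᵗ I C₀ Cs₀) ℕ.≤ ⟦ mstP ⟧ n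
  mstBasedᵗ-steps = ℕ.+-mono-≤ (ℕ.≤-trans (ℕ.≤-reflexive (toVecᵗ-steps Cs₀)) (s≤s N≤n))
    (ℕ.+-mono-≤ (ℕ.≤-trans (primᵗ-steps (C₀ ∷ []) todo (small {C₀} C₀∈ ∷ []) todo-small clusters-few)
                  (s≤s (ℕ.*-monoˡ-≤ (⟦ primP ⟧ n) N≤n)))
      (ℕ.+-mono-≤ (mapᵗ-steps n (⟦ closestP ⟧ n) (λ (D , E) → closestPairᵗ D E) prim-tree prim≤
          (λ { {D , E} DE∈ → let D∈ , E∈ = All.lookup (PrimSpec.clusters-∈ prim-spec) DE∈
                         in closestPairᵗ-steps n D E (small {D} D∈) (small {E} E∈) }))
        (ℕ.+-mono-≤ (ℕ.≤-trans (mergeAllᵗ-steps clusters es (All.tabulate small) es≤)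
                      (s≤s (ℕ.*-monoˡ-≤ (⟦ mergeAllP ⟧ n) clusters-few)))
          (ℕ.+-monoˡ-≤ 1 (filterᵗ-steps n (1 ℕ.+ n ℕ.* 7) (incidentᵗ es′) (toList points) ℕ.≤-refl (λ p → incidentᵗ-steps es′ p es′≤))))))
    where
    small : ∀ {C} → C ∈ clusters → Small n C
    small {C} = clusters-small {C}
    todo = value (toVecᵗ Cs₀)
    prim-tree = value (primᵗ (C₀ ∷ []) todo)
    es = value (mapᵗ (λ (D , E) → closestPairᵗ D E) prim-tree)
    es′ = value (mergeAllᵗ I clusters es)
    todo-small : All (Small n) (Vec.toList todo)
    todo-small = subst (All (Small n)) (sym (toVecᵗ-value Cs₀)) (All.tabulate (small ∘ there))
    prim≤ : length prim-tree ℕ.≤ n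
    prim≤ = ℕ.≤-trans (ℕ.≤-reflexive (PrimSpec.size-T prim-spec)) N≤n
    es≤ : length es ℕ.≤ n
    es≤ = ℕ.≤-trans (ℕ.≤-reflexive (mapᵗ-length _ prim-tree)) prim≤
    es′≤ : length es′ ℕ.≤ n
    es′≤ = ℕ.≤-trans (ℕ.≤-reflexive (mergeAllᵗ-length clusters es)) es≤

  bestForᵗ-steps : ∀ t → All (Small n) (clustersOf t) → nodes t ℕ.≤ n → steps (bestForᵗ t) ℕ.≤ ⟦ bestP ⟧ n
  bestForᵗ-steps t@(node C ts) small m≤ = ℕ.+-mono-≤
    (ℕ.≤-trans (ℕ.n≤1+n _) (ℕ.≤-trans (tableᵗ-steps n t small m≤) (ℕ.*-monoˡ-≤ (⟦ tableP ⟧ n) m≤)))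
    (argminᵗ-steps n 1 (pure ∘ W) (value (tableᵗ t))
      (ℕ.≤-trans (ℕ.≤-reflexive (tableᵗ-length C ts)) (root-small C ts small)) (λ _ → ℕ.≤-refl))

  exhaustiveᵗ-steps : ∀ {s l} → treeSteps N 1 ℕ.≤ s → treeCount N 1 ℕ.≤ l →
                      steps (exhaustiveᵗ C₀ Cs₀) ℕ.≤ ⟦ exhaustiveP s l ⟧ n
  exhaustiveᵗ-steps {s} {l} s≤ l≤ = ℕ.+-mono-≤ (ℕ.≤-trans (ℕ.≤-reflexive (toVecᵗ-steps Cs₀)) (s≤s N≤n))
    (ℕ.+-mono-≤ (ℕ.≤-trans (spanningTreesᵗ-steps (node C₀ []) todo refl) s≤)
      (ℕ.+-mono-≤ (map⁺ᵗ-steps l (⟦ bestP ⟧ n) bestForᵗ trees trees≤ best≤)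
        (ℕ.+-monoˡ-≤ 1 (argminᵗ-steps l 1 (pure ∘ W) (value (map⁺ᵗ bestForᵗ trees))
          (ℕ.≤-trans (ℕ.≤-reflexive (map⁺ᵗ-length bestForᵗ trees)) trees≤) (λ _ → ℕ.≤-refl)))))
    where
    todo = value (toVecᵗ Cs₀)
    trees = value (spanningTreesᵗ (node C₀ []) todo)
    trees≤ : length (toList trees) ℕ.≤ l
    trees≤ = ℕ.≤-trans (spanningTreesᵗ-length (node C₀ []) todo refl) l≤
    tree↭ : ∀ {t} → t ∈ toList trees → clustersOf t ↭ clusters
    tree↭ t∈ = trans (spanningTreesᵗ-sound (node C₀ []) todo t∈)
      (trans (shift C₀ (Vec.toList todo) []) (↭-reflexive (cong (C₀ ∷_) (≡.trans (++-identityʳ _) (toVecᵗ-value Cs₀)))))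
    best≤ : ∀ {t} → t ∈ toList trees → steps (bestForᵗ t) ℕ.≤ ⟦ bestP ⟧ n
    best≤ {t} t∈ = bestForᵗ-steps t (All-resp-↭ (↭-sym (tree↭ t∈)) (All.tabulate clusters-small))
      (ℕ.≤-trans (ℕ.≤-reflexive (↭-length (tree↭ t∈))) clusters-few)

-- The branching condition and the approximation ratio

fromℕᵗ-value : ∀ (R : Reals) → let open GGMST R in ∀ n → value (fromℕᵗ n) ≡ fromℕ n
fromℕᵗ-value R zero    = refl
fromℕᵗ-value R (suc n) = cong (λ z → 1# + z) (fromℕᵗ-value R n)
  where open GGMST R

module Threshold (R : Reals) (ε : GGMST.ℝ R) where

  open GGMST R
  open PlaneGeometry R

  threshold : ℝ
  threshold = fromℕ 10 * √ (fromℕ 2) * ε ⁻¹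

  -- An Archimedean bound `k` on the real threshold gives a natural bound on N that depends on ε
  -- alone.
  isSmallᵗ-true : ∀ I {N k} → threshold ≤ fromℕ k → value (isSmallᵗ I ε N) ≡ true → N ℕ.≤ 15 ℕ.⊔ k
  isSmallᵗ-true I {N} {k} y≤k eq with N ℕ.≤ᵇ 15 in eq₁ | value (fromℕᵗ N) ≤? threshold
  ... | true  | _      = ℕ.≤-trans (ℕ.≤ᵇ⇒≤ N 15 (subst T (sym eq₁) _)) (ℕ.m≤m⊔n 15 k)
  ... | false | yes le = ℕ.≤-trans (fromℕ-cancel-≤ (≤-trans (subst (_≤ threshold) (fromℕᵗ-value R N) le) y≤k)) (ℕ.m≤n⊔m 15 k)
  isSmallᵗ-true I y≤k () | false | no _

  isSmallᵗ-false : ∀ I {N} → value (isSmallᵗ I ε N) ≡ false → 16 ℕ.≤ N × threshold ≤ fromℕ N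
  isSmallᵗ-false I {N} eq with N ℕ.≤ᵇ 15 in eq₁ | value (fromℕᵗ N) ≤? threshold
  ... | false | no ¬le = ℕ.≰⇒> (λ N≤15 → subst T eq₁ (ℕ.≤⇒≤ᵇ N≤15)) , subst (threshold ≤_) (fromℕᵗ-value R N) (≰⇒≥ ¬le)
  isSmallᵗ-false I () | true  | _
  isSmallᵗ-false I () | false | yes _

  open Solver

  -- Since N ≥ 16, 16 (N - 3) ≥ 13 N, so that 16 ε (N - 3) ≥ 130√2 ≥ 128√2; and
  -- 4 (4√2 + ε) W ≥ (4√2 + ε) (N - 3).
  approximation : ∀ {N w W} → 0# < ε → 16 ℕ.≤ N → threshold ≤ fromℕ N →
                  w + √ (fromℕ 2) ≤ W + fromℕ N * √ (fromℕ 2) → fromℕ (suc N) ≤ fromℕ 4 + fromℕ 4 * W →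
                  w ≤ (1# + fromℕ 4 * √ (fromℕ 2) + ε) * W
  approximation {N} {w} {W} (0≤ε , 0≢ε) 16≤N y≤N w≤ N≤ =
    -- The solver reads the numeral one as `1# + 0#`, while the ratio is stated with `1#`.
    subst (λ o → w ≤ (o + fromℕ 4 * s + ε) * W) (+-identityʳ 1#)
      (*-cancelˡ-≤ (fromℕ 64) (fromℕ-nonNegative 64 , 0≢64) (by-difference slack
        (solve 5 (λ w W n s ε →
          con (+ 64) :* (W :+ n :* s :- (w :+ s))
            :+ con (+ 16) :* ((con (+ 4) :* s :+ ε) :* (con (+ 4) :+ con (+ 4) :* W :- (con (+ 1) :+ n)))
            :+ con (+ 13) :* (ε :* n :- con (+ 10) :* s)
            :+ con (+ 3) :* (ε :* (n :- con (+ 16)))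
            :+ con (+ 2) :* s
          := con (+ 64) :* ((con (+ 1) :+ con (+ 4) :* s :+ ε) :* W) :- con (+ 64) :* w) refl w W n s ε)))
    where
    n = fromℕ N
    s = √ (fromℕ 2)
    0≢64 : 0# ≢ fromℕ 64
    0≢64 eq = contradiction (fromℕ-cancel-≤ {64} {0} (≤-reflexive (sym eq))) λ ()
    10s≤εn : fromℕ 10 * s ≤ ε * n
    10s≤εn = subst (_≤ ε * n) (begin
        ε * (fromℕ 10 * s * ε ⁻¹)   ≡⟨ solve 3 (λ e a i → e :* (a :* i) := a :* (e :* i)) refl ε (fromℕ 10 * s) (ε ⁻¹) ⟩
        fromℕ 10 * s * (ε * ε ⁻¹)   ≡⟨ cong (fromℕ 10 * s *_) (*-inverseʳ ε (λ ε≡0 → 0≢ε (sym ε≡0))) ⟩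
        fromℕ 10 * s * 1#           ≡⟨ *-identityʳ _ ⟩
        fromℕ 10 * s                ∎)
      (*-monoˡ-≤ ε 0≤ε y≤N)
      where open ≡-Reasoning
    scaled : ∀ k {x} → 0# ≤ x → 0# ≤ fromℕ k * x
    scaled k = *-nonNegative (fromℕ-nonNegative k)
    N≤′ : fromℕ 1 + n ≤ fromℕ 4 + fromℕ 4 * W
    N≤′ = subst (_≤ fromℕ 4 + fromℕ 4 * W) (fromℕ-+ 1 N) N≤
    slack = +-nonNegative (+-nonNegative (+-nonNegative (+-nonNegative
      (scaled 64 (x≤y⇒0≤y-x w≤))
      (scaled 16 (*-nonNegative (+-nonNegative (scaled 4 0≤√2) 0≤ε) (x≤y⇒0≤y-x N≤′))))
      (scaled 13 (x≤y⇒0≤y-x 10s≤εn)))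
      (scaled 3 (*-nonNegative 0≤ε (x≤y⇒0≤y-x (fromℕ-mono-≤ 16≤N)))))
      (scaled 2 0≤√2)

-- Putting both branches together

module Guarantee (R : Reals) (ε : GGMST.ℝ R) (0<ε : Reals._<_ R (Reals.0# R) ε) where

  open GGMST R
  open PlaneGeometry R
  open Threshold R ε
  open TimedValues

  private
    k : ℕ
    k = proj₁ (archimedean threshold)

    max-steps = max-below (λ m → RealSteps.treeSteps R m 1) (15 ℕ.⊔ k)
    max-count = max-below (λ m → RealSteps.treeCount R m 1) (15 ℕ.⊔ k)

  open RealSteps R using (clustersP; exhaustiveP; mstP)

  -- Fixed before any instance is given, since the constants come from ε through `k`. Both branches
  -- are added because either may be taken.
  branchP totalP : Polynomial
  branchP = exhaustiveP (proj₁ max-steps) (proj₁ max-count) ⊞ mstP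
  totalP  = clustersP ⊞ ((K 1 ⊞ X) ⊞ ((K 7 ⊞ X) ⊞ branchP))

  module _ (I : Instance) where

    open Clustering R I using (C₀; Cs₀)
    open MstBased R I using (N; mstBasedᵗ-feasible; mstBasedᵗ-weight; size-bound)
    open Exhaustive R I using (exhaustiveᵗ-feasible; exhaustiveᵗ-minimum)
    open InstanceSteps R I

    branch : Bool → Timed Graph
    branch b = if b then exhaustiveᵗ C₀ Cs₀ else mstBasedᵗ I C₀ Cs₀

    small : Bool
    small = value (isSmallᵗ I ε (value (lengthᵗ Cs₀)))

    N≡ : value (lengthᵗ Cs₀) ≡ N
    N≡ = lengthᵗ-value Cs₀

    branch-steps : ∀ b → small ≡ b → steps (branch b) ℕ.≤ ⟦ branchP ⟧ n
    branch-steps true  eq = ℕ.≤-trans (exhaustiveᵗ-steps (proj₂ max-steps N≤) (proj₂ max-count N≤))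
      (ℕ.m≤m+n (⟦ exhaustiveP (proj₁ max-steps) (proj₁ max-count) ⟧ n) (⟦ mstP ⟧ n))
      where
      N≤ : N ℕ.≤ 15 ℕ.⊔ k
      N≤ = subst (ℕ._≤ 15 ℕ.⊔ k) N≡ (isSmallᵗ-true I {k = k} (proj₂ (archimedean threshold)) eq)
    branch-steps false eq = ℕ.≤-trans mstBasedᵗ-steps (ℕ.m≤n+m (⟦ mstP ⟧ n) (⟦ exhaustiveP (proj₁ max-steps) (proj₁ max-count) ⟧ n))

    isSmallᵗ-steps : ∀ m → steps (isSmallᵗ I ε m) ≡ 7 ℕ.+ m
    isSmallᵗ-steps m = cong suc (≡.trans (cong (ℕ._+ 5) (RealSteps.fromℕᵗ-steps R m)) (ℕ.+-comm (suc m) 5))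

    𝒜-steps : steps (𝒜 I ε) ℕ.≤ ⟦ totalP ⟧ n
    𝒜-steps = ℕ.+-mono-≤ clustersᵗ-steps
      (ℕ.+-mono-≤ (ℕ.≤-trans (ℕ.≤-reflexive (StepCounts.lengthᵗ-steps Cs₀)) (s≤s N≤n))
        (ℕ.+-mono-≤ (ℕ.≤-trans (ℕ.≤-reflexive (isSmallᵗ-steps (value (lengthᵗ Cs₀)))) (ℕ.+-monoʳ-≤ 7 (subst (ℕ._≤ n) (sym N≡) N≤n)))
          (branch-steps small refl)))

    large : ∀ {b} → small ≡ b → b ≡ false → 16 ℕ.≤ N × threshold ≤ fromℕ N
    large eq refl = subst (λ m → 16 ℕ.≤ m × threshold ≤ fromℕ m) N≡ (isSmallᵗ-false I eq)

    branch-feasible : ∀ b → small ≡ b → IsFeasible I (value (branch b))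
    branch-feasible true  eq = exhaustiveᵗ-feasible
    branch-feasible false eq = mstBasedᵗ-feasible (ℕ.≤-trans (s≤s z≤n) (proj₁ (large eq refl)))

    branch-weight : ∀ b → small ≡ b → ∀ {G} → IsFeasible I G →
                    weight (value (branch b)) ≤ (1# + fromℕ 4 * √ (fromℕ 2) + ε) * weight G
    branch-weight true  eq {G} feasible = ≤-trans (exhaustiveᵗ-minimum feasible)
      -- The output is optimal here, so it suffices that the ratio is at least one and the weight
      -- non-negative.
      (by-difference (*-nonNegative (+-nonNegative (*-nonNegative (fromℕ-nonNegative 4) 0≤√2) (proj₁ 0<ε))
          (edgesWeight-nonNegative (edges G)))
        (≡.trans (solve 3 (λ s e w → (con (+ 4) :* s :+ e) :* w
            := (con (+ 1) :+ con (+ 4) :* s :+ e) :* w :- w) refl (√ (fromℕ 2)) ε (weight G))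
          (cong (λ o → (o + fromℕ 4 * √ (fromℕ 2) + ε) * weight G - weight G) (+-identityʳ 1#))))
      where open Solver
    branch-weight false eq feasible = let 16≤N , y≤N = large eq refl
                                          several = ℕ.≤-trans (s≤s z≤n) 16≤N
      in approximation 0<ε 16≤N y≤N (mstBasedᵗ-weight several feasible) (size-bound feasible)

    𝒜-feasible : IsFeasible I (value (𝒜 I ε))
    𝒜-feasible = branch-feasible small refl

    𝒜-weight : ∀ {G} → IsFeasible I G → weight (value (𝒜 I ε)) ≤ (1# + fromℕ 4 * √ (fromℕ 2) + ε) * weight G
    𝒜-weight = branch-weight small refl

theorem3 : (R : Reals) → let open GGMST R in
    (ε : ℝ) → 0# < ε →
    (∃[ c ] ∃[ k ] ((I : Instance) → steps (𝒜 I ε) ℕ.≤ c ℕ.* Instance.size I ℕ.^ k))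
    ×
    ((I : Instance) →
    IsFeasible I (value (𝒜 I ε))
    ×
    (∀ T-opt → IsOptimal I T-opt →
    weight (value (𝒜 I ε)) ≤ (1# + fromℕ 4 * √ (fromℕ 2) + ε) * weight T-opt))
theorem3 R ε 0<ε =
  polynomially-bounded (GGMST.Instance.size {R}) (λ I → steps (GGMST.𝒜 R I ε)) totalP (λ _ → s≤s z≤n) 𝒜-steps ,
  λ I → 𝒜-feasible I , λ T-opt optimal → 𝒜-weight I (GGMST.IsOptimal.feasible optimal)
  where open Guarantee R ε 0<ε
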